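{- Let $\nu$ be a positive integer, and let $N_k = n_k+n_{k+1}+\dots +n_{\nu}$, for $k=1,2,\dots, \nu$. Then, for non-negative integers $L,M$, \begin{align*} \sum_{\substack{m,n_1,n_2,\dots,n_\nu\geq 0,\\ L+m\equiv N_1+N_2+\dots +N_\nu\text{ (mod 2)}}} &q^{m^2+3(N_1^2+N_2^2+\dots+N_\nu^2)}{L+M-N_1\brack L}_{q^6} {3n_\nu \brack m}_{q^2}\\ &\times{2n_\nu + \frac{L-m-N_1-N_2-\dots-N_\nu}{2}\brack 2n_\nu}_{q^6} \prod_{j=1}^{\nu-1}{L-\sum_{l=1}^{j} N_l+n_j \brack n_j}_{q^6}\\ & = \sum_{j=-\infty}^\infty q^{3(\nu+1)j^2+2j}\, \mathcal{T}\left(L,M;\,(\nu+1)j,\,j;\,q^6\right). \end{align*}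
   Context: Here $|q|<1$, $(a;q)_n=(1-a)(1-aq)\cdots(1-aq^{n-1})$, and ${m+n \brack m}_q = \frac{(q;q)_{m+n}}{(q;q)_m(q;q)_n}$ for $m,n\geq 0$ and $0$ otherwise. The refined $q$-trinomial coefficient is \[\mathcal{T}(L,M;\,a,b;\,q) := \sum_{\substack{n\geq0, \\ L-a\equiv n \text{ (mod 2)}}} q^{\frac{n^2}{2}} {M\brack n}_q {M+b+\frac{L-a-n}{2} \brack M+b}_q {M-b +\frac{L+a-n}{2}\brack M-b}_q.\] -}

module Defs where

open import Algebra.Bundles using (CommutativeRing)
open import Data.Nat as ℕ using (ℕ; zero; suc; _∸_; ⌊_/2⌋)
open import Data.Integer as ℤ using (ℤ; +_; -[1+_])
open import Data.Bool using (Bool; true; false; if_then_else_)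
open import Data.List as List using (List; []; _∷_)
open import Data.Vec.Functional as VF using (Vector)
open import Data.Nat.ListAction using (sum)

-- ℤ halving (exact on even integers, which is the only way it is used)
half : ℤ → ℤ
half (+ n) = + ⌊ n /2⌋
half -[1+ n ] = ℤ.- (+ ⌊ suc n /2⌋)

isEven : ℤ → Bool
isEven x = ⌊ ℤ.∣ x ∣ /2⌋ ℕ.* 2 ℕ.≡ᵇ ℤ.∣ x ∣

nth : List ℕ → ℕ → ℕ
nth [] _ = 0
nth (x ∷ xs) zero = x
nth (x ∷ xs) (suc i) = nth xs i

module QDefs {c ℓ} (R : CommutativeRing c ℓ) where
  open CommutativeRing R

  pow : Carrier → ℕ → Carrier
  pow x zero = 1#
  pow x (suc n) = x * pow x n

  -- Gaussian polynomial  gauss p n k = [n brack k]_p  (q-Pascal recurrence;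
  -- equals (p;p)_n / ((p;p)_k (p;p)_{n-k}) for k ≤ n and 0 for k > n)
  gauss : Carrier → ℕ → ℕ → Carrier
  gauss p n zero = 1#
  gauss p zero (suc k) = 0#
  gauss p (suc n) (suc k) = gauss p n k + pow p (suc k) * gauss p n (suc k)

  bracket : Carrier → ℤ → ℤ → Carrier
  bracket p (+ a) (+ b) = if b ℕ.≤ᵇ a then gauss p a b else 0#
  bracket p _ _ = 0#

  sumRange : ℕ → (ℕ → Carrier) → Carrier
  sumRange zero f = 0#
  sumRange (suc n) f = sumRange n f + f n

  prodRange : ℕ → (ℕ → Carrier) → Carrier
  prodRange zero f = 1#
  prodRange (suc n) f = prodRange n f * f n

  sumBox : (k B : ℕ) → (Vector ℕ k → Carrier) → Carrier
  sumBox zero B F = F (λ ())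
  sumBox (suc k) B F = sumRange (suc B) (λ x → sumBox k B (λ f → F (x VF.∷ f)))

  sumSym : ℕ → (ℤ → Carrier) → Carrier
  sumSym K F = F (+ 0) + sumRange K (λ i → F (+ suc i) + F -[1+ i ])

  -- Refined q-trinomial T(L,M;a,b;r²) written in terms of r, so that
  -- the factor (r²)^{n²/2} is r^{n²}.  The range n ≤ M loses nothing,
  -- since [M brack n] = 0 for n > M.
  trinomialSq : (r : Carrier) (L M : ℕ) (a b : ℤ) → Carrier
  trinomialSq r L M a b = sumRange (suc M) term
    where
      p = pow r 2
      term : ℕ → Carrier
      term n = if isEven ((+ L) ℤ.- a ℤ.- (+ n))
               then pow r (n ℕ.* n)
                    * bracket p (+ M) (+ n)
                    * bracket p ((+ M) ℤ.+ b ℤ.+ half ((+ L) ℤ.- a ℤ.- (+ n))) ((+ M) ℤ.+ b)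
                    * bracket p ((+ M) ℤ.- b ℤ.+ half ((+ L) ℤ.+ a ℤ.- (+ n))) ((+ M) ℤ.- b)
               else 0#

  lhsTerm : (q : Carrier) (ν L M m : ℕ) (ns : List ℕ) → Carrier
  lhsTerm q ν L M m ns =
    if isEven ((+ L) ℤ.+ (+ m) ℤ.- (+ S))
    then pow q (m ℕ.* m ℕ.+ 3 ℕ.* SQ)
         * bracket q6 ((+ L) ℤ.+ (+ M) ℤ.- (+ N 1)) (+ L)
         * bracket q2 (+ (3 ℕ.* n ν)) (+ m)
         * bracket q6 ((+ (2 ℕ.* n ν)) ℤ.+ half ((+ L) ℤ.- (+ m) ℤ.- (+ S))) (+ (2 ℕ.* n ν))
         * prodRange (ν ∸ 1) (λ i → let j = suc i in
              bracket q6 ((+ L) ℤ.- (+ partial j) ℤ.+ (+ n j)) (+ n j))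
    else 0#
    where
      q2 = pow q 2
      q6 = pow q 6
      n : ℕ → ℕ
      n l = nth ns (l ∸ 1)
      N : ℕ → ℕ
      N k = sum (List.drop (k ∸ 1) ns)
      partial : ℕ → ℕ
      partial zero = 0
      partial (suc j) = partial j ℕ.+ N (suc j)
      S = partial ν
      partialSq : ℕ → ℕ
      partialSq zero = 0
      partialSq (suc j) = partialSq j ℕ.+ N (suc j) ℕ.* N (suc j)
      SQ = partialSq ν

  -- LHS, with m and every n_i summed over 0..B
  -- (for B ≥ 3M this is the whole sum: nonzero terms have N_1 ≤ M and m ≤ 3 n_ν)
  lhs : (q : Carrier) (ν L M B : ℕ) → Carrier
  lhs q ν L M B = sumRange (suc B) (λ m → sumBox ν B (λ f → lhsTerm q ν L M m (VF.toList f)))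

  -- RHS, with j summed over -K..K
  -- (for K ≥ L this is the whole bilateral sum: T(L,M;a,b) = 0 when |a| > L)
  rhs : (q : Carrier) (ν L M K : ℕ) → Carrier
  rhs q ν L M K = sumSym K (λ j →
      pow q ℤ.∣ (+ (3 ℕ.* suc ν)) ℤ.* j ℤ.* j ℤ.+ (+ 2) ℤ.* j ∣
      * trinomialSq (pow q 3) L M ((+ suc ν) ℤ.* j) j)

{-# OPTIONS --safe #-}
-- Write p = r² for the base of the refined trinomials, r = q³.  The q-Pfaff–Saalschütz sum, written
-- as an expansion of a product of two Gaussian polynomials (linearization), is the only summation needed.
--
-- Applied to the summands of both sides it gives Warnaar's transformation
--   Σ_i r^{i²} [L+M-i; L] T(L-i, i; a, b) = r^{b²} T(L, M; a+b, b)      (a ≥ b ≥ 0),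
-- whose two sides become the same sum over (c, x, f, s) with c + x + 2 f + 2 s fixed.
--
-- The case ν = 0 of the theorem, where M plays the role of n_ν, reads
--   Σ_j q^{3j²+2j} T(L, M; j, j) = Σ_{m+2k=L} q^{m²} [3M; m]_{q²} [2M+k; k]_{q⁶}.
-- The same sum turns its left-hand side into a sum over α, β, n of products of three Gaussian polynomials
-- [M; ·]_{q⁶}, which collapses because (1 + zq)(1 + zq³) ⋯ (1 + zq^{6M-1}) splits into three progressions
-- of step q⁶.
--
-- Peeling off N₁ from the multisum is exactly the left-hand side of the transformation, so induction on ν
-- concludes.
module Submission where

open import Defs
open import Algebra.Bundles using (CommutativeRing)
open import Data.Bool using (true; false; T; if_then_else_)
open import Data.Fin as Fin using ()
open import Data.Integer as ℤ using (ℤ; +_; -[1+_])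
import Data.Integer.Properties as ℤₚ
import Data.Integer.Tactic.RingSolver as ℤ-RingSolver
open import Data.List using (List; []; _∷_; length; drop)
import Data.List.Properties as Listₚ
open import Data.Nat as ℕ using (ℕ; zero; suc; _≤_; _<_; z≤n; s≤s; _∸_; ⌊_/2⌋)
open import Data.Nat.ListAction using (sum)
import Data.Nat.Properties as ℕₚ
open import Data.Nat.Tactic.RingSolver using (solve-∀)
open import Data.Product using (_,_; ∃)
open import Data.Sum using (inj₁; inj₂)
open import Data.Vec.Functional as VF using (Vector)
open import Function using (_∘_; flip)
open import Relation.Binary.PropositionalEquality as ≡ using (_≡_; _≢_)
import Relation.Binary.Reasoning.Setoid as SetoidReasoning
open import Relation.Nullary using (yes; no; contradiction)

-- Gaussian polynomials are handled only through the two Pascal rules, symmetry, q-Vandermonde and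
-- `revision`, and double sums are compared summand by summand after reindexing. Halved indices and
-- parity conditions would obstruct such reindexing. Each is traded for a free summation variable s
-- and a `guard` that keeps the terms of prescribed weight, for instance n + 2 s + a + b = L. The
-- weight bounds the indices by L, so that all sums can run over one common range `B` with L < B,
-- and a substitution becomes an exchange of sums together with a shift over vanishing terms.
-- Negative j are removed by the symmetry (a, b) ↦ (-a, -b) of T: the index -j contributes the
-- trinomial of j, with the exponent `e₋` in place of `e₊`. The induction runs on multisums that
-- also make sense for ν = 0, where the cut-offs stay fixed while (L, M) is replaced by (L - N₁,
-- N₁).

-- Finite sums, convolutions and guarded terms.

module FiniteSums {c ℓ} (R : CommutativeRing c ℓ) where
  open CommutativeRing R hiding (zero)
  open QDefs R
  open SetoidReasoning setoid
  open import Algebra.Properties.CommutativeSemigroup +-commutativeSemigroup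
    using () renaming (interchange to +-interchange)

  sumRange-cong : ∀ n {f g : ℕ → Carrier} → (∀ i → i < n → f i ≈ g i) → sumRange n f ≈ sumRange n g
  sumRange-cong zero    f≈g = refl
  sumRange-cong (suc n) f≈g =
    +-cong (sumRange-cong n (λ i i<n → f≈g i (ℕₚ.m<n⇒m<1+n i<n))) (f≈g n ℕₚ.≤-refl)

  sumRange-cong′ : ∀ n {f g : ℕ → Carrier} → (∀ i → f i ≈ g i) → sumRange n f ≈ sumRange n g
  sumRange-cong′ n f≈g = sumRange-cong n (λ i _ → f≈g i)

  sumRange-zero : ∀ n {f : ℕ → Carrier} → (∀ i → i < n → f i ≈ 0#) → sumRange n f ≈ 0#
  sumRange-zero zero    f≈0 = refl
  sumRange-zero (suc n) f≈0 =
    trans (+-cong (sumRange-zero n (λ i i<n → f≈0 i (ℕₚ.m<n⇒m<1+n i<n))) (f≈0 n ℕₚ.≤-refl)) (+-identityˡ 0#)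

  sumRange-+ : ∀ n (f g : ℕ → Carrier) → sumRange n (λ i → f i + g i) ≈ sumRange n f + sumRange n g
  sumRange-+ zero    f g = sym (+-identityˡ 0#)
  sumRange-+ (suc n) f g = trans (+-congʳ (sumRange-+ n f g)) (+-interchange _ _ _ _)

  sumRange-*ˡ : ∀ n x (f : ℕ → Carrier) → x * sumRange n f ≈ sumRange n (λ i → x * f i)
  sumRange-*ˡ zero    x f = zeroʳ x
  sumRange-*ˡ (suc n) x f = trans (distribˡ x _ _) (+-congʳ (sumRange-*ˡ n x f))

  sumRange-head : ∀ n (f : ℕ → Carrier) → sumRange (suc n) f ≈ f 0 + sumRange n (f ∘ suc)
  sumRange-head zero    f = +-comm _ _
  sumRange-head (suc n) f = trans (+-congʳ (sumRange-head n f)) (+-assoc _ _ _)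

  sumRange-comm : ∀ m n (f : ℕ → ℕ → Carrier) →
    sumRange m (λ i → sumRange n (f i)) ≈ sumRange n (λ j → sumRange m (λ i → f i j))
  sumRange-comm zero    n f = sym (sumRange-zero n (λ _ _ → refl))
  sumRange-comm (suc m) n f = trans (+-congʳ (sumRange-comm m n f)) (sym (sumRange-+ n _ _))

  sumRange-++ : ∀ m n (f : ℕ → Carrier) → sumRange (m ℕ.+ n) f ≈ sumRange m f + sumRange n (λ i → f (m ℕ.+ i))
  sumRange-++ zero    n f = sym (+-identityˡ _)
  sumRange-++ (suc m) n f = begin
    sumRange (suc (m ℕ.+ n)) f                                      ≈⟨ sumRange-head (m ℕ.+ n) f ⟩
    f 0 + sumRange (m ℕ.+ n) (f ∘ suc)                              ≈⟨ +-congˡ (sumRange-++ m n (f ∘ suc)) ⟩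
    f 0 + (sumRange m (f ∘ suc) + sumRange n (λ i → f (suc m ℕ.+ i))) ≈⟨ +-assoc _ _ _ ⟨
    (f 0 + sumRange m (f ∘ suc)) + sumRange n (λ i → f (suc m ℕ.+ i)) ≈⟨ +-congʳ (sumRange-head m f) ⟨
    sumRange (suc m) f + sumRange n (λ i → f (suc m ℕ.+ i))          ∎

  sumRange-extend : ∀ {m n} {f : ℕ → Carrier} → m ≤ n → (∀ i → m ≤ i → f i ≈ 0#) → sumRange m f ≈ sumRange n f
  sumRange-extend {m} {n} {f} m≤n f≈0 = begin
    sumRange m f                                           ≈⟨ +-identityʳ _ ⟨
    sumRange m f + 0#                                      ≈⟨ +-congˡ (sumRange-zero (n ∸ m) (λ i _ → f≈0 (m ℕ.+ i) (ℕₚ.m≤m+n m i))) ⟨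
    sumRange m f + sumRange (n ∸ m) (λ i → f (m ℕ.+ i))    ≈⟨ sumRange-++ m (n ∸ m) f ⟨
    sumRange (m ℕ.+ (n ∸ m)) f                             ≡⟨ ≡.cong (λ k → sumRange k f) (ℕₚ.m+[n∸m]≡n m≤n) ⟩
    sumRange n f                                           ∎

  sumRange-resize : ∀ m n {f : ℕ → Carrier} → (∀ i → m ≤ i → f i ≈ 0#) → (∀ i → n ≤ i → f i ≈ 0#) →
    sumRange m f ≈ sumRange n f
  sumRange-resize m n zm zn with ℕₚ.≤-total m n
  ... | inj₁ m≤n = sumRange-extend m≤n zm
  ... | inj₂ n≤m = sym (sumRange-extend n≤m zn)

  -- The `k` indices lost at the bottom and the `k` gained at the top all carry zero terms, so the
  -- substitution i = k + i′ keeps the common bound `B`.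
  sumRange-shift : ∀ B k {f : ℕ → Carrier} → (∀ i → i < k → f i ≈ 0#) → (∀ i → B ≤ i → f i ≈ 0#) →
    sumRange B f ≈ sumRange B (λ i → f (k ℕ.+ i))
  sumRange-shift B k {f} low high = begin
    sumRange B f                                    ≈⟨ sumRange-extend (ℕₚ.m≤n+m B k) high ⟩
    sumRange (k ℕ.+ B) f                            ≈⟨ sumRange-++ k B f ⟩
    sumRange k f + sumRange B (λ i → f (k ℕ.+ i))   ≈⟨ +-congʳ (sumRange-zero k low) ⟩
    0# + sumRange B (λ i → f (k ℕ.+ i))             ≈⟨ +-identityˡ _ ⟩
    sumRange B (λ i → f (k ℕ.+ i))                  ∎

  -- The sum of F i j over i + j ≡ n.
  conv : ℕ → (ℕ → ℕ → Carrier) → Carrier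
  conv zero    F = F 0 0
  conv (suc n) F = F 0 (suc n) + conv n (F ∘ suc)

  conv-cong : ∀ n {F G : ℕ → ℕ → Carrier} → (∀ i j → i ℕ.+ j ≡ n → F i j ≈ G i j) → conv n F ≈ conv n G
  conv-cong zero    F≈G = F≈G 0 0 ≡.refl
  conv-cong (suc n) F≈G = +-cong (F≈G 0 (suc n) ≡.refl) (conv-cong n (λ i j eq → F≈G (suc i) j (≡.cong suc eq)))

  conv-zero : ∀ n {F : ℕ → ℕ → Carrier} → (∀ i j → i ℕ.+ j ≡ n → F i j ≈ 0#) → conv n F ≈ 0#
  conv-zero zero    F≈0 = F≈0 0 0 ≡.refl
  conv-zero (suc n) F≈0 = trans (+-cong (F≈0 0 (suc n) ≡.refl) (conv-zero n (λ i j eq → F≈0 (suc i) j (≡.cong suc eq)))) (+-identityˡ 0#)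

  conv-+ : ∀ n (F G : ℕ → ℕ → Carrier) → conv n (λ i j → F i j + G i j) ≈ conv n F + conv n G
  conv-+ zero    F G = refl
  conv-+ (suc n) F G = trans (+-congˡ (conv-+ n _ _)) (+-interchange _ _ _ _)

  conv-*ˡ : ∀ n x (F : ℕ → ℕ → Carrier) → x * conv n F ≈ conv n (λ i j → x * F i j)
  conv-*ˡ zero    x F = refl
  conv-*ˡ (suc n) x F = trans (distribˡ x _ _) (+-congˡ (conv-*ˡ n x (F ∘ suc)))

  conv-*ʳ : ∀ n x (F : ℕ → ℕ → Carrier) → conv n F * x ≈ conv n (λ i j → F i j * x)
  conv-*ʳ n x F = trans (*-comm _ x) (trans (conv-*ˡ n x F) (conv-cong n (λ i j _ → *-comm x _)))

  conv-last : ∀ n (F : ℕ → ℕ → Carrier) → conv (suc n) F ≈ conv n (λ i j → F i (suc j)) + F (suc n) 0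
  conv-last zero    F = refl
  conv-last (suc n) F = trans (+-congˡ (conv-last n (F ∘ suc))) (sym (+-assoc _ _ _))

  conv-flip : ∀ n (F : ℕ → ℕ → Carrier) → conv n F ≈ conv n (flip F)
  conv-flip zero    F = refl
  conv-flip (suc n) F = trans (+-congˡ (conv-flip n (F ∘ suc))) (trans (+-comm _ _) (sym (conv-last n (flip F))))

  conv-assoc : ∀ n (F : ℕ → ℕ → ℕ → Carrier) →
    conv n (λ r k → conv r (λ i j → F i j k)) ≈ conv n (λ i r → conv r (λ j k → F i j k))
  conv-assoc zero    F = refl
  conv-assoc (suc n) F = begin
    F 0 0 (suc n) + conv n (λ r k → F 0 (suc r) k + conv r (λ i j → F (suc i) j k))
      ≈⟨ +-congˡ (conv-+ n _ _) ⟩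
    F 0 0 (suc n) + (conv n (λ r k → F 0 (suc r) k) + conv n (λ r k → conv r (λ i j → F (suc i) j k)))
      ≈⟨ +-assoc _ _ _ ⟨
    conv (suc n) (F 0) + conv n (λ r k → conv r (λ i j → F (suc i) j k))
      ≈⟨ +-congˡ (conv-assoc n (F ∘ suc)) ⟩
    conv (suc n) (F 0) + conv n (λ i r → conv r (λ j k → F (suc i) j k)) ∎

  -- If only j ≤ n contributes, then i + j = k + n forces k ≤ i, and the first `k` steps of the
  -- recursion add nothing.
  conv-shrink : ∀ k n (F : ℕ → ℕ → Carrier) → (∀ i j → n < j → F i j ≈ 0#) →
    conv (k ℕ.+ n) F ≈ conv n (λ j i → F (k ℕ.+ i) j)
  conv-shrink zero    n F F≈0 = conv-flip n F
  conv-shrink (suc k) n F F≈0 =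
    trans (+-cong (F≈0 0 (suc (k ℕ.+ n)) (s≤s (ℕₚ.m≤n+m n k))) (conv-shrink k n (F ∘ suc) (λ i → F≈0 (suc i))))
          (+-identityˡ _)

  conv-sumRange : ∀ n (F : ℕ → ℕ → Carrier) → conv n F ≈ sumRange (suc n) (λ j → F (n ∸ j) j)
  conv-sumRange zero    F = sym (+-identityˡ _)
  conv-sumRange (suc n) F = begin
    conv (suc n) F                                            ≈⟨ conv-flip (suc n) F ⟩
    F (suc n) 0 + conv n (λ j i → F i (suc j))                ≈⟨ +-congˡ (conv-flip n _) ⟩
    F (suc n) 0 + conv n (λ i j → F i (suc j))                ≈⟨ +-congˡ (conv-sumRange n _) ⟩
    F (suc n) 0 + sumRange (suc n) (λ j → F (n ∸ j) (suc j))  ≈⟨ sumRange-head (suc n) (λ j → F (suc n ∸ j) j) ⟨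
    sumRange (suc (suc n)) (λ j → F (suc n ∸ j) j)            ∎

  -- The antidiagonals below `B` fill a triangle, and `F` vanishes on the rest of the square. This
  -- passage between `conv` and independent indices is what reduces changes of variables to
  -- exchanges of sums.
  sumRange-conv : ∀ B (F : ℕ → ℕ → Carrier) → (∀ i j → B ≤ i ℕ.+ j → F i j ≈ 0#) →
    sumRange B (λ n → conv n F) ≈ sumRange B (λ i → sumRange B (F i))
  sumRange-conv zero    F F≈0 = refl
  sumRange-conv (suc B) F F≈0 = begin
    sumRange (suc B) (λ n → conv n F)
      ≈⟨ sumRange-head B _ ⟩
    F 0 0 + sumRange B (λ n → F 0 (suc n) + conv n (F ∘ suc))
      ≈⟨ +-congˡ (sumRange-+ B _ _) ⟩
    F 0 0 + (sumRange B (λ n → F 0 (suc n)) + sumRange B (λ n → conv n (F ∘ suc)))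
      ≈⟨ +-assoc _ _ _ ⟨
    (F 0 0 + sumRange B (λ n → F 0 (suc n))) + sumRange B (λ n → conv n (F ∘ suc))
      ≈⟨ +-cong (sym (sumRange-head B (F 0))) (sumRange-conv B (F ∘ suc) (λ i j B≤ → F≈0 (suc i) j (s≤s B≤))) ⟩
    sumRange (suc B) (F 0) + sumRange B (λ i → sumRange B (F (suc i)))
      ≈⟨ +-congˡ (sumRange-cong′ B (λ i → sumRange-extend (ℕₚ.n≤1+n B)
           (λ j B≤j → F≈0 (suc i) j (s≤s (ℕₚ.≤-trans B≤j (ℕₚ.m≤n+m j i)))))) ⟩
    sumRange (suc B) (F 0) + sumRange B (λ i → sumRange (suc B) (F (suc i)))
      ≈⟨ sumRange-head B _ ⟨
    sumRange (suc B) (λ i → sumRange (suc B) (F i)) ∎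

  sumRange-conv-comm : ∀ B n (F : ℕ → ℕ → ℕ → Carrier) →
    sumRange B (λ k → conv n (F k)) ≈ conv n (λ i j → sumRange B (λ k → F k i j))
  sumRange-conv-comm B zero    F = refl
  sumRange-conv-comm B (suc n) F = trans (sumRange-+ B _ _) (+-congˡ (sumRange-conv-comm B n (λ k → F k ∘ suc)))

  -- Unfolded, guard would be a with-function, from which its arguments cannot be inferred.
  abstract
    guard : ℕ → ℕ → Carrier → Carrier
    guard x y a with x ℕ.≟ y
    ... | yes _ = a
    ... | no _  = 0#

    guard-yes : ∀ {x y a} → x ≡ y → guard x y a ≈ a
    guard-yes {x} {y} x≡y with x ℕ.≟ y
    ... | yes _  = refl
    ... | no x≢y = contradiction x≡y x≢y

    guard-no : ∀ {x y a} → x ≢ y → guard x y a ≈ 0#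
    guard-no {x} {y} x≢y with x ℕ.≟ y
    ... | yes x≡y = contradiction x≡y x≢y
    ... | no _    = refl

    guard-cong : ∀ {x y a b} → (x ≡ y → a ≈ b) → guard x y a ≈ guard x y b
    guard-cong {x} {y} a≈b with x ℕ.≟ y
    ... | yes x≡y = a≈b x≡y
    ... | no _    = refl

    guard-iff : ∀ {x y x′ y′ a} → (x ≡ y → x′ ≡ y′) → (x′ ≡ y′ → x ≡ y) → guard x y a ≈ guard x′ y′ a
    guard-iff {x} {y} to from with x ℕ.≟ y
    ... | yes x≡y = sym (guard-yes (to x≡y))
    ... | no x≢y  = sym (guard-no (x≢y ∘ from))

    guard-zero : ∀ {x y a} → (x ≡ y → a ≈ 0#) → guard x y a ≈ 0#
    guard-zero {x} {y} a≈0 with x ℕ.≟ y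
    ... | yes x≡y = a≈0 x≡y
    ... | no _    = refl

    guard-*ˡ : ∀ x y a b → a * guard x y b ≈ guard x y (a * b)
    guard-*ˡ x y a b with x ℕ.≟ y
    ... | yes _ = refl
    ... | no _  = zeroʳ a

    guard-conv : ∀ x y n (F : ℕ → ℕ → Carrier) → guard x y (conv n F) ≈ conv n (λ i j → guard x y (F i j))
    guard-conv x y n F with x ℕ.≟ y
    ... | yes _ = refl
    ... | no _  = sym (conv-zero n (λ _ _ _ → refl))

-- Laws of powers, and change of base in Gaussian polynomials.

module Powers {c ℓ} (R : CommutativeRing c ℓ) where
  open CommutativeRing R hiding (zero)
  open QDefs R

  pow-+ : ∀ x m n → pow x (m ℕ.+ n) ≈ pow x m * pow x n
  pow-+ x zero    n = sym (*-identityˡ _)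
  pow-+ x (suc m) n = trans (*-congˡ (pow-+ x m n)) (sym (*-assoc _ _ _))

  pow-≡ : ∀ x {m n} → m ≡ n → pow x m ≈ pow x n
  pow-≡ x eq = reflexive (≡.cong (pow x) eq)

  pow-cong : ∀ {x y} n → x ≈ y → pow x n ≈ pow y n
  pow-cong zero    x≈y = refl
  pow-cong (suc n) x≈y = *-cong x≈y (pow-cong n x≈y)

  pow-pow : ∀ x m n → pow (pow x m) n ≈ pow x (m ℕ.* n)
  pow-pow x m zero    = pow-≡ x (≡.sym (ℕₚ.*-zeroʳ m))
  pow-pow x m (suc n) =
    trans (*-congˡ (pow-pow x m n)) (trans (sym (pow-+ x m (m ℕ.* n))) (pow-≡ x (≡.sym (ℕₚ.*-suc m n))))

  gauss-cong : ∀ {p p′} → p ≈ p′ → ∀ n k → gauss p n k ≈ gauss p′ n k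
  gauss-cong p≈p′ n       zero    = refl
  gauss-cong p≈p′ zero    (suc k) = refl
  gauss-cong p≈p′ (suc n) (suc k) =
    +-cong (gauss-cong p≈p′ n k) (*-cong (pow-cong (suc k) p≈p′) (gauss-cong p≈p′ n (suc k)))

-- Gaussian polynomials without division.

module Gaussian {c ℓ} (R : CommutativeRing c ℓ) (p : CommutativeRing.Carrier R) where
  open CommutativeRing R hiding (zero)
  open QDefs R hiding (gauss)
  open FiniteSums R
  open Powers R
  open SetoidReasoning setoid
  open import Algebra.Solver.Ring.NaturalCoefficients.Default commutativeSemiring
    using (solve; _:+_; _:*_; _:=_; con)

  gauss : ℕ → ℕ → Carrier
  gauss = QDefs.gauss R p

  gauss-> : ∀ {n k} → n < k → gauss n k ≈ 0#
  gauss-> {zero}  {suc k} _         = refl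
  gauss-> {suc n} {suc k} (s≤s n<k) =
    trans (+-cong (gauss-> n<k) (trans (*-congˡ (gauss-> (ℕₚ.m<n⇒m<1+n n<k))) (zeroʳ _))) (+-identityˡ 0#)

  gauss-diag : ∀ n → gauss n n ≈ 1#
  gauss-diag zero    = refl
  gauss-diag (suc n) =
    trans (+-cong (gauss-diag n) (trans (*-congˡ (gauss-> (ℕₚ.n<1+n n))) (zeroʳ _))) (+-identityʳ 1#)

  gauss-≡ : ∀ {m n k l} → m ≡ n → k ≡ l → gauss m k ≈ gauss n l
  gauss-≡ ≡.refl ≡.refl = refl

  gauss-top : ∀ k {m n} → m ≡ n → gauss m k ≈ gauss n k
  gauss-top k m≡n = gauss-≡ {k = k} m≡n ≡.refl

  -- The other q-Pascal rule, dual to the defining one under k ↦ n - k. In the inductive step the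
  -- defining rule is applied, then this rule at (k, d + 1) and (k + 1, d), and the result regroups
  -- into defining rules. It is the source of `gauss-sym`.
  pascal : ∀ k d → gauss (suc (k ℕ.+ d)) (suc k) ≈ gauss (k ℕ.+ d) (suc k) + pow p d * gauss (k ℕ.+ d) k
  pascal zero zero = trans (+-congˡ (zeroʳ _)) (trans (+-comm 1# 0#) (+-congˡ (sym (*-identityˡ 1#))))
  pascal zero (suc d) = begin
    1# + p * 1# * gauss (suc d) 1                      ≈⟨ +-congˡ (*-congˡ (pascal zero d)) ⟩
    1# + p * 1# * (gauss d 1 + pow p d * 1#)
      ≈⟨ solve 3 (λ p g q → con 1 :+ p :* con 1 :* (g :+ q :* con 1) := con 1 :+ p :* con 1 :* g :+ p :* q :* con 1) refl _ _ _ ⟩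
    1# + p * 1# * gauss d 1 + p * pow p d * 1#         ∎
  pascal (suc k) zero = begin
    gauss (suc k ℕ.+ 0) (suc k) + pow p (suc (suc k)) * gauss (suc k ℕ.+ 0) (suc (suc k))
      ≈⟨ +-congˡ (trans (*-congˡ vanish) (zeroʳ _)) ⟩
    gauss (suc k ℕ.+ 0) (suc k) + 0#
      ≈⟨ +-comm _ _ ⟩
    0# + gauss (suc k ℕ.+ 0) (suc k)
      ≈⟨ +-cong (sym vanish) (sym (*-identityˡ _)) ⟩
    gauss (suc k ℕ.+ 0) (suc (suc k)) + 1# * gauss (suc k ℕ.+ 0) (suc k) ∎
    where
    vanish : gauss (suc k ℕ.+ 0) (suc (suc k)) ≈ 0#
    vanish = gauss-> (s≤s (s≤s (ℕₚ.≤-reflexive (ℕₚ.+-identityʳ k))))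
  pascal (suc k) (suc d) = begin
    gauss (suc (k ℕ.+ suc d)) (suc k) + P * gauss (suc (k ℕ.+ suc d)) (suc (suc k))
      ≈⟨ +-cong (pascal k (suc d)) (*-congˡ second) ⟩
    (g₁ + p * Q * g₀) + P * (g₂ + Q * g₁)
      ≈⟨ +-congˡ (*-congʳ refl) ⟩
    (g₁ + p * Q * g₀) + (p * K) * (g₂ + Q * g₁)
      ≈⟨ solve 6 (λ g₀ g₁ g₂ p Q K → (g₁ :+ p :* Q :* g₀) :+ (p :* K) :* (g₂ :+ Q :* g₁)
                   := (g₁ :+ p :* K :* g₂) :+ p :* Q :* (g₀ :+ K :* g₁)) refl g₀ g₁ g₂ p Q K ⟩
    (g₁ + P * g₂) + p * Q * (g₀ + K * g₁) ∎
    where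
    g₀ = gauss (k ℕ.+ suc d) k
    g₁ = gauss (k ℕ.+ suc d) (suc k)
    g₂ = gauss (k ℕ.+ suc d) (suc (suc k))
    Q  = pow p d
    K  = pow p (suc k)
    P  = p * K
    second : gauss (suc (k ℕ.+ suc d)) (suc (suc k)) ≈ g₂ + Q * g₁
    second = begin
      gauss (suc (k ℕ.+ suc d)) (suc (suc k))   ≈⟨ gauss-top (suc (suc k)) (≡.cong suc (ℕₚ.+-suc k d)) ⟩
      gauss (suc (suc k ℕ.+ d)) (suc (suc k))   ≈⟨ pascal (suc k) d ⟩
      gauss (suc k ℕ.+ d) (suc (suc k)) + Q * gauss (suc k ℕ.+ d) (suc k)
        ≈⟨ +-cong (gauss-top (suc (suc k)) (≡.sym (ℕₚ.+-suc k d))) (*-congˡ (gauss-top (suc k) (≡.sym (ℕₚ.+-suc k d)))) ⟩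
      g₂ + Q * g₁ ∎

  gauss-sym : ∀ m k → gauss (m ℕ.+ k) m ≈ gauss (m ℕ.+ k) k
  gauss-sym zero    k       = sym (gauss-diag k)
  gauss-sym (suc m) zero    = trans (gauss-top (suc m) (ℕₚ.+-identityʳ (suc m))) (gauss-diag (suc m))
  gauss-sym (suc m) (suc k) = begin
    gauss (m ℕ.+ suc k) m + pow p (suc m) * gauss (m ℕ.+ suc k) (suc m)
      ≈⟨ +-cong (gauss-sym m (suc k))
                (*-congˡ (trans (gauss-top (suc m) (ℕₚ.+-suc m k))
                         (trans (gauss-sym (suc m) k) (gauss-top k (≡.sym (ℕₚ.+-suc m k)))))) ⟩
    gauss (m ℕ.+ suc k) (suc k) + pow p (suc m) * gauss (m ℕ.+ suc k) k
      ≈⟨ +-cong (gauss-top (suc k) eq) (*-congˡ (gauss-top k eq)) ⟩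
    gauss (k ℕ.+ suc m) (suc k) + pow p (suc m) * gauss (k ℕ.+ suc m) k
      ≈⟨ pascal k (suc m) ⟨
    gauss (suc (k ℕ.+ suc m)) (suc k)
      ≈⟨ gauss-top (suc k) (≡.cong suc (≡.sym eq)) ⟩
    gauss (suc (m ℕ.+ suc k)) (suc k) ∎
    where
    eq : m ℕ.+ suc k ≡ k ℕ.+ suc m
    eq = ≡.trans (ℕₚ.+-suc m k) (≡.trans (≡.cong suc (ℕₚ.+-comm m k)) (≡.sym (ℕₚ.+-suc k m)))

  gauss-complement : ∀ {n} k l → k ℕ.+ l ≡ n → gauss n k ≈ gauss n l
  gauss-complement k l ≡.refl = gauss-sym k l

  -- Induction on `m` along the defining recurrence. The truncated difference `m ∸ i` is harmless,
  -- since `gauss m i` is zero when it truncates.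
  vandermonde : ∀ m n k →
    gauss (m ℕ.+ n) k ≈ conv k (λ i j → pow p (j ℕ.* (m ∸ i)) * (gauss m i * gauss n j))
  vandermonde m       n zero    = sym (trans (*-identityˡ _) (*-identityˡ _))
  vandermonde zero    n (suc k) = sym (begin
    pow p (suc k ℕ.* 0) * (1# * gauss n (suc k)) + conv k (λ i j → pow p (j ℕ.* 0) * (0# * gauss n j))
      ≈⟨ +-cong (*-congʳ (pow-≡ p (ℕₚ.*-zeroʳ k))) (conv-zero k (λ i j _ → trans (*-congˡ (zeroˡ _)) (zeroʳ _))) ⟩
    1# * (1# * gauss n (suc k)) + 0#
      ≈⟨ trans (+-identityʳ _) (trans (*-identityˡ _) (*-identityˡ _)) ⟩
    gauss n (suc k) ∎)
  vandermonde (suc m) n (suc k) = begin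
    gauss (m ℕ.+ n) k + pow p (suc k) * gauss (m ℕ.+ n) (suc k)
      ≈⟨ +-cong (vandermonde m n k) (*-congˡ (vandermonde m n (suc k))) ⟩
    conv k A + pow p (suc k) * (pow p (suc k ℕ.* m) * (1# * gauss n (suc k)) + conv k B)
      ≈⟨ +-congˡ (trans (distribˡ _ _ _) (+-cong first (conv-*ˡ k _ B))) ⟩
    conv k A + (pow p (suc k ℕ.* suc m) * (1# * gauss n (suc k)) + conv k (λ i j → pow p (suc k) * B i j))
      ≈⟨ solve 3 (λ x y z → x :+ (y :+ z) := y :+ (x :+ z)) refl _ _ _ ⟩
    pow p (suc k ℕ.* suc m) * (1# * gauss n (suc k)) + (conv k A + conv k (λ i j → pow p (suc k) * B i j))
      ≈⟨ +-congˡ (conv-+ k _ _) ⟨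
    pow p (suc k ℕ.* suc m) * (1# * gauss n (suc k)) + conv k (λ i j → A i j + pow p (suc k) * B i j)
      ≈⟨ +-congˡ (conv-cong k step) ⟩
    pow p (suc k ℕ.* suc m) * (1# * gauss n (suc k))
      + conv k (λ i j → pow p (j ℕ.* (m ∸ i)) * (gauss (suc m) (suc i) * gauss n j)) ∎
    where
    A B : ℕ → ℕ → Carrier
    A i j = pow p (j ℕ.* (m ∸ i)) * (gauss m i * gauss n j)
    B i j = pow p (j ℕ.* (m ∸ suc i)) * (gauss m (suc i) * gauss n j)

    first : pow p (suc k) * (pow p (suc k ℕ.* m) * (1# * gauss n (suc k)))
          ≈ pow p (suc k ℕ.* suc m) * (1# * gauss n (suc k))
    first = trans (sym (*-assoc _ _ _))
      (*-congʳ (trans (sym (pow-+ p (suc k) (suc k ℕ.* m))) (pow-≡ p (≡.sym (ℕₚ.*-suc (suc k) m)))))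

    exponents : ∀ i j → i ℕ.+ j ≡ k → pow p (suc k) * B i j
              ≈ pow p (j ℕ.* (m ∸ i)) * ((pow p (suc i) * gauss m (suc i)) * gauss n j)
    exponents i j i+j≡k with ℕₚ.≤-<-connex m i
    ... | inj₁ m≤i = trans (*-congˡ (trans (*-congˡ (trans (*-congʳ (gauss-> (s≤s m≤i))) (zeroˡ _))) (zeroʳ _)))
          (trans (zeroʳ _) (sym (trans (*-congˡ (trans (*-congʳ (trans (*-congˡ (gauss-> (s≤s m≤i))) (zeroʳ _))) (zeroˡ _))) (zeroʳ _))))
    ... | inj₂ i<m = begin
      pow p (suc k) * (pow p (j ℕ.* (m ∸ suc i)) * (gauss m (suc i) * gauss n j))
        ≈⟨ *-assoc _ _ _ ⟨
      pow p (suc k) * pow p (j ℕ.* (m ∸ suc i)) * (gauss m (suc i) * gauss n j)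
        ≈⟨ *-congʳ (trans (sym (pow-+ p (suc k) _)) (trans (pow-≡ p eq) (pow-+ p (j ℕ.* (m ∸ i)) (suc i)))) ⟩
      pow p (j ℕ.* (m ∸ i)) * pow p (suc i) * (gauss m (suc i) * gauss n j)
        ≈⟨ solve 4 (λ a b c d → a :* b :* (c :* d) := a :* ((b :* c) :* d)) refl _ _ _ _ ⟩
      pow p (j ℕ.* (m ∸ i)) * ((pow p (suc i) * gauss m (suc i)) * gauss n j) ∎
      where
      -- With k = i + j, the power p^(k+1) supplies the j missing in j (m - i - 1) and the exponent
      -- i + 1 of the Pascal recurrence.
      eq : suc k ℕ.+ j ℕ.* (m ∸ suc i) ≡ j ℕ.* (m ∸ i) ℕ.+ suc i
      eq rewrite ≡.sym i+j≡k | ≡.sym (ℕₚ.suc-pred (m ∸ i) {{ℕ.>-nonZero (ℕₚ.m<n⇒0<n∸m i<m)}})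
               | ≡.sym (ℕₚ.pred[m∸n]≡m∸[1+n] m i) = lemma i j (ℕ.pred (m ∸ i))
        where
        lemma : ∀ i j e → suc (i ℕ.+ j) ℕ.+ j ℕ.* e ≡ j ℕ.* suc e ℕ.+ suc i
        lemma = solve-∀

    step : ∀ i j → i ℕ.+ j ≡ k → A i j + pow p (suc k) * B i j
         ≈ pow p (j ℕ.* (m ∸ i)) * (gauss (suc m) (suc i) * gauss n j)
    step i j i+j≡k = trans (+-congˡ (exponents i j i+j≡k))
      (solve 4 (λ e a b d → e :* (a :* d) :+ e :* (b :* d) := e :* ((a :+ b) :* d)) refl _ _ _ _)

  -- Both sides are the q-multinomial coefficient with parts j, c and n - j - c. As factorials
  -- cannot be cancelled, both factors are expanded by the Pascal rule and the induction hypothesis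
  -- is used at j, at j + 1 and, inside `split`, once more with a smaller c.
  revision : ∀ n j c → gauss n (j ℕ.+ c) * gauss (j ℕ.+ c) j ≈ gauss n j * gauss (n ∸ j) c
  revision n       zero    c = *-comm _ _
  revision zero    (suc j) c = trans (zeroˡ _) (sym (zeroˡ _))
  revision (suc n) (suc j) c = begin
    (gauss n (j ℕ.+ c) + pow p (suc j ℕ.+ c) * gauss n (suc j ℕ.+ c)) * (gauss (j ℕ.+ c) j + P * gauss (j ℕ.+ c) (suc j))
      ≈⟨ solve 6 (λ a e b x P y → (a :+ e :* b) :* (x :+ P :* y) := a :* x :+ (P :* (a :* y) :+ e :* (b :* (x :+ P :* y)))) refl _ _ _ _ _ _ ⟩
    gauss n (j ℕ.+ c) * gauss (j ℕ.+ c) j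
      + (P * (gauss n (j ℕ.+ c) * gauss (j ℕ.+ c) (suc j))
      + pow p (suc j ℕ.+ c) * (gauss n (suc j ℕ.+ c) * gauss (suc j ℕ.+ c) (suc j)))
      ≈⟨ +-cong (revision n j c) (+-congˡ (*-cong (pow-+ p (suc j) c) (revision n (suc j) c))) ⟩
    gauss n j * gauss (n ∸ j) c
      + (P * (gauss n (j ℕ.+ c) * gauss (j ℕ.+ c) (suc j))
      + P * pow p c * (gauss n (suc j) * gauss (n ∸ suc j) c))
      ≈⟨ +-congˡ (trans (+-congˡ (*-assoc _ _ _)) (trans (sym (distribˡ P _ _)) (*-congˡ (split c)))) ⟩
    gauss n j * gauss (n ∸ j) c + P * (gauss n (suc j) * gauss (n ∸ j) c)
      ≈⟨ solve 4 (λ a g P b → a :* g :+ P :* (b :* g) := (a :+ P :* b) :* g) refl _ _ _ _ ⟩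
    (gauss n j + P * gauss n (suc j)) * gauss (n ∸ j) c ∎
    where
    P = pow p (suc j)
    split : ∀ c → gauss n (j ℕ.+ c) * gauss (j ℕ.+ c) (suc j) + pow p c * (gauss n (suc j) * gauss (n ∸ suc j) c)
                ≈ gauss n (suc j) * gauss (n ∸ j) c
    split zero = trans (+-cong (trans (*-congˡ (gauss-> (s≤s (ℕₚ.≤-reflexive (ℕₚ.+-identityʳ j))))) (zeroʳ _)) (*-identityˡ _))
                       (+-identityˡ _)
    split (suc c) = begin
      gauss n (j ℕ.+ suc c) * gauss (j ℕ.+ suc c) (suc j) + pow p (suc c) * (gauss n (suc j) * gauss (n ∸ suc j) (suc c))
        ≈⟨ +-congʳ (*-cong (gauss-≡ ≡.refl (ℕₚ.+-suc j c)) (gauss-top (suc j) (ℕₚ.+-suc j c))) ⟩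
      gauss n (suc j ℕ.+ c) * gauss (suc j ℕ.+ c) (suc j) + pow p (suc c) * (gauss n (suc j) * gauss (n ∸ suc j) (suc c))
        ≈⟨ +-congʳ (revision n (suc j) c) ⟩
      gauss n (suc j) * gauss (n ∸ suc j) c + pow p (suc c) * (gauss n (suc j) * gauss (n ∸ suc j) (suc c))
        ≈⟨ solve 4 (λ g x e y → g :* x :+ e :* (g :* y) := g :* (x :+ e :* y)) refl _ _ _ _ ⟩
      gauss n (suc j) * (gauss (n ∸ suc j) c + pow p (suc c) * gauss (n ∸ suc j) (suc c))
        ≈⟨ top ⟩
      gauss n (suc j) * gauss (n ∸ j) (suc c) ∎
      where
      top : gauss n (suc j) * gauss (suc (n ∸ suc j)) (suc c) ≈ gauss n (suc j) * gauss (n ∸ j) (suc c)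
      -- The index `n ∸ suc j` is the predecessor of `n ∸ j` only for j < n; otherwise the common
      -- factor `gauss n (suc j)` vanishes.
      top with ℕₚ.≤-<-connex n j
      ... | inj₁ n≤j = trans (trans (*-congʳ (gauss-> (s≤s n≤j))) (zeroˡ _)) (sym (trans (*-congʳ (gauss-> (s≤s n≤j))) (zeroˡ _)))
      ... | inj₂ j<n = *-congˡ (gauss-top (suc c) (≡.sym (ℕₚ.+-∸-assoc 1 j<n)))

-- The q-Pfaff-Saalschütz sum as a product formula.

module Linearization {c ℓ} (R : CommutativeRing c ℓ) (p : CommutativeRing.Carrier R) where
  open CommutativeRing R hiding (zero)
  open QDefs R hiding (gauss)
  open FiniteSums R
  open Powers R
  open Gaussian R p
  open SetoidReasoning setoid
  open import Algebra.Solver.Ring.NaturalCoefficients.Default commutativeSemiring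
    using (solve; _:*_; _:=_)

  -- At most c of the lower index d + c can come from the block of size c, so at least d comes from
  -- the block of size m.
  vandermonde′ : ∀ m c d → gauss (m ℕ.+ c) (d ℕ.+ c) ≈
    conv c (λ j i → pow p (j ℕ.* (m ∸ (d ℕ.+ i))) * (gauss m (d ℕ.+ i) * gauss c j))
  vandermonde′ m c d = trans (vandermonde m c (d ℕ.+ c)) (conv-shrink d c _
    (λ i j c<j → trans (*-congˡ (trans (*-congˡ (gauss-> c<j)) (zeroʳ _))) (zeroʳ _)))

  -- A form of the q-Pfaff–Saalschütz sum.
  linearization : ∀ W b z N h → W ℕ.+ b ≡ N ℕ.+ h →
    gauss (z ℕ.+ N) N * gauss (W ℕ.+ z) h ≈
    conv N (λ c f → pow p ((b ∸ c) ℕ.* f) * (gauss (W ℕ.+ z ℕ.+ c) (W ℕ.+ b) * (gauss b c * gauss W f)))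
  linearization W b z N h W+b≡N+h with ℕₚ.≤-<-connex b (z ℕ.+ N)
  -- For b > z + N both sides vanish. Otherwise y = z + N - b exists, and [z + N; N] on the left is
  -- read as [y + b; N], to be produced by q-Vandermonde at the end.
  ... | inj₂ z+N<b = trans (trans (*-congˡ (gauss-> W+z<h)) (zeroʳ _))
        (sym (conv-zero N (λ c f c+f≡N → trans (*-congˡ (trans (*-congʳ (gauss-> (top c f c+f≡N))) (zeroˡ _))) (zeroʳ _))))
    where
    W+z<h : W ℕ.+ z < h
    W+z<h = ℕₚ.+-cancelʳ-< N _ _ (≡.subst₂ _<_ (≡.sym (ℕₚ.+-assoc W z N)) (≡.trans W+b≡N+h (ℕₚ.+-comm N h)) (ℕₚ.+-monoʳ-< W z+N<b))
    top : ∀ c f → c ℕ.+ f ≡ N → W ℕ.+ z ℕ.+ c < W ℕ.+ b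
    top c f ≡.refl = ≡.subst (_< W ℕ.+ b) (≡.sym (ℕₚ.+-assoc W z c))
      (ℕₚ.+-monoʳ-< W (ℕₚ.≤-<-trans (ℕₚ.+-monoʳ-≤ z (ℕₚ.m≤m+n c f)) z+N<b))
  ... | inj₁ b≤z+N with ℕₚ.m≤n⇒∃[o]m+o≡n b≤z+N
  ... | y , b+y≡z+N = sym (begin
    conv N (λ c f → term c f)
      -- [W + z + c; W + b] is expanded by `vandermonde′` over j + i = c, and [b; c] [c; j] is
      -- revised to [b; j] [b - j; i].
      ≈⟨ conv-cong N (λ c f _ → expand c f) ⟩
    conv N (λ c f → conv c (λ j i → A j * B j i f))
      ≈⟨ conv-assoc N (λ j i f → A j * B j i f) ⟩
    conv N (λ j r → conv r (λ i f → A j * B j i f))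
      ≈⟨ conv-cong N (λ j r _ → conv-*ˡ r (A j) (B j)) ⟨
    conv N (λ j r → A j * conv r (B j))
      -- For fixed j, the variables i and f occur only in a q-Vandermonde sum for [b - j + W; r].
      ≈⟨ conv-cong N (λ j r _ → *-congˡ (vandermonde (b ∸ j) W r)) ⟨
    conv N (λ j r → A j * gauss (b ∸ j ℕ.+ W) r)
      ≈⟨ conv-cong N collapse ⟩
    conv N (λ j r → gauss (W ℕ.+ z) h * (pow p (j ℕ.* (y ∸ r)) * (gauss y r * gauss b j)))
      ≈⟨ conv-*ˡ N _ _ ⟨
    gauss (W ℕ.+ z) h * conv N (λ j r → pow p (j ℕ.* (y ∸ r)) * (gauss y r * gauss b j))
      ≈⟨ *-congˡ (trans (conv-flip N _) (sym (vandermonde y b N))) ⟩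
    gauss (W ℕ.+ z) h * gauss (y ℕ.+ b) N
      ≈⟨ *-comm _ _ ⟩
    gauss (y ℕ.+ b) N * gauss (W ℕ.+ z) h
      ≈⟨ *-congʳ (gauss-top N (≡.trans (ℕₚ.+-comm y b) b+y≡z+N)) ⟩
    gauss (z ℕ.+ N) N * gauss (W ℕ.+ z) h ∎)
    where
    term : ℕ → ℕ → Carrier
    term c f = pow p ((b ∸ c) ℕ.* f) * (gauss (W ℕ.+ z ℕ.+ c) (W ℕ.+ b) * (gauss b c * gauss W f))
    A : ℕ → Carrier
    A j = pow p (j ℕ.* (z ∸ (b ∸ j))) * (gauss (W ℕ.+ z) (W ℕ.+ (b ∸ j)) * gauss b j)
    B : ℕ → ℕ → ℕ → Carrier
    B j i f = pow p (f ℕ.* (b ∸ j ∸ i)) * (gauss (b ∸ j) i * gauss W f)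

    expand : ∀ c f → term c f ≈ conv c (λ j i → A j * B j i f)
    expand c f with ℕₚ.≤-<-connex c b
    ... | inj₂ b<c = trans
          (trans (*-congˡ (trans (*-congˡ (trans (*-congʳ (gauss-> b<c)) (zeroˡ _))) (zeroʳ _))) (zeroʳ _))
          (sym (conv-zero c vanish))
      where
      vanish : ∀ j i → j ℕ.+ i ≡ c → A j * B j i f ≈ 0#
      vanish j i ≡.refl = begin
        A j * B j i f
          ≈⟨ solve 6 (λ a g b e h w → (a :* (g :* b)) :* (e :* (h :* w)) := (a :* g :* (e :* w)) :* (b :* h)) refl _ _ _ _ _ _ ⟩
        pow p (j ℕ.* (z ∸ (b ∸ j))) * gauss (W ℕ.+ z) (W ℕ.+ (b ∸ j)) * (pow p (f ℕ.* (b ∸ j ∸ i)) * gauss W f) * (gauss b j * gauss (b ∸ j) i)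
          ≈⟨ *-congˡ (trans (sym (revision b j i)) (trans (*-congʳ (gauss-> b<c)) (zeroˡ _))) ⟩
        _ * 0#
          ≈⟨ zeroʳ _ ⟩
        0# ∎
    ... | inj₁ c≤b = begin
      term c f
        ≈⟨ *-congˡ (*-congʳ (trans (gauss-≡ ≡.refl W+b≡) (vandermonde′ (W ℕ.+ z) c (W ℕ.+ (b ∸ c))))) ⟩
      pow p ((b ∸ c) ℕ.* f) * (conv c V * (gauss b c * gauss W f))
        ≈⟨ trans (*-congˡ (conv-*ʳ c _ V)) (conv-*ˡ c _ _) ⟩
      conv c (λ j i → pow p ((b ∸ c) ℕ.* f) * (V j i * (gauss b c * gauss W f)))
        ≈⟨ conv-cong c revise ⟩
      conv c (λ j i → A j * B j i f) ∎
      where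
      V : ℕ → ℕ → Carrier
      V j i = pow p (j ℕ.* (W ℕ.+ z ∸ (W ℕ.+ (b ∸ c) ℕ.+ i))) * (gauss (W ℕ.+ z) (W ℕ.+ (b ∸ c) ℕ.+ i) * gauss c j)
      W+b≡ : W ℕ.+ b ≡ W ℕ.+ (b ∸ c) ℕ.+ c
      W+b≡ = ≡.trans (≡.cong (W ℕ.+_) (≡.sym (ℕₚ.m∸n+n≡m c≤b))) (≡.sym (ℕₚ.+-assoc W (b ∸ c) c))
      revise : ∀ j i → j ℕ.+ i ≡ c → pow p ((b ∸ c) ℕ.* f) * (V j i * (gauss b c * gauss W f)) ≈ A j * B j i f
      revise j i ≡.refl = begin
        pow p ((b ∸ (j ℕ.+ i)) ℕ.* f) * (V j i * (gauss b (j ℕ.+ i) * gauss W f))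
          ≈⟨ solve 6 (λ e a g k n w → e :* ((a :* (g :* k)) :* (n :* w)) := (a :* g :* (e :* w)) :* (n :* k)) refl
               (pow p ((b ∸ (j ℕ.+ i)) ℕ.* f)) (pow p (j ℕ.* (W ℕ.+ z ∸ L))) (gauss (W ℕ.+ z) L) (gauss (j ℕ.+ i) j) (gauss b (j ℕ.+ i)) (gauss W f) ⟩
        pow p (j ℕ.* (W ℕ.+ z ∸ L)) * gauss (W ℕ.+ z) L * (pow p ((b ∸ (j ℕ.+ i)) ℕ.* f) * gauss W f) * (gauss b (j ℕ.+ i) * gauss (j ℕ.+ i) j)
          ≈⟨ *-cong (*-cong (*-cong (pow-≡ p (≡.cong (j ℕ.*_) (≡.trans (≡.cong (W ℕ.+ z ∸_) L≡) (ℕₚ.[m+n]∸[m+o]≡n∸o W z (b ∸ j)))))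
                                    (gauss-≡ ≡.refl L≡))
                            (*-congʳ (pow-≡ p (≡.trans (≡.cong (ℕ._* f) (≡.sym (ℕₚ.∸-+-assoc b j i))) (ℕₚ.*-comm _ f)))))
                    (revision b j i) ⟩
        pow p (j ℕ.* (z ∸ (b ∸ j))) * gauss (W ℕ.+ z) (W ℕ.+ (b ∸ j)) * (pow p (f ℕ.* (b ∸ j ∸ i)) * gauss W f) * (gauss b j * gauss (b ∸ j) i)
          ≈⟨ solve 6 (λ a g b e h w → (a :* (g :* b)) :* (e :* (h :* w)) := (a :* g :* (e :* w)) :* (b :* h)) refl
               (pow p (j ℕ.* (z ∸ (b ∸ j)))) (gauss (W ℕ.+ z) (W ℕ.+ (b ∸ j))) (gauss b j) (pow p (f ℕ.* (b ∸ j ∸ i))) (gauss (b ∸ j) i) (gauss W f) ⟨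
        A j * B j i f ∎
        where
        L = W ℕ.+ (b ∸ (j ℕ.+ i)) ℕ.+ i
        L≡ : L ≡ W ℕ.+ (b ∸ j)
        L≡ = ≡.trans (ℕₚ.+-assoc W _ i) (≡.cong (W ℕ.+_)
               (≡.trans (≡.cong (ℕ._+ i) (≡.sym (ℕₚ.∸-+-assoc b j i)))
                        (ℕₚ.m∸n+n≡m (≡.subst (_≤ b ∸ j) (ℕₚ.m+n∸m≡n j i) (ℕₚ.∸-monoˡ-≤ j c≤b)))))

    -- Here W + b = N + h enters: with d = b - j and r = N - j it reads W + d = h + r, so `revision`
    -- turns [W + z; W + d] [W + d; r] into [W + z; h] [y; r], whose first factor is independent of
    -- j.
    collapse : ∀ j r → j ℕ.+ r ≡ N →
      A j * gauss (b ∸ j ℕ.+ W) r ≈ gauss (W ℕ.+ z) h * (pow p (j ℕ.* (y ∸ r)) * (gauss y r * gauss b j))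
    collapse j r ≡.refl with ℕₚ.≤-<-connex j b
    ... | inj₂ b<j = trans (trans (*-congʳ (trans (*-congˡ (trans (*-congˡ (gauss-> b<j)) (zeroʳ _))) (zeroʳ _))) (zeroˡ _))
          (sym (trans (*-congˡ (trans (*-congˡ (trans (*-congˡ (gauss-> b<j)) (zeroʳ _))) (zeroʳ _))) (zeroʳ _)))
    ... | inj₁ j≤b with ℕₚ.m≤n⇒∃[o]m+o≡n j≤b
    ... | d , ≡.refl = begin
      pow p (j ℕ.* (z ∸ (j ℕ.+ d ∸ j))) * (gauss (W ℕ.+ z) (W ℕ.+ (j ℕ.+ d ∸ j)) * gauss (j ℕ.+ d) j) * gauss (j ℕ.+ d ∸ j ℕ.+ W) r
        ≡⟨ ≡.cong (λ e → pow p (j ℕ.* (z ∸ e)) * (gauss (W ℕ.+ z) (W ℕ.+ e) * gauss (j ℕ.+ d) j) * gauss (e ℕ.+ W) r) (ℕₚ.m+n∸m≡n j d) ⟩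
      pow p (j ℕ.* (z ∸ d)) * (gauss (W ℕ.+ z) (W ℕ.+ d) * gauss (j ℕ.+ d) j) * gauss (d ℕ.+ W) r
        ≈⟨ *-cong (*-cong (pow-≡ p (≡.cong (j ℕ.*_) z∸d≡y∸r)) (*-congʳ (gauss-≡ W+z≡h+y W+d≡h+r)))
                  (trans (gauss-top r (≡.trans (ℕₚ.+-comm d W) W+d≡h+r)) (sym (gauss-sym h r))) ⟩
      pow p (j ℕ.* (y ∸ r)) * (gauss (h ℕ.+ y) (h ℕ.+ r) * gauss (j ℕ.+ d) j) * gauss (h ℕ.+ r) h
        ≈⟨ solve 4 (λ e g b k → e :* (g :* b) :* k := (g :* k) :* (e :* b)) refl _ _ _ _ ⟩
      gauss (h ℕ.+ y) (h ℕ.+ r) * gauss (h ℕ.+ r) h * (pow p (j ℕ.* (y ∸ r)) * gauss (j ℕ.+ d) j)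
        ≈⟨ *-congʳ (trans (revision (h ℕ.+ y) h r) (*-cong (gauss-top h (≡.sym W+z≡h+y)) (gauss-top r (ℕₚ.m+n∸m≡n h y)))) ⟩
      gauss (W ℕ.+ z) h * gauss y r * (pow p (j ℕ.* (y ∸ r)) * gauss (j ℕ.+ d) j)
        ≈⟨ solve 4 (λ e g b k → g :* k :* (e :* b) := g :* (e :* (k :* b))) refl _ _ _ _ ⟩
      gauss (W ℕ.+ z) h * (pow p (j ℕ.* (y ∸ r)) * (gauss y r * gauss (j ℕ.+ d) j)) ∎
      where
      d+y≡z+r : d ℕ.+ y ≡ z ℕ.+ r
      d+y≡z+r = ℕₚ.+-cancelˡ-≡ j _ _ (≡.trans (≡.sym (ℕₚ.+-assoc j d y)) (≡.trans b+y≡z+N (lemma z j r)))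
        where
        lemma : ∀ z j r → z ℕ.+ (j ℕ.+ r) ≡ j ℕ.+ (z ℕ.+ r)
        lemma = solve-∀
      W+d≡h+r : W ℕ.+ d ≡ h ℕ.+ r
      W+d≡h+r = ℕₚ.+-cancelˡ-≡ j _ _ (≡.trans (lemma₁ j W d) (≡.trans W+b≡N+h (lemma₂ j r h)))
        where
        lemma₁ : ∀ j W d → j ℕ.+ (W ℕ.+ d) ≡ W ℕ.+ (j ℕ.+ d)
        lemma₁ = solve-∀
        lemma₂ : ∀ j r h → j ℕ.+ r ℕ.+ h ≡ j ℕ.+ (h ℕ.+ r)
        lemma₂ = solve-∀
      W+z≡h+y : W ℕ.+ z ≡ h ℕ.+ y
      W+z≡h+y = ℕₚ.+-cancelʳ-≡ r _ _ (≡.trans (ℕₚ.+-assoc W z r) (≡.trans (≡.cong (W ℕ.+_) (≡.sym d+y≡z+r))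
        (≡.trans (≡.sym (ℕₚ.+-assoc W d y)) (≡.trans (≡.cong (ℕ._+ y) W+d≡h+r) (lemma h r y)))))
        where
        lemma : ∀ h r y → h ℕ.+ r ℕ.+ y ≡ h ℕ.+ y ℕ.+ r
        lemma = solve-∀
      z∸d≡y∸r : z ∸ d ≡ y ∸ r
      z∸d≡y∸r = ≡.trans (≡.sym (ℕₚ.[m+n]∸[m+o]≡n∸o r z d))
        (≡.trans (≡.cong₂ _∸_ (≡.trans (ℕₚ.+-comm r z) (≡.sym d+y≡z+r)) (ℕₚ.+-comm r d)) (ℕₚ.[m+n]∸[m+o]≡n∸o d y r))

-- The transformation of refined trinomials.

module Transformation {c ℓ} (R : CommutativeRing c ℓ) (r : CommutativeRing.Carrier R) where
  open CommutativeRing R hiding (zero)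
  open QDefs R using (pow; sumRange)
  open FiniteSums R
  open Powers R
  p : Carrier
  p = pow r 2
  open Gaussian R p
  open Linearization R p
  open SetoidReasoning setoid
  open import Algebra.Solver.Ring.NaturalCoefficients.Default commutativeSemiring
    using (solve; _:*_; _:=_)

  -- This is `linearization` at W = n + w, z = i - n, h = w + b. For i < n both sides vanish: on the
  -- right, either [b; c] is zero or the upper index i + w + c is too small.
  split : ∀ i n w b → gauss i n * gauss (i ℕ.+ w) (w ℕ.+ b) ≈
    conv n (λ c f → pow p ((b ∸ c) ℕ.* f) * (gauss (i ℕ.+ w ℕ.+ c) (n ℕ.+ w ℕ.+ b) * (gauss b c * gauss (n ℕ.+ w) f)))
  split i n w b with ℕₚ.≤-<-connex n i
  ... | inj₁ n≤i = begin
    gauss i n * gauss (i ℕ.+ w) (w ℕ.+ b)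
      ≈⟨ *-cong (gauss-top n (≡.sym (ℕₚ.m∸n+n≡m n≤i))) (gauss-top (w ℕ.+ b) (≡.sym top)) ⟩
    gauss (i ∸ n ℕ.+ n) n * gauss (n ℕ.+ w ℕ.+ (i ∸ n)) (w ℕ.+ b)
      ≈⟨ linearization (n ℕ.+ w) b (i ∸ n) n (w ℕ.+ b) (ℕₚ.+-assoc n w b) ⟩
    conv n (λ c f → pow p ((b ∸ c) ℕ.* f) * (gauss (n ℕ.+ w ℕ.+ (i ∸ n) ℕ.+ c) (n ℕ.+ w ℕ.+ b) * (gauss b c * gauss (n ℕ.+ w) f)))
      ≡⟨ ≡.cong (λ t → conv n (λ c f → pow p ((b ∸ c) ℕ.* f) * (gauss (t ℕ.+ c) (n ℕ.+ w ℕ.+ b) * (gauss b c * gauss (n ℕ.+ w) f)))) top ⟩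
    conv n (λ c f → pow p ((b ∸ c) ℕ.* f) * (gauss (i ℕ.+ w ℕ.+ c) (n ℕ.+ w ℕ.+ b) * (gauss b c * gauss (n ℕ.+ w) f))) ∎
    where
    top : n ℕ.+ w ℕ.+ (i ∸ n) ≡ i ℕ.+ w
    top = ≡.trans (lemma n w (i ∸ n)) (≡.cong (ℕ._+ w) (ℕₚ.m∸n+n≡m n≤i))
      where
      lemma : ∀ n w d → n ℕ.+ w ℕ.+ d ≡ d ℕ.+ n ℕ.+ w
      lemma = solve-∀
  ... | inj₂ i<n = trans (trans (*-congʳ (gauss-> i<n)) (zeroˡ _)) (sym (conv-zero n (λ c f _ →
          trans (*-congˡ (vanish c f)) (zeroʳ _))))
    where
    vanish : ∀ c f → gauss (i ℕ.+ w ℕ.+ c) (n ℕ.+ w ℕ.+ b) * (gauss b c * gauss (n ℕ.+ w) f) ≈ 0#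
    vanish c f with ℕₚ.≤-<-connex c b
    ... | inj₁ c≤b = trans (*-congʳ (gauss-> (ℕₚ.+-mono-<-≤ (ℕₚ.+-monoˡ-< w i<n) c≤b))) (zeroˡ _)
    ... | inj₂ b<c = trans (*-congˡ (trans (*-congʳ (gauss-> b<c)) (zeroˡ _))) (zeroʳ _)

  -- trinomial B L M a b is T(L,M;a+b,b;r²) as soon as L < B.
  trinomial : (B L M a b : ℕ) → Carrier
  trinomial B L M a b = sumRange B (λ n → sumRange B (λ s → guard (n ℕ.+ 2 ℕ.* s ℕ.+ a ℕ.+ b) L
    (pow r (n ℕ.* n) * (gauss M n * (gauss (M ℕ.+ b ℕ.+ s) s * gauss (M ℕ.+ a ℕ.+ s) (a ℕ.+ b ℕ.+ s))))))

  module _ (B L M a b : ℕ) (L<B : L < B) where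
    private
      Σ : (ℕ → Carrier) → Carrier
      Σ = sumRange B

      Σ-cong : ∀ {f g : ℕ → Carrier} → (∀ i → f i ≈ g i) → Σ f ≈ Σ g
      Σ-cong = sumRange-cong′ B

      Σ-comm : ∀ (f : ℕ → ℕ → Carrier) → Σ (λ i → Σ (f i)) ≈ Σ (λ j → Σ (λ i → f i j))
      Σ-comm = sumRange-comm B B

      left : (i n s c f : ℕ) → Carrier
      left i n s c f = pow r (i ℕ.* i) * gauss (M ℕ.+ (n ℕ.+ 2 ℕ.* s ℕ.+ a ℕ.+ b)) L * (pow r (n ℕ.* n) * (gauss (i ℕ.+ b ℕ.+ s) s *
        (pow p ((b ∸ c) ℕ.* f) * (gauss (i ℕ.+ (a ℕ.+ s) ℕ.+ c) (n ℕ.+ (a ℕ.+ s) ℕ.+ b) * (gauss b c * gauss (n ℕ.+ (a ℕ.+ s)) f)))))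

      -- For c ≤ b, `X N c` and `W s′ c` split the lower index N + (a + b + s′) + b that `split`
      -- leaves on the right-hand side. They are cut so that `linearization` applies a second time,
      -- with W = `W s′ c` and b = `X N c` + s′.
      X : (N c : ℕ) → ℕ
      X N c = N ℕ.+ (b ∸ c) ℕ.+ b

      W : (s′ c : ℕ) → ℕ
      W s′ c = a ℕ.+ s′ ℕ.+ c

      right : (N s′ c x s f : ℕ) → Carrier
      right N s′ c x s f = pow r (b ℕ.* b) * (pow r (N ℕ.* N) * (pow p ((b ∸ c) ℕ.* x) * (gauss b c * gauss (N ℕ.+ (a ℕ.+ b ℕ.+ s′)) x) *
        (pow p ((X N c ℕ.+ s′ ∸ s) ℕ.* f) * (gauss (W s′ c ℕ.+ (M ℕ.+ b) ℕ.+ s) (W s′ c ℕ.+ (X N c ℕ.+ s′)) * (gauss (X N c ℕ.+ s′) s * gauss (W s′ c) f)))))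

      weightL : (i n s : ℕ) → ℕ
      weightL i n s = i ℕ.+ (n ℕ.+ 2 ℕ.* s ℕ.+ a ℕ.+ b)

      weightR : (N s′ : ℕ) → ℕ
      weightR N s′ = N ℕ.+ 2 ℕ.* s′ ℕ.+ (a ℕ.+ b) ℕ.+ b

      F : (i s c f : ℕ) → Carrier
      F i s c f = guard (weightL i (c ℕ.+ f) s) L (left i (c ℕ.+ f) s c f)

      G : (c x s f : ℕ) → Carrier
      G c x s f = guard (weightR (c ℕ.+ x) (s ℕ.+ f)) L (right (c ℕ.+ x) (s ℕ.+ f) c x s f)

      -- The substitution i = b + f + x, n = c + f, N = c + x, s′ = s + f matches weights, powers of
      -- r and Gaussian polynomials one by one; the third Gaussian needs its lower index
      -- complemented. For c > b both sides contain [b; c] = 0.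
      F≈G : ∀ c x s f → F (b ℕ.+ f ℕ.+ x) s c f ≈ G c x s f
      F≈G c x s f with ℕₚ.≤-<-connex c b
      ... | inj₂ b<c = trans (guard-zero (λ _ → trans (*-congˡ (trans (*-congˡ (trans (*-congˡ (trans (*-congˡ
                (trans (*-congˡ gbc) (zeroʳ _))) (zeroʳ _))) (zeroʳ _))) (zeroʳ _))) (zeroʳ _)))
              (sym (guard-zero (λ _ → trans (*-congˡ (trans (*-congˡ (trans (*-congʳ (trans (*-congˡ gbc)
                (zeroʳ _))) (zeroˡ _))) (zeroʳ _))) (zeroʳ _))))
        where
        gbc : ∀ {y} → gauss b c * y ≈ 0#
        gbc = trans (*-congʳ (gauss-> b<c)) (zeroˡ _)
      ... | inj₁ c≤b with ℕₚ.m≤n⇒∃[o]m+o≡n c≤b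
      ... | d , c+d≡b = trans (guard-iff (≡.trans (≡.sym weights)) (≡.trans weights)) (guard-cong same)
        where
        i = b ℕ.+ f ℕ.+ x
        n = c ℕ.+ f
        N = c ℕ.+ x
        s′ = s ℕ.+ f
        weights : weightL i n s ≡ weightR N s′
        weights = lemma a b c f s x
          where
          lemma : ∀ a b c f s x → b ℕ.+ f ℕ.+ x ℕ.+ (c ℕ.+ f ℕ.+ 2 ℕ.* s ℕ.+ a ℕ.+ b) ≡ c ℕ.+ x ℕ.+ 2 ℕ.* (s ℕ.+ f) ℕ.+ (a ℕ.+ b) ℕ.+ b
          lemma = solve-∀
        b∸c : b ∸ c ≡ d
        b∸c = ≡.trans (≡.cong (_∸ c) (≡.sym c+d≡b)) (ℕₚ.m+n∸m≡n c d)
        bottom : weightR N s′ ≡ L → L ≡ W s′ c ℕ.+ (X N c ℕ.+ s′)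
        bottom eq = ≡.trans (≡.sym eq) (≡.trans (≡.cong (λ t → c ℕ.+ x ℕ.+ 2 ℕ.* (s ℕ.+ f) ℕ.+ (a ℕ.+ b) ℕ.+ t) (≡.sym c+d≡b)) (≡.trans (lemma a b c d f s x)
          (≡.cong (λ t → W s′ c ℕ.+ (N ℕ.+ t ℕ.+ b ℕ.+ s′)) (≡.sym b∸c))))
          where
          lemma : ∀ a b c d f s x → c ℕ.+ x ℕ.+ 2 ℕ.* (s ℕ.+ f) ℕ.+ (a ℕ.+ b) ℕ.+ (c ℕ.+ d) ≡ a ℕ.+ (s ℕ.+ f) ℕ.+ c ℕ.+ (c ℕ.+ x ℕ.+ d ℕ.+ b ℕ.+ (s ℕ.+ f))
          lemma = solve-∀
        g₁ : weightR N s′ ≡ L → gauss (M ℕ.+ (n ℕ.+ 2 ℕ.* s ℕ.+ a ℕ.+ b)) L ≈ gauss (W s′ c ℕ.+ (M ℕ.+ b) ℕ.+ s) (W s′ c ℕ.+ (X N c ℕ.+ s′))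
        g₁ eq = gauss-≡ (lemma M a b c f s) (bottom eq)
          where
          lemma : ∀ M a b c f s → M ℕ.+ (c ℕ.+ f ℕ.+ 2 ℕ.* s ℕ.+ a ℕ.+ b) ≡ a ℕ.+ (s ℕ.+ f) ℕ.+ c ℕ.+ (M ℕ.+ b) ℕ.+ s
          lemma = solve-∀
        g₂ : gauss (i ℕ.+ b ℕ.+ s) s ≈ gauss (X N c ℕ.+ s′) s
        g₂ = gauss-top s (≡.trans (≡.cong (λ t → t ℕ.+ f ℕ.+ x ℕ.+ b ℕ.+ s) (≡.sym c+d≡b)) (≡.trans (lemma b c d f s x)
          (≡.cong (λ t → N ℕ.+ t ℕ.+ b ℕ.+ s′) (≡.sym b∸c))))
          where
          lemma : ∀ b c d f s x → c ℕ.+ d ℕ.+ f ℕ.+ x ℕ.+ b ℕ.+ s ≡ c ℕ.+ x ℕ.+ d ℕ.+ b ℕ.+ (s ℕ.+ f)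
          lemma = solve-∀
        g₃ : gauss (i ℕ.+ (a ℕ.+ s) ℕ.+ c) (n ℕ.+ (a ℕ.+ s) ℕ.+ b) ≈ gauss (N ℕ.+ (a ℕ.+ b ℕ.+ s′)) x
        g₃ = trans (gauss-complement _ x (lemma₁ a b c f s x)) (gauss-top x (lemma₂ a b c f s x))
          where
          lemma₁ : ∀ a b c f s x → c ℕ.+ f ℕ.+ (a ℕ.+ s) ℕ.+ b ℕ.+ x ≡ b ℕ.+ f ℕ.+ x ℕ.+ (a ℕ.+ s) ℕ.+ c
          lemma₁ = solve-∀
          lemma₂ : ∀ a b c f s x → b ℕ.+ f ℕ.+ x ℕ.+ (a ℕ.+ s) ℕ.+ c ≡ c ℕ.+ x ℕ.+ (a ℕ.+ b ℕ.+ (s ℕ.+ f))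
          lemma₂ = solve-∀
        g₄ : gauss (n ℕ.+ (a ℕ.+ s)) f ≈ gauss (W s′ c) f
        g₄ = gauss-top f (lemma a c f s)
          where
          lemma : ∀ a c f s → c ℕ.+ f ℕ.+ (a ℕ.+ s) ≡ a ℕ.+ (s ℕ.+ f) ℕ.+ c
          lemma = solve-∀
        pow-p : ∀ k → pow p k ≈ pow r (2 ℕ.* k)
        pow-p = pow-pow r 2
        powers : pow r (i ℕ.* i) * pow r (n ℕ.* n) * pow p ((b ∸ c) ℕ.* f)
               ≈ pow r (b ℕ.* b) * pow r (N ℕ.* N) * pow p ((b ∸ c) ℕ.* x) * pow p ((X N c ℕ.+ s′ ∸ s) ℕ.* f)
        powers = begin
          pow r (i ℕ.* i) * pow r (n ℕ.* n) * pow p ((b ∸ c) ℕ.* f)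
            ≈⟨ *-cong (sym (pow-+ r (i ℕ.* i) (n ℕ.* n))) (pow-p ((b ∸ c) ℕ.* f)) ⟩
          pow r (i ℕ.* i ℕ.+ n ℕ.* n) * pow r (2 ℕ.* ((b ∸ c) ℕ.* f))
            ≈⟨ pow-+ r (i ℕ.* i ℕ.+ n ℕ.* n) _ ⟨
          pow r (i ℕ.* i ℕ.+ n ℕ.* n ℕ.+ 2 ℕ.* ((b ∸ c) ℕ.* f))
            ≈⟨ pow-≡ r exponents ⟩
          pow r (b ℕ.* b ℕ.+ N ℕ.* N ℕ.+ 2 ℕ.* ((b ∸ c) ℕ.* x) ℕ.+ 2 ℕ.* ((X N c ℕ.+ s′ ∸ s) ℕ.* f))
            ≈⟨ trans (pow-+ r (b ℕ.* b ℕ.+ N ℕ.* N ℕ.+ 2 ℕ.* ((b ∸ c) ℕ.* x)) _)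
                 (*-cong (trans (pow-+ r (b ℕ.* b ℕ.+ N ℕ.* N) _) (*-cong (pow-+ r (b ℕ.* b) _) (sym (pow-p ((b ∸ c) ℕ.* x))))) (sym (pow-p ((X N c ℕ.+ s′ ∸ s) ℕ.* f)))) ⟩
          pow r (b ℕ.* b) * pow r (N ℕ.* N) * pow p ((b ∸ c) ℕ.* x) * pow p ((X N c ℕ.+ s′ ∸ s) ℕ.* f) ∎
          where
          X+s′∸s : X N c ℕ.+ s′ ∸ s ≡ N ℕ.+ d ℕ.+ b ℕ.+ f
          X+s′∸s = ≡.trans (≡.cong (λ t → N ℕ.+ t ℕ.+ b ℕ.+ s′ ∸ s) b∸c) (≡.trans (≡.cong (_∸ s) (lemma (N ℕ.+ d ℕ.+ b) s f)) (ℕₚ.m+n∸m≡n s _))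
            where
            lemma : ∀ y s f → y ℕ.+ (s ℕ.+ f) ≡ s ℕ.+ (y ℕ.+ f)
            lemma = solve-∀
          exponents : i ℕ.* i ℕ.+ n ℕ.* n ℕ.+ 2 ℕ.* ((b ∸ c) ℕ.* f)
                    ≡ b ℕ.* b ℕ.+ N ℕ.* N ℕ.+ 2 ℕ.* ((b ∸ c) ℕ.* x) ℕ.+ 2 ℕ.* ((X N c ℕ.+ s′ ∸ s) ℕ.* f)
          exponents rewrite X+s′∸s | b∸c | ≡.sym c+d≡b = lemma c d f x
            where
            lemma : ∀ c d f x → (c ℕ.+ d ℕ.+ f ℕ.+ x) ℕ.* (c ℕ.+ d ℕ.+ f ℕ.+ x) ℕ.+ (c ℕ.+ f) ℕ.* (c ℕ.+ f) ℕ.+ 2 ℕ.* (d ℕ.* f)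
                  ≡ (c ℕ.+ d) ℕ.* (c ℕ.+ d) ℕ.+ (c ℕ.+ x) ℕ.* (c ℕ.+ x) ℕ.+ 2 ℕ.* (d ℕ.* x) ℕ.+ 2 ℕ.* ((c ℕ.+ x ℕ.+ d ℕ.+ (c ℕ.+ d) ℕ.+ f) ℕ.* f)
            lemma = solve-∀
        same : weightR N s′ ≡ L → left i n s c f ≈ right N s′ c x s f
        same eq = begin
          left i n s c f
            ≈⟨ solve 8 (λ e₁ g₁ e₂ g₂ e₃ g₃ k g₄ → e₁ :* g₁ :* (e₂ :* (g₂ :* (e₃ :* (g₃ :* (k :* g₄))))) := (e₁ :* e₂ :* e₃) :* (g₁ :* g₂ :* g₃ :* g₄ :* k)) refl _ _ _ _ _ _ _ _ ⟩
          (pow r (i ℕ.* i) * pow r (n ℕ.* n) * pow p ((b ∸ c) ℕ.* f)) * (gauss (M ℕ.+ (n ℕ.+ 2 ℕ.* s ℕ.+ a ℕ.+ b)) L * gauss (i ℕ.+ b ℕ.+ s) s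
            * gauss (i ℕ.+ (a ℕ.+ s) ℕ.+ c) (n ℕ.+ (a ℕ.+ s) ℕ.+ b) * gauss (n ℕ.+ (a ℕ.+ s)) f * gauss b c)
            ≈⟨ *-cong powers (*-congʳ (*-cong (*-cong (*-cong (g₁ eq) g₂) g₃) g₄)) ⟩
          (pow r (b ℕ.* b) * pow r (N ℕ.* N) * pow p ((b ∸ c) ℕ.* x) * pow p ((X N c ℕ.+ s′ ∸ s) ℕ.* f)) *
            (gauss (W s′ c ℕ.+ (M ℕ.+ b) ℕ.+ s) (W s′ c ℕ.+ (X N c ℕ.+ s′)) * gauss (X N c ℕ.+ s′) s * gauss (N ℕ.+ (a ℕ.+ b ℕ.+ s′)) x * gauss (W s′ c) f * gauss b c)
            ≈⟨ solve 9 (λ e₁ e₂ e₃ e₄ g₁ g₂ g₃ g₄ k → e₁ :* (e₂ :* (e₃ :* (k :* g₃) :* (e₄ :* (g₁ :* (g₂ :* g₄))))) := (e₁ :* e₂ :* e₃ :* e₄) :* (g₁ :* g₂ :* g₃ :* g₄ :* k)) refl _ _ _ _ _ _ _ _ _ ⟨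
          right N s′ c x s f ∎

      -- `split` is applied to [i; n] and [i + a + s; a + b + s], while [i + b + s; s] is carried
      -- along. On the weight i + w = L the prefactor [L + M - i; L] becomes [M + w; L].
      expandL : ∀ i n s → i ≤ L →
        pow r (i ℕ.* i) * gauss (L ℕ.+ M ∸ i) L * guard (n ℕ.+ 2 ℕ.* s ℕ.+ a ℕ.+ b) (L ∸ i)
          (pow r (n ℕ.* n) * (gauss i n * (gauss (i ℕ.+ b ℕ.+ s) s * gauss (i ℕ.+ a ℕ.+ s) (a ℕ.+ b ℕ.+ s))))
        ≈ conv n (λ c f → F i s c f)
      expandL i n s i≤L = begin
        pow r (i ℕ.* i) * gauss (L ℕ.+ M ∸ i) L * guard w (L ∸ i) (pow r (n ℕ.* n) * (gauss i n * (gauss (i ℕ.+ b ℕ.+ s) s * gauss (i ℕ.+ a ℕ.+ s) (a ℕ.+ b ℕ.+ s))))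
          ≈⟨ guard-*ˡ _ _ _ _ ⟩
        guard w (L ∸ i) (pow r (i ℕ.* i) * gauss (L ℕ.+ M ∸ i) L * (pow r (n ℕ.* n) * (gauss i n * (gauss (i ℕ.+ b ℕ.+ s) s * gauss (i ℕ.+ a ℕ.+ s) (a ℕ.+ b ℕ.+ s)))))
          ≈⟨ guard-iff to from ⟩
        guard (i ℕ.+ w) L (pow r (i ℕ.* i) * gauss (L ℕ.+ M ∸ i) L * (pow r (n ℕ.* n) * (gauss i n * (gauss (i ℕ.+ b ℕ.+ s) s * gauss (i ℕ.+ a ℕ.+ s) (a ℕ.+ b ℕ.+ s)))))
          ≈⟨ guard-cong (λ eq → *-cong (*-congˡ (gauss-top L (top eq))) (*-congˡ product)) ⟩
        guard (i ℕ.+ w) L (pow r (i ℕ.* i) * gauss (M ℕ.+ w) L * (pow r (n ℕ.* n) * (gauss (i ℕ.+ b ℕ.+ s) s * conv n C)))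
          ≈⟨ guard-cong (λ _ → trans (*-congˡ (trans (*-congˡ (conv-*ˡ n _ C)) (conv-*ˡ n _ _))) (conv-*ˡ n _ _)) ⟩
        guard (i ℕ.+ w) L (conv n (left i n s))
          ≈⟨ guard-conv (i ℕ.+ w) L n (left i n s) ⟩
        conv n (λ c f → guard (i ℕ.+ w) L (left i n s c f))
          ≈⟨ conv-cong n (λ { c f ≡.refl → refl }) ⟩
        conv n (λ c f → F i s c f) ∎
        where
        w = n ℕ.+ 2 ℕ.* s ℕ.+ a ℕ.+ b
        C : ℕ → ℕ → Carrier
        C c f = pow p ((b ∸ c) ℕ.* f) * (gauss (i ℕ.+ (a ℕ.+ s) ℕ.+ c) (n ℕ.+ (a ℕ.+ s) ℕ.+ b) * (gauss b c * gauss (n ℕ.+ (a ℕ.+ s)) f))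
        to : w ≡ L ∸ i → i ℕ.+ w ≡ L
        to eq = ≡.trans (≡.cong (i ℕ.+_) eq) (ℕₚ.m+[n∸m]≡n i≤L)
        from : i ℕ.+ w ≡ L → w ≡ L ∸ i
        from eq = ≡.trans (≡.sym (ℕₚ.m+n∸m≡n i w)) (≡.cong (_∸ i) eq)
        top : i ℕ.+ w ≡ L → L ℕ.+ M ∸ i ≡ M ℕ.+ w
        top eq = ≡.trans (≡.cong (λ t → t ℕ.+ M ∸ i) (≡.sym eq)) (≡.trans (≡.cong (_∸ i) (ℕₚ.+-assoc i w M)) (≡.trans (ℕₚ.m+n∸m≡n i (w ℕ.+ M)) (ℕₚ.+-comm w M)))
        product : gauss i n * (gauss (i ℕ.+ b ℕ.+ s) s * gauss (i ℕ.+ a ℕ.+ s) (a ℕ.+ b ℕ.+ s)) ≈ gauss (i ℕ.+ b ℕ.+ s) s * conv n C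
        product = begin
          gauss i n * (gauss (i ℕ.+ b ℕ.+ s) s * gauss (i ℕ.+ a ℕ.+ s) (a ℕ.+ b ℕ.+ s))
            ≈⟨ solve 3 (λ x y z → x :* (y :* z) := y :* (x :* z)) refl _ _ _ ⟩
          gauss (i ℕ.+ b ℕ.+ s) s * (gauss i n * gauss (i ℕ.+ a ℕ.+ s) (a ℕ.+ b ℕ.+ s))
            ≈⟨ *-congˡ (*-congˡ (gauss-≡ (ℕₚ.+-assoc i a s) (lemma a b s))) ⟩
          gauss (i ℕ.+ b ℕ.+ s) s * (gauss i n * gauss (i ℕ.+ (a ℕ.+ s)) (a ℕ.+ s ℕ.+ b))
            ≈⟨ *-congˡ (split i n (a ℕ.+ s) b) ⟩
          gauss (i ℕ.+ b ℕ.+ s) s * conv n C ∎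
          where
          lemma : ∀ a b s → a ℕ.+ b ℕ.+ s ≡ a ℕ.+ s ℕ.+ b
          lemma = solve-∀

      expandR : ∀ N s′ →
        pow r (b ℕ.* b) * guard (N ℕ.+ 2 ℕ.* s′ ℕ.+ (a ℕ.+ b) ℕ.+ b) L
          (pow r (N ℕ.* N) * (gauss M N * (gauss (M ℕ.+ b ℕ.+ s′) s′ * gauss (M ℕ.+ (a ℕ.+ b) ℕ.+ s′) (a ℕ.+ b ℕ.+ b ℕ.+ s′))))
        ≈ conv N (λ c x → conv s′ (λ s f → G c x s f))
      expandR N s′ = begin
        pow r (b ℕ.* b) * guard w L (pow r (N ℕ.* N) * (gauss M N * (gauss (M ℕ.+ b ℕ.+ s′) s′ * gauss (M ℕ.+ (a ℕ.+ b) ℕ.+ s′) (a ℕ.+ b ℕ.+ b ℕ.+ s′))))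
          ≈⟨ guard-*ˡ _ _ _ _ ⟩
        guard w L (pow r (b ℕ.* b) * (pow r (N ℕ.* N) * (gauss M N * (gauss (M ℕ.+ b ℕ.+ s′) s′ * gauss (M ℕ.+ (a ℕ.+ b) ℕ.+ s′) (a ℕ.+ b ℕ.+ b ℕ.+ s′)))))
          ≈⟨ guard-cong (λ _ → *-congˡ (*-congˡ product)) ⟩
        guard w L (pow r (b ℕ.* b) * (pow r (N ℕ.* N) * conv N (λ c x → conv s′ (C c x))))
          ≈⟨ guard-cong (λ _ → trans (*-congˡ (trans (conv-*ˡ N _ _) (conv-cong N (λ c x _ → conv-*ˡ s′ _ (C c x)))))
                                     (trans (conv-*ˡ N _ _) (conv-cong N (λ c x _ → conv-*ˡ s′ _ _)))) ⟩
        guard w L (conv N (λ c x → conv s′ (right N s′ c x)))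
          ≈⟨ trans (guard-conv w L N _) (conv-cong N (λ c x _ → guard-conv w L s′ _)) ⟩
        conv N (λ c x → conv s′ (λ s f → guard w L (right N s′ c x s f)))
          ≈⟨ conv-cong N (λ { c x ≡.refl → conv-cong s′ (λ { s f ≡.refl → refl }) }) ⟩
        conv N (λ c x → conv s′ (λ s f → G c x s f)) ∎
        where
        w = weightR N s′
        w′ = a ℕ.+ b ℕ.+ s′
        C : (c x s f : ℕ) → Carrier
        C c x s f = pow p ((b ∸ c) ℕ.* x) * (gauss b c * gauss (N ℕ.+ w′) x) *
          (pow p ((X N c ℕ.+ s′ ∸ s) ℕ.* f) * (gauss (W s′ c ℕ.+ (M ℕ.+ b) ℕ.+ s) (W s′ c ℕ.+ (X N c ℕ.+ s′)) * (gauss (X N c ℕ.+ s′) s * gauss (W s′ c) f)))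
        -- The second linearization on this side. For c ≤ b the Gaussian left by `split` is
        -- [W + (M + b); W + X], and its product with the remaining factor [M + b + s′; s′] has the
        -- balanced form required by `linearization`.
        merge : ∀ c x → gauss (M ℕ.+ b ℕ.+ s′) s′ * (pow p ((b ∸ c) ℕ.* x) * (gauss (M ℕ.+ w′ ℕ.+ c) (N ℕ.+ w′ ℕ.+ b) * (gauss b c * gauss (N ℕ.+ w′) x)))
          ≈ conv s′ (C c x)
        merge c x with ℕₚ.≤-<-connex c b
        ... | inj₂ b<c = trans (trans (*-congˡ (trans (*-congˡ (trans (*-congˡ gbc) (zeroʳ _))) (zeroʳ _))) (zeroʳ _))
                (sym (conv-zero s′ (λ s f _ → trans (*-congʳ (trans (*-congˡ gbc) (zeroʳ _))) (zeroˡ _))))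
          where
          gbc : ∀ {y} → gauss b c * y ≈ 0#
          gbc = trans (*-congʳ (gauss-> b<c)) (zeroˡ _)
        ... | inj₁ c≤b = begin
          gauss (M ℕ.+ b ℕ.+ s′) s′ * (pow p ((b ∸ c) ℕ.* x) * (gauss (M ℕ.+ w′ ℕ.+ c) (N ℕ.+ w′ ℕ.+ b) * (gauss b c * gauss (N ℕ.+ w′) x)))
            ≈⟨ solve 4 (λ x y z u → x :* (y :* (z :* u)) := y :* u :* (x :* z)) refl _ _ _ _ ⟩
          pow p ((b ∸ c) ℕ.* x) * (gauss b c * gauss (N ℕ.+ w′) x) * (gauss (M ℕ.+ b ℕ.+ s′) s′ * gauss (M ℕ.+ w′ ℕ.+ c) (N ℕ.+ w′ ℕ.+ b))
            ≈⟨ *-congˡ (*-congˡ (gauss-≡ (lemma M a b c s′) low)) ⟩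
          pow p ((b ∸ c) ℕ.* x) * (gauss b c * gauss (N ℕ.+ w′) x) * (gauss (M ℕ.+ b ℕ.+ s′) s′ * gauss (W s′ c ℕ.+ (M ℕ.+ b)) (W s′ c ℕ.+ X N c))
            ≈⟨ *-congˡ (linearization (W s′ c) (X N c ℕ.+ s′) (M ℕ.+ b) s′ (W s′ c ℕ.+ X N c) (lemma′ (W s′ c) (X N c) s′)) ⟩
          pow p ((b ∸ c) ℕ.* x) * (gauss b c * gauss (N ℕ.+ w′) x) * conv s′ (λ s f → pow p ((X N c ℕ.+ s′ ∸ s) ℕ.* f)
              * (gauss (W s′ c ℕ.+ (M ℕ.+ b) ℕ.+ s) (W s′ c ℕ.+ (X N c ℕ.+ s′)) * (gauss (X N c ℕ.+ s′) s * gauss (W s′ c) f)))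
            ≈⟨ conv-*ˡ s′ _ _ ⟩
          conv s′ (C c x) ∎
          where
          lemma : ∀ M a b c s′ → M ℕ.+ (a ℕ.+ b ℕ.+ s′) ℕ.+ c ≡ a ℕ.+ s′ ℕ.+ c ℕ.+ (M ℕ.+ b)
          lemma = solve-∀
          lemma′ : ∀ W X s′ → W ℕ.+ (X ℕ.+ s′) ≡ s′ ℕ.+ (W ℕ.+ X)
          lemma′ = solve-∀
          low : N ℕ.+ w′ ℕ.+ b ≡ W s′ c ℕ.+ X N c
          low = ≡.trans (≡.cong (N ℕ.+ w′ ℕ.+_) (≡.sym (ℕₚ.m+[n∸m]≡n c≤b))) (lemma″ N a b c (b ∸ c) s′)
            where
            lemma″ : ∀ N a b c d s′ → N ℕ.+ (a ℕ.+ b ℕ.+ s′) ℕ.+ (c ℕ.+ d) ≡ a ℕ.+ s′ ℕ.+ c ℕ.+ (N ℕ.+ d ℕ.+ b)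
            lemma″ = solve-∀
        product : gauss M N * (gauss (M ℕ.+ b ℕ.+ s′) s′ * gauss (M ℕ.+ (a ℕ.+ b) ℕ.+ s′) (a ℕ.+ b ℕ.+ b ℕ.+ s′)) ≈ conv N (λ c x → conv s′ (C c x))
        product = begin
          gauss M N * (gauss (M ℕ.+ b ℕ.+ s′) s′ * gauss (M ℕ.+ (a ℕ.+ b) ℕ.+ s′) (a ℕ.+ b ℕ.+ b ℕ.+ s′))
            ≈⟨ solve 3 (λ x y z → x :* (y :* z) := y :* (x :* z)) refl _ _ _ ⟩
          gauss (M ℕ.+ b ℕ.+ s′) s′ * (gauss M N * gauss (M ℕ.+ (a ℕ.+ b) ℕ.+ s′) (a ℕ.+ b ℕ.+ b ℕ.+ s′))
            ≈⟨ *-congˡ (*-congˡ (gauss-≡ (ℕₚ.+-assoc M (a ℕ.+ b) s′) (lemma a b s′))) ⟩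
          gauss (M ℕ.+ b ℕ.+ s′) s′ * (gauss M N * gauss (M ℕ.+ w′) (w′ ℕ.+ b))
            ≈⟨ *-congˡ (split M N w′ b) ⟩
          gauss (M ℕ.+ b ℕ.+ s′) s′ * conv N (λ c x → pow p ((b ∸ c) ℕ.* x) * (gauss (M ℕ.+ w′ ℕ.+ c) (N ℕ.+ w′ ℕ.+ b) * (gauss b c * gauss (N ℕ.+ w′) x)))
            ≈⟨ trans (conv-*ˡ N _ _) (conv-cong N (λ c x _ → merge c x)) ⟩
          conv N (λ c x → conv s′ (C c x)) ∎
          where
          lemma : ∀ a b s → a ℕ.+ b ℕ.+ b ℕ.+ s ≡ a ℕ.+ b ℕ.+ s ℕ.+ b
          lemma = solve-∀

      ¬weight : ∀ {x} → B ≤ x → x ≢ L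
      ¬weight B≤x ≡.refl = ℕₚ.<⇒≱ L<B B≤x

      -- With n = c + f, the Gaussian with lower index n + (a + s) + b vanishes for i < b + f, so i
      -- can be written b + f + x.
      shiftF : ∀ s c f → Σ (λ i → F i s c f) ≈ Σ (λ x → F (b ℕ.+ f ℕ.+ x) s c f)
      shiftF s c f = sumRange-shift B (b ℕ.+ f)
        (λ i i<b+f → guard-zero (λ _ → trans (*-congˡ (trans (*-congˡ (trans (*-congˡ (trans (*-congˡ
            (trans (*-congʳ (gauss-> (top i i<b+f))) (zeroˡ _))) (zeroʳ _))) (zeroʳ _))) (zeroʳ _))) (zeroʳ _)))
        (λ i B≤i → guard-no (¬weight (ℕₚ.≤-trans B≤i (ℕₚ.m≤m+n i _))))
        where
        top : ∀ i → i < b ℕ.+ f → i ℕ.+ (a ℕ.+ s) ℕ.+ c < c ℕ.+ f ℕ.+ (a ℕ.+ s) ℕ.+ b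
        top i i<b+f = ≡.subst (i ℕ.+ (a ℕ.+ s) ℕ.+ c <_) (lemma a b c f s) (ℕₚ.+-monoˡ-< c (ℕₚ.+-monoˡ-< (a ℕ.+ s) i<b+f))
          where
          lemma : ∀ a b c f s → b ℕ.+ f ℕ.+ (a ℕ.+ s) ℕ.+ c ≡ c ℕ.+ f ℕ.+ (a ℕ.+ s) ℕ.+ b
          lemma = solve-∀

    transformation :
      sumRange (suc L) (λ i → pow r (i ℕ.* i) * gauss (L ℕ.+ M ∸ i) L * trinomial B (L ∸ i) i a b)
      ≈ pow r (b ℕ.* b) * trinomial B L M (a ℕ.+ b) b
    transformation = begin
      sumRange (suc L) (λ i → pow r (i ℕ.* i) * gauss (L ℕ.+ M ∸ i) L * trinomial B (L ∸ i) i a b)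
        ≈⟨ sumRange-cong (suc L) (λ { i (s≤s i≤L) → trans (sumRange-*ˡ B _ _) (Σ-cong (λ n → trans (sumRange-*ˡ B _ _) (Σ-cong (λ s → expandL i n s i≤L)))) }) ⟩
      sumRange (suc L) (λ i → Σ (λ n → Σ (λ s → conv n (F i s))))
        -- The weight is at least i, so the guard already enforces i ≤ L and the outer sum can take
        -- the common bound.
        ≈⟨ sumRange-extend L<B (λ i L<i → sumRange-zero B (λ n _ → sumRange-zero B (λ s _ → conv-zero n (λ c f _ →
             guard-no (ℕₚ.>⇒≢ (ℕₚ.<-≤-trans L<i (ℕₚ.m≤m+n i _))))))) ⟩
      Σ (λ i → Σ (λ n → Σ (λ s → conv n (F i s))))
        ≈⟨ Σ-cong (λ i → trans (Σ-comm _) (Σ-cong (λ s → sumRange-conv B (F i s) (λ c f B≤c+f → guard-no (¬weight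
             (ℕₚ.≤-trans B≤c+f (ℕₚ.≤-trans (ℕₚ.m≤m+n (c ℕ.+ f) (2 ℕ.* s ℕ.+ a ℕ.+ b)) (ℕₚ.≤-trans (ℕₚ.≤-reflexive (lemma (c ℕ.+ f) s a b)) (ℕₚ.m≤n+m _ i)))))))))  ⟩
      Σ (λ i → Σ (λ s → Σ (λ c → Σ (F i s c))))
        ≈⟨ trans (Σ-comm _) (Σ-cong (λ s → trans (Σ-comm _) (Σ-cong (λ c → trans (Σ-comm _) (Σ-cong (λ f → shiftF s c f)))))) ⟩
      Σ (λ s → Σ (λ c → Σ (λ f → Σ (λ x → F (b ℕ.+ f ℕ.+ x) s c f))))
        ≈⟨ Σ-cong (λ s → Σ-cong (λ c → Σ-cong (λ f → Σ-cong (λ x → F≈G c x s f)))) ⟩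
      Σ (λ s → Σ (λ c → Σ (λ f → Σ (λ x → G c x s f))))
        ≈⟨ trans (Σ-comm _) (Σ-cong (λ c → trans (Σ-cong (λ s → Σ-comm _)) (Σ-comm _))) ⟩
      Σ (λ c → Σ (λ x → Σ (λ s → Σ (G c x s))))
        ≈⟨ sumRange-conv B _ (λ c x B≤c+x → sumRange-zero B (λ s _ → sumRange-zero B (λ f _ → guard-no (¬weight
             (ℕₚ.≤-trans B≤c+x (ℕₚ.≤-trans (ℕₚ.m≤m+n (c ℕ.+ x) (2 ℕ.* (s ℕ.+ f) ℕ.+ (a ℕ.+ b) ℕ.+ b)) (ℕₚ.≤-reflexive (lemma (c ℕ.+ x) (s ℕ.+ f) (a ℕ.+ b) b)))))))) ⟨
      Σ (λ N → conv N (λ c x → Σ (λ s → Σ (G c x s))))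
        ≈⟨ Σ-cong (λ N → conv-cong N (λ c x _ → sumRange-conv B (G c x) (λ s f B≤s+f → guard-no (¬weight
             (ℕₚ.≤-trans B≤s+f (ℕₚ.≤-trans (ℕₚ.m≤m+n (s ℕ.+ f) (c ℕ.+ x ℕ.+ (s ℕ.+ f) ℕ.+ (a ℕ.+ b) ℕ.+ b)) (ℕₚ.≤-reflexive (lemma′ (s ℕ.+ f) (c ℕ.+ x) (a ℕ.+ b) b)))))))) ⟨
      Σ (λ N → conv N (λ c x → Σ (λ s′ → conv s′ (G c x))))
        ≈⟨ Σ-cong (λ N → sumRange-conv-comm B N _) ⟨
      Σ (λ N → Σ (λ s′ → conv N (λ c x → conv s′ (G c x))))
        ≈⟨ trans (sumRange-*ˡ B _ _) (Σ-cong (λ N → trans (sumRange-*ˡ B _ _) (Σ-cong (λ s′ → expandR N s′)))) ⟨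
      pow r (b ℕ.* b) * trinomial B L M (a ℕ.+ b) b ∎
      where
      lemma : ∀ n s a b → n ℕ.+ (2 ℕ.* s ℕ.+ a ℕ.+ b) ≡ n ℕ.+ 2 ℕ.* s ℕ.+ a ℕ.+ b
      lemma = solve-∀
      lemma′ : ∀ s n a b → s ℕ.+ (n ℕ.+ s ℕ.+ a ℕ.+ b) ≡ n ℕ.+ 2 ℕ.* s ℕ.+ a ℕ.+ b
      lemma′ = solve-∀

-- Generating functions of products over arithmetic progressions.

module Progressions {c ℓ} (R : CommutativeRing c ℓ) where
  open CommutativeRing R hiding (zero)
  open QDefs R
  open FiniteSums R
  open Powers R
  open SetoidReasoning setoid
  open import Algebra.Solver.Ring.NaturalCoefficients.Default commutativeSemiring
    using (solve; _:+_; _:*_; _:=_)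

  infix 4 _≗′_
  _≗′_ : (f g : ℕ → Carrier) → Set ℓ
  f ≗′ g = ∀ k → f k ≈ g k

  -- Sequences stand for generating functions in z: mul y f is (1 + y z) f.
  mul : Carrier → (ℕ → Carrier) → ℕ → Carrier
  mul y f zero    = f 0
  mul y f (suc k) = f (suc k) + y * f k

  infixr 7 _⊛_
  _⊛_ : (f g : ℕ → Carrier) → ℕ → Carrier
  (f ⊛ g) k = conv k (λ i j → f i * g j)

  mul-cong : ∀ {x y f g} → x ≈ y → f ≗′ g → mul x f ≗′ mul y g
  mul-cong x≈y f≗g zero    = f≗g 0
  mul-cong x≈y f≗g (suc k) = +-cong (f≗g (suc k)) (*-cong x≈y (f≗g k))

  ⊛-cong : ∀ {f f′ g g′} → f ≗′ f′ → g ≗′ g′ → f ⊛ g ≗′ f′ ⊛ g′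
  ⊛-cong f≗ g≗ k = conv-cong k (λ i j _ → *-cong (f≗ i) (g≗ j))

  ⊛-comm : ∀ f g → f ⊛ g ≗′ g ⊛ f
  ⊛-comm f g k = trans (conv-flip k _) (conv-cong k (λ i j _ → *-comm _ _))

  mul-⊛ˡ : ∀ y f g → mul y f ⊛ g ≗′ mul y (f ⊛ g)
  mul-⊛ˡ y f g zero    = refl
  mul-⊛ˡ y f g (suc k) = begin
    f 0 * g (suc k) + conv k (λ i j → (f (suc i) + y * f i) * g j)
      ≈⟨ +-congˡ (conv-cong k (λ i j _ → trans (distribʳ _ _ _) (+-congˡ (*-assoc _ _ _)))) ⟩
    f 0 * g (suc k) + conv k (λ i j → f (suc i) * g j + y * (f i * g j))
      ≈⟨ +-congˡ (trans (conv-+ k _ _) (+-congˡ (sym (conv-*ˡ k y _)))) ⟩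
    f 0 * g (suc k) + (conv k (λ i j → f (suc i) * g j) + y * (f ⊛ g) k)
      ≈⟨ +-assoc _ _ _ ⟨
    (f ⊛ g) (suc k) + y * (f ⊛ g) k ∎

  mul-⊛ʳ : ∀ y f g → f ⊛ mul y g ≗′ mul y (f ⊛ g)
  mul-⊛ʳ y f g k = trans (⊛-comm f (mul y g) k) (trans (mul-⊛ˡ y g f k) (mul-cong refl (⊛-comm g f) k))

  -- This is x^k P^(k(k-1)/2), the coefficient of the q-binomial theorem, given by a recursion that
  -- avoids halving.
  weight : (x P : Carrier) → ℕ → Carrier
  weight x P zero    = 1#
  weight x P (suc k) = weight x P k * (x * pow P k)

  -- progression x P n generates (1 + x z)(1 + x P z) ⋯ (1 + x P ^ (n - 1) z), by the q-binomial theorem.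
  progression : (x P : Carrier) → ℕ → ℕ → Carrier
  progression x P n k = weight x P k * gauss P n k

  -- Appends the last factor 1 + x P^n z. The dual rule `pascal` is the right one: it gives P^d with
  -- d = n - k, which joins the P^k of `weight` to form P^n.
  progression-suc : ∀ x P n → progression x P (suc n) ≗′ mul (x * pow P n) (progression x P n)
  progression-suc x P n zero    = refl
  progression-suc x P n (suc k) with ℕₚ.≤-<-connex k n
  ... | inj₂ n<k = trans (vanish (s≤s n<k)) (sym (trans (+-cong (vanish (ℕₚ.m<n⇒m<1+n n<k)) (trans (*-congˡ (vanish n<k)) (zeroʳ _))) (+-identityˡ 0#)))
    where
    vanish : ∀ {n k} → n < k → progression x P n k ≈ 0#
    vanish n<k = trans (*-congˡ (Gaussian.gauss-> R P n<k)) (zeroʳ _)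
  ... | inj₁ k≤n with ℕₚ.m≤n⇒∃[o]m+o≡n k≤n
  ... | d , ≡.refl = begin
    weight x P k * (x * pow P k) * gauss P (suc (k ℕ.+ d)) (suc k)
      ≈⟨ *-congˡ (Gaussian.pascal R P k d) ⟩
    weight x P k * (x * pow P k) * (gauss P (k ℕ.+ d) (suc k) + pow P d * gauss P (k ℕ.+ d) k)
      ≈⟨ solve 6 (λ w x K g D h → w :* (x :* K) :* (g :+ D :* h) := w :* (x :* K) :* g :+ (x :* (K :* D)) :* (w :* h)) refl _ _ _ _ _ _ ⟩
    weight x P k * (x * pow P k) * gauss P (k ℕ.+ d) (suc k) + (x * (pow P k * pow P d)) * (weight x P k * gauss P (k ℕ.+ d) k)
      ≈⟨ +-congˡ (*-congʳ (*-congˡ (pow-+ P k d))) ⟨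
    weight x P k * (x * pow P k) * gauss P (k ℕ.+ d) (suc k) + (x * pow P (k ℕ.+ d)) * (weight x P k * gauss P (k ℕ.+ d) k) ∎

  progression-0-⊛ : ∀ x P f → progression x P 0 ⊛ f ≗′ f
  progression-0-⊛ x P f zero    = trans (*-congʳ (*-identityʳ 1#)) (*-identityˡ _)
  progression-0-⊛ x P f (suc k) = trans (+-cong (trans (*-congʳ (*-identityʳ 1#)) (*-identityˡ _))
    (conv-zero k (λ i j _ → trans (*-congʳ (zeroʳ _)) (zeroˡ _)))) (+-identityʳ _)

  -- The exponent of q has first differences u + v k. The pairs (u, v) = (1, 2), (5, 6), (3, 6), (1,
  -- 6) give k², `e₊ k`, 3 k² and `e₋ k`, which is where the exponents of the theorem come from.
  weight-pow : ∀ q u v (e : ℕ → ℕ) → e 0 ≡ 0 → (∀ k → e (suc k) ≡ e k ℕ.+ (u ℕ.+ v ℕ.* k)) →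
    ∀ {x P} → x ≈ pow q u → P ≈ pow q v → ∀ k → weight x P k ≈ pow q (e k)
  weight-pow q u v e e0 e+ x≈ P≈ zero    = sym (pow-≡ q e0)
  weight-pow q u v e e0 e+ {x} {P} x≈ P≈ (suc k) = begin
    weight x P k * (x * pow P k)
      ≈⟨ *-cong (weight-pow q u v e e0 e+ x≈ P≈ k) (*-cong x≈ (trans (pow-cong k P≈) (pow-pow q v k))) ⟩
    pow q (e k) * (pow q u * pow q (v ℕ.* k))
      ≈⟨ *-congˡ (pow-+ q u (v ℕ.* k)) ⟨
    pow q (e k) * pow q (u ℕ.+ v ℕ.* k)
      ≈⟨ pow-+ q (e k) _ ⟨
    pow q (e k ℕ.+ (u ℕ.+ v ℕ.* k))
      ≈⟨ pow-≡ q (e+ k) ⟨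
    pow q (e (suc k)) ∎

  -- Raising M by one adds the factors with q^(6M+1), q^(6M+3) and q^(6M+5), and each of them is the
  -- next factor of exactly one of the three progressions.
  progression-trisection : ∀ q M → progression q (pow q 2) (3 ℕ.* M) ≗′
    progression (pow q 5) (pow q 6) M ⊛ progression (pow q 3) (pow q 6) M ⊛ progression q (pow q 6) M
  progression-trisection q zero    k = sym (trans (progression-0-⊛ (pow q 5) P _ k) (trans (progression-0-⊛ (pow q 3) P _ k) (same k)))
    where
    P = pow q 6
    same : progression q P 0 ≗′ progression q (pow q 2) 0
    same zero    = refl
    same (suc k) = trans (zeroʳ _) (sym (zeroʳ _))
  progression-trisection q (suc M) k = begin
    progression q Q (3 ℕ.* suc M) k
      ≡⟨ ≡.cong (λ n → progression q Q n k) (lemma M) ⟩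
    progression q Q (3 ℕ.+ 3 ℕ.* M) k
      ≈⟨ trans (progression-suc q Q (2 ℕ.+ 3 ℕ.* M) k) (mul-cong refl (λ k → trans (progression-suc q Q (1 ℕ.+ 3 ℕ.* M) k)
           (mul-cong refl (progression-suc q Q (3 ℕ.* M)) k)) k) ⟩
    mul (q * pow Q (2 ℕ.+ 3 ℕ.* M)) (mul (q * pow Q (1 ℕ.+ 3 ℕ.* M)) (mul (q * pow Q (3 ℕ.* M)) (progression q Q (3 ℕ.* M)))) k
      ≈⟨ mul-cong (factor 2) (mul-cong (factor 1) (mul-cong (trans (factor 0) (*-congʳ (*-identityʳ q))) (progression-trisection q M))) k ⟩
    mul (pow q 5 * pow P M) (mul (pow q 3 * pow P M) (mul (q * pow P M) (C ⊛ A ⊛ B))) k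
      ≈⟨ mul-cong refl (λ k → trans (mul-cong refl (λ k → trans (sym (mul-⊛ʳ (q * pow P M) C (A ⊛ B) k)) (⊛-cong (λ _ → refl) (λ k → sym (mul-⊛ʳ (q * pow P M) A B k)) k)) k)
           (trans (sym (mul-⊛ʳ (pow q 3 * pow P M) C _ k)) (⊛-cong (λ _ → refl) (λ k → sym (mul-⊛ˡ (pow q 3 * pow P M) A _ k)) k))) k ⟩
    mul (pow q 5 * pow P M) (C ⊛ mul (pow q 3 * pow P M) A ⊛ mul (q * pow P M) B) k
      ≈⟨ mul-⊛ˡ _ C _ k ⟨
    (mul (pow q 5 * pow P M) C ⊛ mul (pow q 3 * pow P M) A ⊛ mul (q * pow P M) B) k
      ≈⟨ ⊛-cong (progression-suc (pow q 5) P M) (⊛-cong (progression-suc (pow q 3) P M) (progression-suc q P M)) k ⟨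
    (progression (pow q 5) P (suc M) ⊛ progression (pow q 3) P (suc M) ⊛ progression q P (suc M)) k ∎
    where
    Q = pow q 2
    P = pow q 6
    A = progression (pow q 3) P M
    B = progression q P M
    C = progression (pow q 5) P M
    lemma : ∀ M → 3 ℕ.* suc M ≡ 3 ℕ.+ 3 ℕ.* M
    lemma = solve-∀
    factor : ∀ i → q * pow Q (i ℕ.+ 3 ℕ.* M) ≈ pow q (1 ℕ.+ 2 ℕ.* i) * pow P M
    factor i = begin
      q * pow Q (i ℕ.+ 3 ℕ.* M)                     ≈⟨ *-congˡ (pow-pow q 2 (i ℕ.+ 3 ℕ.* M)) ⟩
      q * pow q (2 ℕ.* (i ℕ.+ 3 ℕ.* M))             ≈⟨ pow-≡ q (lemma′ i M) ⟩
      pow q (1 ℕ.+ 2 ℕ.* i ℕ.+ 6 ℕ.* M)             ≈⟨ pow-+ q (1 ℕ.+ 2 ℕ.* i) (6 ℕ.* M) ⟩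
      pow q (1 ℕ.+ 2 ℕ.* i) * pow q (6 ℕ.* M)       ≈⟨ *-congˡ (pow-pow q 6 M) ⟨
      pow q (1 ℕ.+ 2 ℕ.* i) * pow P M               ∎
      where
      lemma′ : ∀ i M → suc (2 ℕ.* (i ℕ.+ 3 ℕ.* M)) ≡ 1 ℕ.+ 2 ℕ.* i ℕ.+ 6 ℕ.* M
      lemma′ = solve-∀

-- A symmetric special case of the linearization.

module Saalschütz {c ℓ} (R : CommutativeRing c ℓ) (p : CommutativeRing.Carrier R) where
  open CommutativeRing R hiding (zero)
  open QDefs R using (pow; sumRange)
  open FiniteSums R
  open Powers R
  open Gaussian R p
  open Linearization R p
  open SetoidReasoning setoid

  -- Complementing both lower indices gives `linearization` at W = b = M, but with a sum over c + f
  -- = M - D instead of k + f = A. Both are sums of the same `H` over f, and `H` vanishes beyond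
  -- either bound.
  saalschütz : ∀ M A D → gauss (M ℕ.+ A ℕ.+ D) A * gauss (M ℕ.+ A) (A ℕ.+ D) ≈
    conv A (λ k f → pow p (f ℕ.* (f ℕ.+ D)) * (gauss (2 ℕ.* M ℕ.+ k) k * (gauss M f * gauss M (f ℕ.+ D))))
  saalschütz M A D with ℕₚ.≤-<-connex D M
  ... | inj₂ M<D = trans (trans (*-congˡ (gauss-> (≡.subst (M ℕ.+ A <_) (ℕₚ.+-comm D A) (ℕₚ.+-monoˡ-< A M<D)))) (zeroʳ _))
        (sym (conv-zero A (λ k f _ → trans (*-congˡ (trans (*-congˡ (trans (*-congˡ (gauss-> (ℕₚ.<-≤-trans M<D (ℕₚ.m≤n+m D f)))) (zeroʳ _))) (zeroʳ _))) (zeroʳ _))))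
  ... | inj₁ D≤M with ℕₚ.m≤n⇒∃[o]m+o≡n D≤M
  ... | N , D+N≡M = begin
    gauss (M ℕ.+ A ℕ.+ D) A * gauss (M ℕ.+ A) (A ℕ.+ D)
      ≈⟨ *-comm _ _ ⟩
    gauss (M ℕ.+ A) (A ℕ.+ D) * gauss (M ℕ.+ A ℕ.+ D) A
      ≈⟨ *-cong (trans (gauss-complement (A ℕ.+ D) N top) (gauss-top N (≡.sym top)))
                (trans (gauss-complement A (M ℕ.+ D) (lemma₁ M A D)) (gauss-top (M ℕ.+ D) (ℕₚ.+-assoc M A D))) ⟩
    gauss (A ℕ.+ D ℕ.+ N) N * gauss (M ℕ.+ (A ℕ.+ D)) (M ℕ.+ D)
      ≈⟨ linearization M M (A ℕ.+ D) N (M ℕ.+ D) (≡.trans (≡.cong (M ℕ.+_) (≡.sym D+N≡M)) (lemma₂ M D N)) ⟩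
    conv N (λ c f → pow p ((M ∸ c) ℕ.* f) * (gauss (M ℕ.+ (A ℕ.+ D) ℕ.+ c) (M ℕ.+ M) * (gauss M c * gauss M f)))
      ≈⟨ conv-sumRange N _ ⟩
    sumRange (suc N) (λ f → pow p ((M ∸ (N ∸ f)) ℕ.* f) * (gauss (M ℕ.+ (A ℕ.+ D) ℕ.+ (N ∸ f)) (M ℕ.+ M) * (gauss M (N ∸ f) * gauss M f)))
      ≈⟨ sumRange-cong (suc N) (λ { f (s≤s f≤N) → fromN f f≤N }) ⟩
    sumRange (suc N) H
      ≈⟨ sumRange-resize (suc N) (suc A) beyondN beyondA ⟩
    sumRange (suc A) H
      ≈⟨ sumRange-cong (suc A) (λ { f (s≤s f≤A) → fromA f f≤A }) ⟨
    sumRange (suc A) (λ f → pow p (f ℕ.* (f ℕ.+ D)) * (gauss (2 ℕ.* M ℕ.+ (A ∸ f)) (A ∸ f) * (gauss M f * gauss M (f ℕ.+ D))))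
      ≈⟨ conv-sumRange A _ ⟨
    conv A (λ k f → pow p (f ℕ.* (f ℕ.+ D)) * (gauss (2 ℕ.* M ℕ.+ k) k * (gauss M f * gauss M (f ℕ.+ D)))) ∎
    where
    H : ℕ → Carrier
    H f = pow p (f ℕ.* (f ℕ.+ D)) * (gauss (M ℕ.+ M ℕ.+ A ∸ f) (M ℕ.+ M) * (gauss M f * gauss M (f ℕ.+ D)))
    top : A ℕ.+ D ℕ.+ N ≡ M ℕ.+ A
    top = ≡.trans (ℕₚ.+-assoc A D N) (≡.trans (≡.cong (A ℕ.+_) D+N≡M) (ℕₚ.+-comm A M))
    lemma₁ : ∀ M A D → A ℕ.+ (M ℕ.+ D) ≡ M ℕ.+ A ℕ.+ D
    lemma₁ = solve-∀
    lemma₂ : ∀ M D N → M ℕ.+ (D ℕ.+ N) ≡ N ℕ.+ (M ℕ.+ D)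
    lemma₂ = solve-∀

    beyondN : ∀ f → suc N ≤ f → H f ≈ 0#
    beyondN f N<f = trans (*-congˡ (trans (*-congˡ (trans (*-congˡ (gauss-> M<f+D)) (zeroʳ _))) (zeroʳ _))) (zeroʳ _)
      where
      M<f+D : M < f ℕ.+ D
      M<f+D = ≡.subst₂ _<_ D+N≡M (ℕₚ.+-comm D f) (ℕₚ.+-monoʳ-< D N<f)
    beyondA : ∀ f → suc A ≤ f → H f ≈ 0#
    beyondA f A<f with ℕₚ.≤-<-connex f M
    ... | inj₂ M<f = trans (*-congˡ (trans (*-congˡ (trans (*-congʳ (gauss-> M<f)) (zeroˡ _))) (zeroʳ _))) (zeroʳ _)
    ... | inj₁ f≤M = trans (*-congˡ (trans (*-congʳ (gauss-> (ℕₚ.m<n+o⇒m∸n<o (M ℕ.+ M ℕ.+ A) f {{nz}} bound))) (zeroˡ _))) (zeroʳ _)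
      where
      -- Truncated subtraction drops below M + M only if M + M is positive; this follows from M ≥ f
      -- > A.
      nz : ℕ.NonZero (M ℕ.+ M)
      nz = ℕ.>-nonZero (ℕₚ.≤-trans (ℕₚ.≤-trans (s≤s z≤n) A<f) (ℕₚ.≤-trans f≤M (ℕₚ.m≤m+n M M)))
      bound : M ℕ.+ M ℕ.+ A < f ℕ.+ (M ℕ.+ M)
      bound = ≡.subst (M ℕ.+ M ℕ.+ A <_) (ℕₚ.+-comm (M ℕ.+ M) f) (ℕₚ.+-monoʳ-< (M ℕ.+ M) A<f)

    fromN : ∀ f → f ≤ N → pow p ((M ∸ (N ∸ f)) ℕ.* f) * (gauss (M ℕ.+ (A ℕ.+ D) ℕ.+ (N ∸ f)) (M ℕ.+ M) * (gauss M (N ∸ f) * gauss M f)) ≈ H f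
    fromN f f≤N with ℕₚ.m≤n⇒∃[o]m+o≡n f≤N
    ... | e , ≡.refl rewrite ℕₚ.m+n∸m≡n f e = *-cong (pow-≡ p (≡.trans (≡.cong (ℕ._* f) M∸e) (ℕₚ.*-comm (f ℕ.+ D) f)))
            (*-cong (gauss-top (M ℕ.+ M) top′) (trans (*-comm _ _) (*-congˡ (gauss-complement e (f ℕ.+ D) M≡))))
      where
      M≡ : e ℕ.+ (f ℕ.+ D) ≡ M
      M≡ = ≡.trans (lemma e f D) D+N≡M
        where
        lemma : ∀ e f D → e ℕ.+ (f ℕ.+ D) ≡ D ℕ.+ (f ℕ.+ e)
        lemma = solve-∀
      M∸e : M ∸ e ≡ f ℕ.+ D
      M∸e = ≡.trans (≡.cong (_∸ e) (≡.sym M≡)) (ℕₚ.m+n∸m≡n e (f ℕ.+ D))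
      top′ : M ℕ.+ (A ℕ.+ D) ℕ.+ e ≡ M ℕ.+ M ℕ.+ A ∸ f
      top′ = ≡.sym (≡.trans (≡.cong (λ t → M ℕ.+ t ℕ.+ A ∸ f) (≡.sym M≡)) (≡.trans (≡.cong (_∸ f) (lemma M A D e f)) (ℕₚ.m+n∸m≡n f _)))
        where
        lemma : ∀ M A D e f → M ℕ.+ (e ℕ.+ (f ℕ.+ D)) ℕ.+ A ≡ f ℕ.+ (M ℕ.+ (A ℕ.+ D) ℕ.+ e)
        lemma = solve-∀

    fromA : ∀ f → f ≤ A → pow p (f ℕ.* (f ℕ.+ D)) * (gauss (2 ℕ.* M ℕ.+ (A ∸ f)) (A ∸ f) * (gauss M f * gauss M (f ℕ.+ D))) ≈ H f
    fromA f f≤A = *-congˡ (*-congʳ (trans (gauss-complement (A ∸ f) (M ℕ.+ M) (lemma (A ∸ f) M))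
                    (gauss-top (M ℕ.+ M) (≡.trans (≡.cong (ℕ._+ (A ∸ f)) (lemma′ M)) (≡.sym (ℕₚ.+-∸-assoc (M ℕ.+ M) f≤A))))))
      where
      lemma : ∀ d M → d ℕ.+ (M ℕ.+ M) ≡ 2 ℕ.* M ℕ.+ d
      lemma = solve-∀
      lemma′ : ∀ M → 2 ℕ.* M ≡ M ℕ.+ M
      lemma′ = solve-∀

-- The case of no summation variables n_i.

-- e₋ j = 3 j² - 2 j
e₊ e₋ : ℕ → ℕ
e₊ j = 3 ℕ.* j ℕ.* j ℕ.+ 2 ℕ.* j
e₋ zero    = 0
e₋ (suc i) = 3 ℕ.* i ℕ.* i ℕ.+ 4 ℕ.* i ℕ.+ 1

e₊-suc : ∀ k → e₊ (suc k) ≡ e₊ k ℕ.+ (5 ℕ.+ 6 ℕ.* k)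
e₊-suc = lemma
  where
  lemma : ∀ k → 3 ℕ.* suc k ℕ.* suc k ℕ.+ 2 ℕ.* suc k ≡ 3 ℕ.* k ℕ.* k ℕ.+ 2 ℕ.* k ℕ.+ (5 ℕ.+ 6 ℕ.* k)
  lemma = solve-∀

e₋-suc : ∀ k → e₋ (suc k) ≡ e₋ k ℕ.+ (1 ℕ.+ 6 ℕ.* k)
e₋-suc zero    = ≡.refl
e₋-suc (suc k) = lemma k
  where
  lemma : ∀ k → 3 ℕ.* suc k ℕ.* suc k ℕ.+ 4 ℕ.* suc k ℕ.+ 1 ≡ 3 ℕ.* k ℕ.* k ℕ.+ 4 ℕ.* k ℕ.+ 1 ℕ.+ (1 ℕ.+ 6 ℕ.* suc k)
  lemma = solve-∀

-- On the diagonal β = α + j the exponents from the progressions 1 and 5 modulo 6 exceed `e₊ j` by 6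
-- f (f + D) with f = α and D = j, which is the power of p = q⁶ in `saalschütz`.
e₊-diagonal : ∀ α j → e₋ α ℕ.+ e₊ (α ℕ.+ j) ≡ e₊ j ℕ.+ 6 ℕ.* (α ℕ.* (α ℕ.+ j))
e₊-diagonal zero    j = ≡.sym (ℕₚ.+-identityʳ (e₊ j))
e₊-diagonal (suc i) j = lemma i j
  where
  lemma : ∀ i j → 3 ℕ.* i ℕ.* i ℕ.+ 4 ℕ.* i ℕ.+ 1 ℕ.+ (3 ℕ.* (suc i ℕ.+ j) ℕ.* (suc i ℕ.+ j) ℕ.+ 2 ℕ.* (suc i ℕ.+ j))
        ≡ 3 ℕ.* j ℕ.* j ℕ.+ 2 ℕ.* j ℕ.+ 6 ℕ.* (suc i ℕ.* (suc i ℕ.+ j))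
  lemma = solve-∀

-- The same match on the diagonal α = β + j + 1, with f = β and D = j + 1.
e₋-diagonal : ∀ β j → e₋ (suc β ℕ.+ j) ℕ.+ e₊ β ≡ e₋ (suc j) ℕ.+ 6 ℕ.* (β ℕ.* (β ℕ.+ suc j))
e₋-diagonal = lemma
  where
  lemma : ∀ β j → 3 ℕ.* (β ℕ.+ j) ℕ.* (β ℕ.+ j) ℕ.+ 4 ℕ.* (β ℕ.+ j) ℕ.+ 1 ℕ.+ (3 ℕ.* β ℕ.* β ℕ.+ 2 ℕ.* β)
        ≡ 3 ℕ.* j ℕ.* j ℕ.+ 4 ℕ.* j ℕ.+ 1 ℕ.+ 6 ℕ.* (β ℕ.* (β ℕ.+ suc j))
  lemma = solve-∀

module Seed {c ℓ} (R : CommutativeRing c ℓ) (q : CommutativeRing.Carrier R) where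
  open CommutativeRing R hiding (zero)
  open QDefs R using (pow; sumRange)
  open FiniteSums R
  open Powers R
  r : Carrier
  r = pow q 3
  open Transformation R r
  open Gaussian R p
  open Progressions R using (weight-pow; progression; progression-trisection)
  open Saalschütz R p
  open SetoidReasoning setoid
  open import Algebra.Solver.Ring.NaturalCoefficients.Default commutativeSemiring
    using (solve; _:*_; _:=_)

  p≈q⁶ : p ≈ pow q 6
  p≈q⁶ = pow-pow q 3 2

  -- The parts above and strictly below the diagonal are reindexed by their distance from it. They
  -- become the indices j ≥ 0 and j < 0 of the bilateral sum.
  sumRange-diagonal : ∀ B (F : ℕ → ℕ → Carrier) → (∀ i j → B ≤ i ℕ.+ j → F i j ≈ 0#) →
    sumRange B (λ i → sumRange B (F i)) ≈
    sumRange B (λ j → sumRange B (λ i → F i (i ℕ.+ j))) + sumRange B (λ j → sumRange B (λ i → F (suc i ℕ.+ j) i))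
  sumRange-diagonal B F F≈0 = begin
    sumRange B (λ i → sumRange B (F i))
      ≈⟨ sumRange-cong′ B (λ i → trans (sumRange-cong′ B (λ j → parts i j)) (sumRange-+ B (U i) (V i))) ⟩
    sumRange B (λ i → sumRange B (U i) + sumRange B (V i))
      ≈⟨ sumRange-+ B _ _ ⟩
    sumRange B (λ i → sumRange B (U i)) + sumRange B (λ i → sumRange B (V i))
      ≈⟨ +-cong upper (trans (sumRange-comm B B _) lower) ⟩
    sumRange B (λ i → sumRange B (λ j → F i (i ℕ.+ j))) + sumRange B (λ i → sumRange B (λ j → F (suc i ℕ.+ j) i))
      ≈⟨ +-cong (sumRange-comm B B _) (sumRange-comm B B _) ⟩
    sumRange B (λ j → sumRange B (λ i → F i (i ℕ.+ j))) + sumRange B (λ j → sumRange B (λ i → F (suc i ℕ.+ j) i)) ∎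
    where
    U V : ℕ → ℕ → Carrier
    U i j with i ℕₚ.≤? j
    ... | yes _ = F i j
    ... | no _  = 0#
    V i j with i ℕₚ.≤? j
    ... | yes _ = 0#
    ... | no _  = F i j
    parts : ∀ i j → F i j ≈ U i j + V i j
    parts i j with i ℕₚ.≤? j
    ... | yes _ = sym (+-identityʳ _)
    ... | no _  = sym (+-identityˡ _)
    U≤ : ∀ {i j} → i ≤ j → U i j ≈ F i j
    U≤ {i} {j} i≤j with i ℕₚ.≤? j
    ... | yes _  = refl
    ... | no i≰j = contradiction i≤j i≰j
    U> : ∀ {i j} → j < i → U i j ≈ 0#
    U> {i} {j} j<i with i ℕₚ.≤? j
    ... | yes i≤j = contradiction i≤j (ℕₚ.<⇒≱ j<i)
    ... | no _    = refl
    V≤ : ∀ {i j} → i ≤ j → V i j ≈ 0#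
    V≤ {i} {j} i≤j with i ℕₚ.≤? j
    ... | yes _  = refl
    ... | no i≰j = contradiction i≤j i≰j
    V> : ∀ {i j} → j < i → V i j ≈ F i j
    V> {i} {j} j<i with i ℕₚ.≤? j
    ... | yes i≤j = contradiction i≤j (ℕₚ.<⇒≱ j<i)
    ... | no _    = refl
    U-far : ∀ i j → B ≤ i ℕ.+ j → U i j ≈ 0#
    U-far i j B≤ with i ℕₚ.≤? j
    ... | yes _ = F≈0 i j B≤
    ... | no _  = refl
    V-far : ∀ i j → B ≤ i ℕ.+ j → V i j ≈ 0#
    V-far i j B≤ with i ℕₚ.≤? j
    ... | yes _ = refl
    ... | no _  = F≈0 i j B≤
    upper : sumRange B (λ i → sumRange B (U i)) ≈ sumRange B (λ i → sumRange B (λ j → F i (i ℕ.+ j)))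
    upper = sumRange-cong′ B (λ i → trans
      (sumRange-shift B i (λ j j<i → U> j<i) (λ j B≤j → U-far i j (ℕₚ.≤-trans B≤j (ℕₚ.m≤n+m j i))))
      (sumRange-cong′ B (λ j → U≤ (ℕₚ.m≤m+n i j))))
    lower : sumRange B (λ j → sumRange B (λ i → V i j)) ≈ sumRange B (λ j → sumRange B (λ i → F (suc j ℕ.+ i) j))
    lower = sumRange-cong′ B (λ j → trans
      (sumRange-shift B (suc j) (λ { i (s≤s i≤j) → V≤ i≤j }) (λ i B≤i → V-far i j (ℕₚ.≤-trans B≤i (ℕₚ.m≤m+n i j))))
      (sumRange-cong′ B (λ i → V> (s≤s (ℕₚ.m≤m+n j i)))))

  seedTerm : (L M m k : ℕ) → Carrier
  seedTerm L M m k = guard (m ℕ.+ 2 ℕ.* k) L (pow q (m ℕ.* m) * (QDefs.gauss R (pow q 2) (3 ℕ.* M) m * gauss (2 ℕ.* M ℕ.+ k) k))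

  module _ (B L M : ℕ) (L<B : L < B) where
    private
      Σ : (ℕ → Carrier) → Carrier
      Σ = sumRange B

      Σ-cong : ∀ {f g : ℕ → Carrier} → (∀ i → f i ≈ g i) → Σ f ≈ Σ g
      Σ-cong = sumRange-cong′ B

      Σ-comm : ∀ (f : ℕ → ℕ → Carrier) → Σ (λ i → Σ (f i)) ≈ Σ (λ j → Σ (λ i → f i j))
      Σ-comm = sumRange-comm B B

      ¬weight : ∀ {x} → B ≤ x → x ≢ L
      ¬weight B≤x ≡.refl = ℕₚ.<⇒≱ L<B B≤x

      term : (n k α β : ℕ) → Carrier
      term n k α β = guard (n ℕ.+ 2 ℕ.* k ℕ.+ (α ℕ.+ β)) L
        (gauss (2 ℕ.* M ℕ.+ k) k * (pow q (e₊ β) * gauss M β * (pow r (n ℕ.* n) * gauss M n * (pow q (e₋ α) * gauss M α))))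

      pow-p : ∀ k → pow p k ≈ pow q (6 ℕ.* k)
      pow-p k = trans (pow-cong k p≈q⁶) (pow-pow q 6 k)

      -- The part |α - β| = D of the double sum over α and β, for either sign of α - β.
      diagonal : ∀ D e (α β : ℕ → ℕ) → (∀ f → α f ℕ.+ β f ≡ f ℕ.+ (f ℕ.+ D)) →
        (∀ f → gauss M (α f) * gauss M (β f) ≈ gauss M f * gauss M (f ℕ.+ D)) →
        (∀ f → e₋ (α f) ℕ.+ e₊ (β f) ≡ e ℕ.+ 6 ℕ.* (f ℕ.* (f ℕ.+ D))) →
        pow q e * trinomial B L M 0 D ≈ Σ (λ f → Σ (λ n → Σ (λ k → term n k (α f) (β f))))
      diagonal D e α β sum≡ prod≈ exp≡ = begin
        pow q e * trinomial B L M 0 D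
          ≈⟨ trans (sumRange-*ˡ B _ _) (Σ-cong (λ n → trans (sumRange-*ˡ B _ _) (Σ-cong (λ s → expand n s)))) ⟩
        Σ (λ n → Σ (λ s → conv s (λ k f → term n k (α f) (β f))))
          ≈⟨ Σ-cong (λ n → sumRange-conv B _ (λ k f B≤k+f → guard-no (¬weight (ℕₚ.≤-trans B≤k+f (far n k f))))) ⟩
        Σ (λ n → Σ (λ k → Σ (λ f → term n k (α f) (β f))))
          ≈⟨ trans (Σ-cong (λ n → Σ-comm _)) (Σ-comm _) ⟩
        Σ (λ f → Σ (λ n → Σ (λ k → term n k (α f) (β f)))) ∎
        where
        far : ∀ n k f → k ℕ.+ f ≤ n ℕ.+ 2 ℕ.* k ℕ.+ (α f ℕ.+ β f)
        far n k f rewrite sum≡ f = ≡.subst (k ℕ.+ f ≤_) (lemma n k f D) (ℕₚ.m≤m+n (k ℕ.+ f) (n ℕ.+ k ℕ.+ (f ℕ.+ D)))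
          where
          lemma : ∀ n k f D → k ℕ.+ f ℕ.+ (n ℕ.+ k ℕ.+ (f ℕ.+ D)) ≡ n ℕ.+ 2 ℕ.* k ℕ.+ (f ℕ.+ (f ℕ.+ D))
          lemma = solve-∀
        expand : ∀ n s → pow q e * guard (n ℕ.+ 2 ℕ.* s ℕ.+ 0 ℕ.+ D) L
            (pow r (n ℕ.* n) * (gauss M n * (gauss (M ℕ.+ D ℕ.+ s) s * gauss (M ℕ.+ 0 ℕ.+ s) (0 ℕ.+ D ℕ.+ s))))
          ≈ conv s (λ k f → term n k (α f) (β f))
        expand n s = begin
          pow q e * guard w L (pow r (n ℕ.* n) * (gauss M n * (gauss (M ℕ.+ D ℕ.+ s) s * gauss (M ℕ.+ 0 ℕ.+ s) (0 ℕ.+ D ℕ.+ s))))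
            ≈⟨ guard-*ˡ w L _ _ ⟩
          guard w L (pow q e * (pow r (n ℕ.* n) * (gauss M n * (gauss (M ℕ.+ D ℕ.+ s) s * gauss (M ℕ.+ 0 ℕ.+ s) (0 ℕ.+ D ℕ.+ s)))))
            -- For a = 0 and b = D the last two Gaussians of the trinomial are, up to reordering
            -- sums, the left-hand side of `saalschütz` at A = s.
            ≈⟨ guard-cong (λ _ → *-congˡ (*-congˡ (*-congˡ (trans (*-cong (gauss-top s (lemma M D s)) (gauss-≡ (≡.cong (ℕ._+ s) (ℕₚ.+-identityʳ M)) (ℕₚ.+-comm D s))) (saalschütz M s D))))) ⟩
          guard w L (pow q e * (pow r (n ℕ.* n) * (gauss M n * conv s C)))
            ≈⟨ guard-cong (λ _ → trans (*-congˡ (trans (*-congˡ (conv-*ˡ s _ C)) (conv-*ˡ s _ _))) (conv-*ˡ s _ _)) ⟩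
          guard w L (conv s (λ k f → pow q e * (pow r (n ℕ.* n) * (gauss M n * C k f))))
            ≈⟨ guard-conv w L s _ ⟩
          conv s (λ k f → guard w L (pow q e * (pow r (n ℕ.* n) * (gauss M n * C k f))))
            ≈⟨ conv-cong s (λ k f k+f≡s → trans (guard-iff (≡.trans (≡.sym (weights k f k+f≡s))) (≡.trans (weights k f k+f≡s))) (guard-cong (λ _ → same k f))) ⟩
          conv s (λ k f → term n k (α f) (β f)) ∎
          where
          w = n ℕ.+ 2 ℕ.* s ℕ.+ 0 ℕ.+ D
          C : ℕ → ℕ → Carrier
          C k f = pow p (f ℕ.* (f ℕ.+ D)) * (gauss (2 ℕ.* M ℕ.+ k) k * (gauss M f * gauss M (f ℕ.+ D)))
          lemma : ∀ M D s → M ℕ.+ D ℕ.+ s ≡ M ℕ.+ s ℕ.+ D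
          lemma = solve-∀
          weights : ∀ k f → k ℕ.+ f ≡ s → w ≡ n ℕ.+ 2 ℕ.* k ℕ.+ (α f ℕ.+ β f)
          weights k f ≡.refl rewrite sum≡ f = lemma′ n k f D
            where
            lemma′ : ∀ n k f D → n ℕ.+ 2 ℕ.* (k ℕ.+ f) ℕ.+ 0 ℕ.+ D ≡ n ℕ.+ 2 ℕ.* k ℕ.+ (f ℕ.+ (f ℕ.+ D))
            lemma′ = solve-∀
          same : ∀ k f → pow q e * (pow r (n ℕ.* n) * (gauss M n * C k f))
            ≈ gauss (2 ℕ.* M ℕ.+ k) k * (pow q (e₊ (β f)) * gauss M (β f) * (pow r (n ℕ.* n) * gauss M n * (pow q (e₋ (α f)) * gauss M (α f))))
          same k f = begin
            pow q e * (pow r (n ℕ.* n) * (gauss M n * C k f))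
              ≈⟨ solve 7 (λ a b c d g x y → a :* (b :* (c :* (d :* (g :* (x :* y))))) := b :* c :* g :* ((a :* d) :* (x :* y))) refl _ _ _ _ _ _ _ ⟩
            pow r (n ℕ.* n) * gauss M n * gauss (2 ℕ.* M ℕ.+ k) k * ((pow q e * pow p (f ℕ.* (f ℕ.+ D))) * (gauss M f * gauss M (f ℕ.+ D)))
              ≈⟨ *-congˡ (*-cong (trans (*-congˡ (pow-p (f ℕ.* (f ℕ.+ D)))) (trans (sym (pow-+ q e _)) (trans (pow-≡ q (≡.sym (exp≡ f))) (pow-+ q (e₋ (α f)) _)))) (sym (prod≈ f))) ⟩
            pow r (n ℕ.* n) * gauss M n * gauss (2 ℕ.* M ℕ.+ k) k * ((pow q (e₋ (α f)) * pow q (e₊ (β f))) * (gauss M (α f) * gauss M (β f)))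
              ≈⟨ solve 7 (λ b c g u v x y → b :* c :* g :* ((u :* v) :* (x :* y)) := g :* (v :* y :* (b :* c :* (u :* x)))) refl _ _ _ _ _ _ _ ⟩
            gauss (2 ℕ.* M ℕ.+ k) k * (pow q (e₊ (β f)) * gauss M (β f) * (pow r (n ℕ.* n) * gauss M n * (pow q (e₋ (α f)) * gauss M (α f)))) ∎

      -- Both sides are the coefficient of z^m in (1 + z q)(1 + z q³) ⋯ (1 + z q^(6M-1)); β, n and α
      -- count the factors taken with exponents 5, 3 and 1 modulo 6.
      square : ∀ m → pow q (m ℕ.* m) * QDefs.gauss R (pow q 2) (3 ℕ.* M) m ≈
        conv m (λ β ρ → conv ρ (λ n α → pow q (e₊ β) * gauss M β * (pow r (n ℕ.* n) * gauss M n * (pow q (e₋ α) * gauss M α))))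
      square m = begin
        pow q (m ℕ.* m) * QDefs.gauss R (pow q 2) (3 ℕ.* M) m
          ≈⟨ *-congʳ (weight-pow q 1 2 (λ k → k ℕ.* k) ≡.refl squares (sym (*-identityʳ q)) refl m) ⟨
        progression q (pow q 2) (3 ℕ.* M) m
          ≈⟨ progression-trisection q M m ⟩
        conv m (λ β ρ → progression (pow q 5) (pow q 6) M β * conv ρ (λ n α → progression r (pow q 6) M n * progression q (pow q 6) M α))
          ≈⟨ conv-cong m (λ β ρ _ → *-cong (*-cong (weight-pow q 5 6 e₊ ≡.refl e₊-suc refl refl β) (gauss-p β))
               (conv-cong ρ (λ n α _ → *-cong (*-cong (trans (weight-pow q 3 6 (λ k → 3 ℕ.* (k ℕ.* k)) ≡.refl triple refl refl n) (sym (pow-pow q 3 (n ℕ.* n)))) (gauss-p n))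
                 (*-cong (weight-pow q 1 6 e₋ ≡.refl e₋-suc (sym (*-identityʳ q)) refl α) (gauss-p α))))) ⟩
        conv m (λ β ρ → pow q (e₊ β) * gauss M β * conv ρ (λ n α → pow r (n ℕ.* n) * gauss M n * (pow q (e₋ α) * gauss M α)))
          ≈⟨ conv-cong m (λ β ρ _ → conv-*ˡ ρ _ _) ⟩
        conv m (λ β ρ → conv ρ (λ n α → pow q (e₊ β) * gauss M β * (pow r (n ℕ.* n) * gauss M n * (pow q (e₋ α) * gauss M α)))) ∎
        where
        gauss-p : ∀ k → QDefs.gauss R (pow q 6) M k ≈ gauss M k
        gauss-p = gauss-cong (sym p≈q⁶) M
        squares : ∀ k → suc k ℕ.* suc k ≡ k ℕ.* k ℕ.+ (1 ℕ.+ 2 ℕ.* k)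
        squares = solve-∀
        triple : ∀ k → 3 ℕ.* (suc k ℕ.* suc k) ≡ 3 ℕ.* (k ℕ.* k) ℕ.+ (3 ℕ.+ 6 ℕ.* k)
        triple = solve-∀

      seedTerm-conv : ∀ m k → seedTerm L M m k ≈ conv m (λ β ρ → conv ρ (λ n α → term n k α β))
      seedTerm-conv m k = begin
        guard (m ℕ.+ 2 ℕ.* k) L (pow q (m ℕ.* m) * (QDefs.gauss R (pow q 2) (3 ℕ.* M) m * gauss (2 ℕ.* M ℕ.+ k) k))
          ≈⟨ guard-cong (λ _ → trans (sym (*-assoc _ _ _)) (trans (*-comm _ _) (trans (*-congˡ (square m))
               (trans (conv-*ˡ m _ _) (conv-cong m (λ β ρ _ → conv-*ˡ ρ _ _)))))) ⟩
        guard (m ℕ.+ 2 ℕ.* k) L (conv m (λ β ρ → conv ρ (λ n α → summand n k α β)))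
          ≈⟨ trans (guard-conv _ L m _) (conv-cong m (λ β ρ _ → guard-conv _ L ρ _)) ⟩
        conv m (λ β ρ → conv ρ (λ n α → guard (m ℕ.+ 2 ℕ.* k) L (summand n k α β)))
          ≈⟨ conv-cong m (λ { β ρ ≡.refl → conv-cong ρ (λ { n α ≡.refl → guard-iff (≡.trans (≡.sym (lemma β n α k))) (≡.trans (lemma β n α k)) }) }) ⟩
        conv m (λ β ρ → conv ρ (λ n α → term n k α β)) ∎
        where
        summand : (n k α β : ℕ) → Carrier
        summand n k α β = gauss (2 ℕ.* M ℕ.+ k) k * (pow q (e₊ β) * gauss M β * (pow r (n ℕ.* n) * gauss M n * (pow q (e₋ α) * gauss M α)))
        lemma : ∀ β n α k → β ℕ.+ (n ℕ.+ α) ℕ.+ 2 ℕ.* k ≡ n ℕ.+ 2 ℕ.* k ℕ.+ (α ℕ.+ β)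
        lemma = solve-∀

    -- One fourfold sum of `term` is read in two ways: grouped by the difference of α and β it gives
    -- the trinomials, and grouped by m = α + β + n it gives the single Gaussian [3M; m].
    seed : Σ (λ j → pow q (e₊ j) * trinomial B L M 0 j) + Σ (λ j → pow q (e₋ (suc j)) * trinomial B L M 0 (suc j))
         ≈ Σ (λ m → Σ (λ k → seedTerm L M m k))
    seed = begin
      Σ (λ j → pow q (e₊ j) * trinomial B L M 0 j) + Σ (λ j → pow q (e₋ (suc j)) * trinomial B L M 0 (suc j))
        ≈⟨ +-cong (Σ-cong (λ j → diagonal j (e₊ j) (λ f → f) (λ f → f ℕ.+ j) (λ _ → ≡.refl) (λ _ → refl) (λ f → e₊-diagonal f j)))
                  (Σ-cong (λ j → diagonal (suc j) (e₋ (suc j)) (λ f → suc f ℕ.+ j) (λ f → f) (λ f → lemma f j)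
                    (λ f → trans (*-comm _ _) (*-congˡ (gauss-≡ {M} ≡.refl (≡.sym (ℕₚ.+-suc f j))))) (λ f → e₋-diagonal f j))) ⟩
      Σ (λ j → Σ (λ f → inner f (f ℕ.+ j))) + Σ (λ j → Σ (λ f → inner (suc f ℕ.+ j) f))
        ≈⟨ sumRange-diagonal B inner (λ α β B≤ → sumRange-zero B (λ n _ → sumRange-zero B (λ k _ → guard-no (¬weight (ℕₚ.≤-trans B≤ (ℕₚ.m≤n+m _ (n ℕ.+ 2 ℕ.* k))))))) ⟨
      Σ (λ α → Σ (λ β → Σ (λ n → Σ (λ k → term n k α β))))
        ≈⟨ trans (Σ-comm _) (Σ-cong (λ β → Σ-comm _)) ⟩
      Σ (λ β → Σ (λ n → Σ (λ α → Σ (λ k → term n k α β))))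
        ≈⟨ Σ-cong (λ β → sumRange-conv B _ (λ n α B≤ → sumRange-zero B (λ k _ → guard-no (¬weight (ℕₚ.≤-trans B≤ (far n k α β)))))) ⟨
      Σ (λ β → Σ (λ ρ → conv ρ (λ n α → Σ (λ k → term n k α β))))
        ≈⟨ sumRange-conv B _ (λ β ρ B≤ → conv-zero ρ (λ { n α ≡.refl → sumRange-zero B (λ k _ → guard-no (¬weight (ℕₚ.≤-trans B≤ (far′ n k α β)))) })) ⟨
      Σ (λ m → conv m (λ β ρ → conv ρ (λ n α → Σ (λ k → term n k α β))))
        ≈⟨ Σ-cong (λ m → trans (sumRange-conv-comm B m _) (conv-cong m (λ β ρ _ → sumRange-conv-comm B ρ _))) ⟨
      Σ (λ m → Σ (λ k → conv m (λ β ρ → conv ρ (λ n α → term n k α β))))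
        ≈⟨ Σ-cong (λ m → Σ-cong (λ k → seedTerm-conv m k)) ⟨
      Σ (λ m → Σ (λ k → seedTerm L M m k)) ∎
      where
      inner : ℕ → ℕ → Carrier
      inner α β = Σ (λ n → Σ (λ k → term n k α β))
      lemma : ∀ f j → suc f ℕ.+ j ℕ.+ f ≡ f ℕ.+ (f ℕ.+ suc j)
      lemma = solve-∀
      far : ∀ n k α β → n ℕ.+ α ≤ n ℕ.+ 2 ℕ.* k ℕ.+ (α ℕ.+ β)
      far n k α β = ℕₚ.+-mono-≤ (ℕₚ.m≤m+n n _) (ℕₚ.m≤m+n α β)
      far′ : ∀ n k α β → β ℕ.+ (n ℕ.+ α) ≤ n ℕ.+ 2 ℕ.* k ℕ.+ (α ℕ.+ β)
      far′ n k α β = ≡.subst (_≤ n ℕ.+ 2 ℕ.* k ℕ.+ (α ℕ.+ β)) (lemma′ n α β) (ℕₚ.+-monoˡ-≤ (α ℕ.+ β) (ℕₚ.m≤m+n n (2 ℕ.* k)))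
        where
        lemma′ : ∀ n α β → n ℕ.+ (α ℕ.+ β) ≡ β ℕ.+ (n ℕ.+ α)
        lemma′ = solve-∀

-- Parity and halving of integers.

⌊n+n/2⌋*2 : ∀ n → ⌊ n ℕ.+ n /2⌋ ℕ.* 2 ≡ n ℕ.+ n
⌊n+n/2⌋*2 n = ≡.trans (≡.cong (ℕ._* 2) (≡.sym (ℕₚ.n≡⌊n+n/2⌋ n))) (lemma n)
  where
  lemma : ∀ n → n ℕ.* 2 ≡ n ℕ.+ n
  lemma = solve-∀

T⇒true : ∀ {b} → T b → b ≡ true
T⇒true {true} _ = ≡.refl

isEven-double : ∀ k → isEven (k ℤ.+ k) ≡ true
isEven-double (+ n)    = T⇒true (ℕₚ.≡⇒≡ᵇ _ _ (⌊n+n/2⌋*2 n))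
isEven-double -[1+ n ] = T⇒true (ℕₚ.≡⇒≡ᵇ _ _ (⌊n+n/2⌋*2 n))

half-double : ∀ k → half (k ℤ.+ k) ≡ k
half-double (+ n)    = ≡.cong +_ (≡.sym (ℕₚ.n≡⌊n+n/2⌋ n))
half-double -[1+ n ] = ≡.cong -[1+_] (≡.sym (ℕₚ.n≡⌊n+n/2⌋ n))

isEven⇒double : ∀ z → isEven z ≡ true → ∃ λ k → z ≡ k ℤ.+ k
isEven⇒double z even with ℕₚ.≡ᵇ⇒≡ (⌊ ℤ.∣ z ∣ /2⌋ ℕ.* 2) ℤ.∣ z ∣ (≡.subst T (≡.sym even) _)
isEven⇒double (+ n)    even | eq = + ⌊ n /2⌋ , ≡.cong +_ (≡.trans (≡.sym eq) (lemma ⌊ n /2⌋))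
  where
  lemma : ∀ n → n ℕ.* 2 ≡ n ℕ.+ n
  lemma = solve-∀
isEven⇒double -[1+ n ] even | eq = ℤ.- (+ ⌊ suc n /2⌋) ,
  ≡.trans (≡.cong (λ m → ℤ.- (+ m)) (≡.trans (≡.sym eq) (lemma ⌊ suc n /2⌋))) (ℤₚ.neg-distrib-+ (+ ⌊ suc n /2⌋) (+ ⌊ suc n /2⌋))
  where
  lemma : ∀ n → n ℕ.* 2 ≡ n ℕ.+ n
  lemma = solve-∀

isEven-shift : ∀ z w → isEven (z ℤ.+ (w ℤ.+ w)) ≡ isEven z
isEven-shift z w with isEven z in even
... | true with isEven⇒double z even
...   | k , ≡.refl = ≡.trans (≡.cong isEven (lemma k w)) (isEven-double (k ℤ.+ w))
  where
  lemma : ∀ k w → k ℤ.+ k ℤ.+ (w ℤ.+ w) ≡ k ℤ.+ w ℤ.+ (k ℤ.+ w)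
  lemma = ℤ-RingSolver.solve-∀
isEven-shift z w | false with isEven (z ℤ.+ (w ℤ.+ w)) in even′
...   | false = ≡.refl
...   | true with isEven⇒double (z ℤ.+ (w ℤ.+ w)) even′
...     | k , eq = ≡.trans (≡.sym (isEven-double (k ℤ.- w))) (≡.trans (≡.cong isEven (≡.trans (lemma k w) (≡.trans (≡.cong (ℤ._- (w ℤ.+ w)) (≡.sym eq)) (lemma′ z w)))) even)
  where
  lemma : ∀ k w → k ℤ.- w ℤ.+ (k ℤ.- w) ≡ k ℤ.+ k ℤ.- (w ℤ.+ w)
  lemma = ℤ-RingSolver.solve-∀
  lemma′ : ∀ z w → z ℤ.+ (w ℤ.+ w) ℤ.- (w ℤ.+ w) ≡ z
  lemma′ = ℤ-RingSolver.solve-∀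

-- Evenness matters because `half` rounds towards zero: half (-1 + 2) is 0, whereas half (-1) + 1 is
-- 1.
half-shift : ∀ z w → isEven z ≡ true → half (z ℤ.+ (w ℤ.+ w)) ≡ half z ℤ.+ w
half-shift z w even with isEven⇒double z even
... | k , ≡.refl = ≡.trans (≡.cong half (lemma k w)) (≡.trans (half-double (k ℤ.+ w)) (≡.cong (ℤ._+ w) (≡.sym (half-double k))))
  where
  lemma : ∀ k w → k ℤ.+ k ℤ.+ (w ℤ.+ w) ≡ k ℤ.+ w ℤ.+ (k ℤ.+ w)
  lemma = ℤ-RingSolver.solve-∀

-- From parity tests and integer brackets to guarded sums.

module EvenSums {c ℓ} (R : CommutativeRing c ℓ) where
  open CommutativeRing R hiding (zero)
  open QDefs R using (sumRange; bracket)
  open FiniteSums R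
  open SetoidReasoning setoid

  sumRange-single : ∀ B s {f : ℕ → Carrier} → s < B → (∀ i → i ≢ s → f i ≈ 0#) → sumRange B f ≈ f s
  sumRange-single B s {f} s<B f≈0 = begin
    sumRange B f                                        ≈⟨ sumRange-extend {suc s} s<B′ (λ i s<i → f≈0 i (ℕₚ.>⇒≢ s<i)) ⟨
    sumRange s f + f s                                  ≈⟨ +-congʳ (sumRange-zero s (λ i i<s → f≈0 i (ℕₚ.<⇒≢ i<s))) ⟩
    0# + f s                                            ≈⟨ +-identityˡ _ ⟩
    f s                                                 ∎
    where
    s<B′ : suc s ≤ B
    s<B′ = s<B

  -- The bridge from the parity test to `guard`. For odd z no s satisfies Y + 2 s = X, for even z ≥
  -- 0 exactly one does, and for even z < 0 the term itself has to vanish.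
  even-sum : ∀ B X Y z (t : Carrier) (f : ℕ → Carrier) → X < B → z ≡ + X ℤ.- + Y →
    (∀ s → Y ℕ.+ 2 ℕ.* s ≡ X → isEven z ≡ true → half z ≡ + s → t ≈ f s) →
    (∀ s → isEven z ≡ true → half z ≡ -[1+ s ] → t ≈ 0#) →
    (if isEven z then t else 0#) ≈ sumRange B (λ s → guard (Y ℕ.+ 2 ℕ.* s) X (f s))
  even-sum B X Y z t f X<B z≡ pos neg with isEven z in even
  ... | false = sym (sumRange-zero B (λ s _ → guard-no (λ eq → contradiction (≡.trans (≡.sym even) (≡.trans (≡.cong isEven (z≡double s eq)) (isEven-double (+ s)))) λ ())))
    where
    z≡double : ∀ s → Y ℕ.+ 2 ℕ.* s ≡ X → z ≡ + s ℤ.+ + s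
    z≡double s ≡.refl = ≡.trans z≡ (≡.trans (≡.cong (ℤ._- + Y) (≡.trans (ℤₚ.pos-+ Y (2 ℕ.* s)) (≡.cong (ℤ._+_ (+ Y)) (≡.trans (≡.cong +_ (lemma s)) (ℤₚ.pos-+ s s))))) (lemma′ (+ Y) (+ s)))
      where
      lemma : ∀ s → 2 ℕ.* s ≡ s ℕ.+ s
      lemma = solve-∀
      lemma′ : ∀ y s → y ℤ.+ (s ℤ.+ s) ℤ.- y ≡ s ℤ.+ s
      lemma′ = ℤ-RingSolver.solve-∀
  ... | true with isEven⇒double z even
  ...   | + s , z≡k+k = trans (pos s Y+2s≡X ≡.refl half≡) (sym (trans (sumRange-single B s s<B other) (guard-yes Y+2s≡X)))
    where
    half≡ : half z ≡ + s
    half≡ = ≡.trans (≡.cong half z≡k+k) (half-double (+ s))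
    Y+2s≡X : Y ℕ.+ 2 ℕ.* s ≡ X
    Y+2s≡X = ℤₚ.+-injective (≡.trans (ℤₚ.pos-+ Y (2 ℕ.* s)) (≡.trans (≡.cong (ℤ._+_ (+ Y)) (≡.trans (≡.cong +_ (lemma s)) (≡.trans (≡.sym z≡k+k) z≡))) (lemma′ (+ X) (+ Y))))
      where
      lemma : ∀ s → 2 ℕ.* s ≡ s ℕ.+ s
      lemma = solve-∀
      lemma′ : ∀ x y → y ℤ.+ (x ℤ.- y) ≡ x
      lemma′ = ℤ-RingSolver.solve-∀
    s<B : s < B
    s<B = ℕₚ.≤-<-trans (ℕₚ.≤-trans (ℕₚ.≤-trans (ℕₚ.m≤n*m s 2) (ℕₚ.m≤n+m (2 ℕ.* s) Y)) (ℕₚ.≤-reflexive Y+2s≡X)) X<B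
    other : ∀ i → i ≢ s → guard (Y ℕ.+ 2 ℕ.* i) X (f i) ≈ 0#
    other i i≢s = guard-no (λ eq → i≢s (ℕₚ.*-cancelˡ-≡ i s 2 (ℕₚ.+-cancelˡ-≡ Y _ _ (≡.trans eq (≡.sym Y+2s≡X)))))
  ...   | -[1+ s ] , z≡k+k = trans (neg s ≡.refl (≡.trans (≡.cong half z≡k+k) (half-double -[1+ s ])))
            (sym (sumRange-zero B (λ i _ → guard-no (λ eq → contradiction (≡.trans (≡.sym (nonneg i eq)) z≡k+k) λ ()))))
    where
    nonneg : ∀ i → Y ℕ.+ 2 ℕ.* i ≡ X → z ≡ + (2 ℕ.* i)
    nonneg i ≡.refl = ≡.trans z≡ (≡.trans (≡.cong (ℤ._- + Y) (ℤₚ.pos-+ Y (2 ℕ.* i))) (lemma (+ Y) (+ (2 ℕ.* i))))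
      where
      lemma : ∀ y s → y ℤ.+ s ℤ.- y ≡ s
      lemma = ℤ-RingSolver.solve-∀

  module _ (P : Carrier) where
    open Gaussian R P using (gauss; gauss->)

    bracket-gauss : ∀ n k → bracket P (+ n) (+ k) ≈ gauss n k
    bracket-gauss n k with k ℕ.≤ᵇ n in k≤n
    ... | true  = refl
    ... | false = sym (gauss-> {n} {k} (ℕₚ.≰⇒> (λ le → contradiction (≡.trans (≡.sym k≤n) (T⇒true (ℕₚ.≤⇒≤ᵇ le))) λ ())))

    bracket-≡ : ∀ {x y n k} → x ≡ + n → y ≡ + k → bracket P x y ≈ gauss n k
    bracket-≡ {n = n} {k} ≡.refl ≡.refl = bracket-gauss n k

    bracket-negˡ : ∀ n y → bracket P -[1+ n ] y ≈ 0#
    bracket-negˡ n (+ k)    = refl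
    bracket-negˡ n -[1+ k ] = refl

    bracket-negʳ : ∀ x k → bracket P x -[1+ k ] ≈ 0#
    bracket-negʳ (+ n)    k = refl
    bracket-negʳ -[1+ n ] k = refl

    -- The upper index is either a natural number below m or negative, where `bracket` is 0 by
    -- convention. This disposes of even differences with a negative half.
    bracket-deficit : ∀ m s → bracket P (+ m ℤ.+ -[1+ s ]) (+ m) ≈ 0#
    bracket-deficit m s with ℕₚ.≤-<-connex (suc s) m
    ... | inj₁ s<m = trans (reflexive (≡.cong (λ x → bracket P x (+ m)) (ℤₚ.⊖-≥ s<m)))
            (trans (bracket-gauss (m ∸ suc s) m) (gauss-> (ℕₚ.∸-monoʳ-< (s≤s z≤n) s<m)))
    ... | inj₂ m≤s = trans (reflexive (≡.cong (λ x → bracket P x (+ m)) (≡.trans (ℤₚ.⊖-< m≤s) (≡.cong (λ x → ℤ.- (+ x)) (ℕₚ.+-∸-assoc 1 (ℕₚ.≤-pred m≤s))))))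
            (bracket-negˡ (s ∸ m) (+ m))

-- The defined trinomials in guarded form.

module Trinomials {c ℓ} (R : CommutativeRing c ℓ) (r : CommutativeRing.Carrier R) where
  open CommutativeRing R hiding (zero)
  open QDefs R using (pow; bracket; trinomialSq)
  open FiniteSums R
  open EvenSums R
  open Transformation R r
  open Gaussian R p
  open SetoidReasoning setoid
  open import Algebra.Solver.Ring.NaturalCoefficients.Default commutativeSemiring
    using (solve; _:*_; _:=_)

  -- The sign change exchanges the last two brackets, and the parity test is stable because L + a -
  -- n and L - a - n differ by 2 a.
  trinomialSq-neg : ∀ L M a b → trinomialSq r L M (ℤ.- a) (ℤ.- b) ≈ trinomialSq r L M a b
  trinomialSq-neg L M a b = sumRange-cong′ (suc M) same
    where
    z z′ : ℕ → ℤ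
    z  n = + L ℤ.- a ℤ.- + n
    z′ n = + L ℤ.- ℤ.- a ℤ.- + n
    lemma : ∀ L a n → L ℤ.- ℤ.- a ℤ.- n ≡ L ℤ.- a ℤ.- n ℤ.+ (a ℤ.+ a)
    lemma = ℤ-RingSolver.solve-∀
    same : ∀ n →
      (if isEven (z′ n) then pow r (n ℕ.* n) * bracket p (+ M) (+ n)
        * bracket p (+ M ℤ.+ ℤ.- b ℤ.+ half (z′ n)) (+ M ℤ.+ ℤ.- b)
        * bracket p (+ M ℤ.- ℤ.- b ℤ.+ half (+ L ℤ.+ ℤ.- a ℤ.- + n)) (+ M ℤ.- ℤ.- b) else 0#) ≈
      (if isEven (z n) then pow r (n ℕ.* n) * bracket p (+ M) (+ n)
        * bracket p (+ M ℤ.+ b ℤ.+ half (z n)) (+ M ℤ.+ b)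
        * bracket p (+ M ℤ.- b ℤ.+ half (+ L ℤ.+ a ℤ.- + n)) (+ M ℤ.- b) else 0#)
    same n rewrite ≡.trans (≡.cong isEven (lemma (+ L) a (+ n))) (isEven-shift (z n) a)
                 | ℤₚ.neg-involutive a | ℤₚ.neg-involutive b with isEven (z n)
    ... | true  = solve 4 (λ x y u v → x :* y :* u :* v := x :* y :* v :* u) refl _ _ _ _
    ... | false = refl

  -- With s = (L - a - b - n)/2 the other half is s + a + b. Lower indices are complemented, so M -
  -- b disappears; n ≤ M may be replaced by n < B since [M; n] and the weight kill the excess on
  -- either side.
  trinomialSq≈trinomial : ∀ B L M a b → L < B → trinomialSq r L M (+ (a ℕ.+ b)) (+ b) ≈ trinomial B L M a b
  trinomialSq≈trinomial B L M a b L<B = trans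
    (sumRange-cong′ (suc M) (λ n → trans
      (even-sum B L (a ℕ.+ b ℕ.+ n) (z n) (t n) (f n) L<B (z≡ n) (pos n) (neg n))
      (sumRange-cong′ B (λ s → guard-iff (≡.trans (lemma n s a b)) (≡.trans (≡.sym (lemma n s a b)))))))
    (sumRange-resize (suc M) B
      (λ n M<n → sumRange-zero B (λ s _ → guard-zero (λ _ → trans (*-congˡ (trans (*-congʳ (gauss-> M<n)) (zeroˡ _))) (zeroʳ _))))
      (λ n B≤n → sumRange-zero B (λ s _ → guard-no (ℕₚ.>⇒≢ (ℕₚ.<-≤-trans (ℕₚ.<-≤-trans L<B B≤n)
        (ℕₚ.≤-trans (ℕₚ.m≤m+n n (2 ℕ.* s ℕ.+ a ℕ.+ b)) (ℕₚ.≤-reflexive (lemma′ n s a b))))))))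
    where
    lemma : ∀ n s a b → n ℕ.+ 2 ℕ.* s ℕ.+ a ℕ.+ b ≡ a ℕ.+ b ℕ.+ n ℕ.+ 2 ℕ.* s
    lemma = solve-∀
    lemma′ : ∀ n s a b → n ℕ.+ (2 ℕ.* s ℕ.+ a ℕ.+ b) ≡ n ℕ.+ 2 ℕ.* s ℕ.+ a ℕ.+ b
    lemma′ = solve-∀
    z : ℕ → ℤ
    z n = + L ℤ.- + (a ℕ.+ b) ℤ.- + n
    t : ℕ → Carrier
    t n = pow r (n ℕ.* n) * bracket p (+ M) (+ n) * bracket p (+ M ℤ.+ + b ℤ.+ half (z n)) (+ M ℤ.+ + b)
      * bracket p (+ M ℤ.- + b ℤ.+ half (+ L ℤ.+ + (a ℕ.+ b) ℤ.- + n)) (+ M ℤ.- + b)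
    f : ℕ → ℕ → Carrier
    f n s = pow r (n ℕ.* n) * (gauss M n * (gauss (M ℕ.+ b ℕ.+ s) s * gauss (M ℕ.+ a ℕ.+ s) (a ℕ.+ b ℕ.+ s)))
    z≡ : ∀ n → z n ≡ + L ℤ.- + (a ℕ.+ b ℕ.+ n)
    z≡ n = ≡.trans (assoc (+ L) (+ (a ℕ.+ b)) (+ n)) (≡.cong (λ x → + L ℤ.- x) (≡.sym (ℤₚ.pos-+ (a ℕ.+ b) n)))
      where
      assoc : ∀ x y w → x ℤ.- y ℤ.- w ≡ x ℤ.- (y ℤ.+ w)
      assoc = ℤ-RingSolver.solve-∀

    second : ∀ n s → isEven (z n) ≡ true → half (z n) ≡ + s →
      bracket p (+ M ℤ.- + b ℤ.+ half (+ L ℤ.+ + (a ℕ.+ b) ℤ.- + n)) (+ M ℤ.- + b) ≈ gauss (M ℕ.+ a ℕ.+ s) (a ℕ.+ b ℕ.+ s)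
    second n s even half≡ with ℕₚ.≤-<-connex b M
    -- For b > M the lower index M - b is negative and the bracket is 0; the complemented Gaussian
    -- is 0 too, as M + a + s < a + b + s.
    ... | inj₂ M<b = trans (reflexive (≡.cong (bracket p (+ M ℤ.- + b ℤ.+ half (+ L ℤ.+ + (a ℕ.+ b) ℤ.- + n))) negative)) (trans (bracket-negʳ p (+ M ℤ.- + b ℤ.+ half (+ L ℤ.+ + (a ℕ.+ b) ℤ.- + n)) (b ∸ suc M))
            (sym (gauss-> (ℕₚ.+-monoˡ-< s (≡.subst (_< a ℕ.+ b) (ℕₚ.+-comm a M) (ℕₚ.+-monoʳ-< a M<b))))))
      where
      negative : + M ℤ.- + b ≡ -[1+ b ∸ suc M ]
      negative = ≡.trans (ℤₚ.m-n≡m⊖n M b) (≡.trans (ℤₚ.⊖-< M<b) (≡.cong (λ x → ℤ.- (+ x)) (ℕₚ.+-∸-assoc 1 M<b)))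
    ... | inj₁ b≤M with ℕₚ.m≤n⇒∃[o]m+o≡n b≤M
    ... | d , ≡.refl = trans (bracket-≡ p {n = d ℕ.+ (s ℕ.+ (a ℕ.+ b))} {k = d} upper M-b)
            (trans (gauss-sym d (s ℕ.+ (a ℕ.+ b))) (gauss-≡ (lemma₁ d s a b) (lemma₂ s a b)))
      where
      lemma₁ : ∀ d s a b → d ℕ.+ (s ℕ.+ (a ℕ.+ b)) ≡ b ℕ.+ d ℕ.+ a ℕ.+ s
      lemma₁ = solve-∀
      lemma₂ : ∀ s a b → s ℕ.+ (a ℕ.+ b) ≡ a ℕ.+ b ℕ.+ s
      lemma₂ = solve-∀
      M-b : + (b ℕ.+ d) ℤ.- + b ≡ + d
      M-b = ≡.trans (≡.cong (ℤ._- + b) (ℤₚ.pos-+ b d)) (cancel (+ b) (+ d))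
        where
        cancel : ∀ b d → b ℤ.+ d ℤ.- b ≡ d
        cancel = ℤ-RingSolver.solve-∀
      upper : + (b ℕ.+ d) ℤ.- + b ℤ.+ half (+ L ℤ.+ + (a ℕ.+ b) ℤ.- + n) ≡ + (d ℕ.+ (s ℕ.+ (a ℕ.+ b)))
      upper = ≡.cong₂ ℤ._+_ M-b (≡.trans (≡.cong half (shift (+ L) (+ (a ℕ.+ b)) (+ n)))
                (≡.trans (half-shift (z n) (+ (a ℕ.+ b)) even) (≡.cong (ℤ._+ + (a ℕ.+ b)) half≡)))
        where
        shift : ∀ L A n → L ℤ.+ A ℤ.- n ≡ L ℤ.- A ℤ.- n ℤ.+ (A ℤ.+ A)
        shift = ℤ-RingSolver.solve-∀

    pos : ∀ n s → a ℕ.+ b ℕ.+ n ℕ.+ 2 ℕ.* s ≡ L → isEven (z n) ≡ true → half (z n) ≡ + s → t n ≈ f n s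
    pos n s _ even half≡ = trans
      (*-cong (*-cong (*-congˡ (bracket-gauss p M n))
        (trans (bracket-≡ p {n = M ℕ.+ b ℕ.+ s} {k = M ℕ.+ b} (≡.cong (ℤ._+_ (+ (M ℕ.+ b))) half≡) ≡.refl) (gauss-sym (M ℕ.+ b) s)))
        (second n s even half≡))
      (solve 4 (λ x y u v → x :* y :* u :* v := x :* (y :* (u :* v))) refl _ _ _ _)

    neg : ∀ n s → isEven (z n) ≡ true → half (z n) ≡ -[1+ s ] → t n ≈ 0#
    neg n s _ half≡ = trans (*-congʳ (trans (*-congˡ (trans
      (reflexive (≡.cong (λ x → bracket p (+ (M ℕ.+ b) ℤ.+ x) (+ (M ℕ.+ b))) half≡))
      (bracket-deficit p (M ℕ.+ b) s))) (zeroʳ _))) (zeroˡ _)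

  trinomial-zero : ∀ B L M a b → L < b → trinomial B L M a b ≈ 0#
  trinomial-zero B L M a b L<b = sumRange-zero B (λ n _ → sumRange-zero B (λ s _ → guard-no (ℕₚ.>⇒≢ (ℕₚ.<-≤-trans L<b (ℕₚ.m≤n+m b _)))))

-- The right-hand side and its recursion in ν.

module TrinomialSums {c ℓ} (R : CommutativeRing c ℓ) (q : CommutativeRing.Carrier R) where
  open CommutativeRing R hiding (zero)
  open QDefs R using (pow; sumRange; trinomialSq; rhs)
  open FiniteSums R
  open Powers R
  open Seed R q using (r; seed; seedTerm)
  open Transformation R r
  open Trinomials R r
  open Gaussian R p using (gauss)
  open SetoidReasoning setoid
  open import Algebra.Solver.Ring.NaturalCoefficients.Default commutativeSemiring
    using (solve; _:*_; _:=_)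

  -- With e = 3 j² ± 2 j the exponent is 3 (ν + 1) j² ± 2 j, and the trinomial is T(L, M; (ν + 1) j,
  -- j). Keeping e apart isolates the part that is constant in ν.
  rhsTerm : (e : ℕ) (ν B L M j : ℕ) → Carrier
  rhsTerm e ν B L M j = pow q (e ℕ.+ ν ℕ.* (3 ℕ.* (j ℕ.* j))) * trinomial B L M (ν ℕ.* j) j

  rhsℕ : (ν B L M : ℕ) → Carrier
  rhsℕ ν B L M = sumRange B (λ j → rhsTerm (e₊ j) ν B L M j) + sumRange B (λ j → rhsTerm (e₋ (suc j)) ν B L M (suc j))

  rhsℕ-zero : ∀ B L M → L < B → rhsℕ 0 B L M ≈ sumRange B (λ m → sumRange B (λ k → seedTerm L M m k))
  rhsℕ-zero B L M L<B = trans
    (+-cong (sumRange-cong′ B (λ j → *-congʳ (pow-≡ q (ℕₚ.+-identityʳ (e₊ j)))))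
            (sumRange-cong′ B (λ j → *-congʳ (pow-≡ q (ℕₚ.+-identityʳ (e₋ (suc j)))))))
    (seed B L M L<B)

  -- `transformation` at a = ν j, b = j: its factor r^(j²) = q^(3 j²) is the growth of the exponent,
  -- and its shift by b is the growth of the first trinomial parameter.
  rhsTerm-suc : ∀ e ν B L M j → L < B → rhsTerm e (suc ν) B L M j ≈
    sumRange (suc L) (λ i → pow r (i ℕ.* i) * gauss (L ℕ.+ M ∸ i) L * rhsTerm e ν B (L ∸ i) i j)
  rhsTerm-suc e ν B L M j L<B = begin
    pow q (e ℕ.+ suc ν ℕ.* S) * trinomial B L M (j ℕ.+ ν ℕ.* j) j
      ≈⟨ *-cong (trans (pow-≡ q (lemma e S (ν ℕ.* S))) (trans (pow-+ q (e ℕ.+ ν ℕ.* S) S) (*-congˡ (sym (pow-pow q 3 (j ℕ.* j))))))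
                (reflexive (≡.cong (λ a → trinomial B L M a j) (ℕₚ.+-comm j (ν ℕ.* j)))) ⟩
    pow q (e ℕ.+ ν ℕ.* S) * pow r (j ℕ.* j) * trinomial B L M (ν ℕ.* j ℕ.+ j) j
      ≈⟨ *-assoc _ _ _ ⟩
    pow q (e ℕ.+ ν ℕ.* S) * (pow r (j ℕ.* j) * trinomial B L M (ν ℕ.* j ℕ.+ j) j)
      ≈⟨ *-congˡ (transformation B L M (ν ℕ.* j) j L<B) ⟨
    pow q (e ℕ.+ ν ℕ.* S) * sumRange (suc L) (λ i → pow r (i ℕ.* i) * gauss (L ℕ.+ M ∸ i) L * trinomial B (L ∸ i) i (ν ℕ.* j) j)
      ≈⟨ trans (sumRange-*ˡ (suc L) _ _) (sumRange-cong′ (suc L) (λ i → solve 3 (λ x y z → x :* (y :* z) := y :* (x :* z)) refl _ _ _)) ⟩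
    sumRange (suc L) (λ i → pow r (i ℕ.* i) * gauss (L ℕ.+ M ∸ i) L * rhsTerm e ν B (L ∸ i) i j) ∎
    where
    S = 3 ℕ.* (j ℕ.* j)
    lemma : ∀ e S T → e ℕ.+ (S ℕ.+ T) ≡ e ℕ.+ T ℕ.+ S
    lemma = solve-∀

  rhsℕ-suc : ∀ ν B L M → L < B → rhsℕ (suc ν) B L M ≈
    sumRange (suc L) (λ i → pow r (i ℕ.* i) * gauss (L ℕ.+ M ∸ i) L * rhsℕ ν B (L ∸ i) i)
  rhsℕ-suc ν B L M L<B = begin
    rhsℕ (suc ν) B L M
      ≈⟨ +-cong (part (λ j → j) e₊) (part suc (e₋ ∘ suc)) ⟩
    sumRange (suc L) (λ i → C i * sumRange B (λ j → rhsTerm (e₊ j) ν B (L ∸ i) i j))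
      + sumRange (suc L) (λ i → C i * sumRange B (λ j → rhsTerm (e₋ (suc j)) ν B (L ∸ i) i (suc j)))
      ≈⟨ sumRange-+ (suc L) _ _ ⟨
    sumRange (suc L) (λ i → C i * sumRange B (λ j → rhsTerm (e₊ j) ν B (L ∸ i) i j)
      + C i * sumRange B (λ j → rhsTerm (e₋ (suc j)) ν B (L ∸ i) i (suc j)))
      ≈⟨ sumRange-cong′ (suc L) (λ i → distribˡ (C i) _ _) ⟨
    sumRange (suc L) (λ i → C i * rhsℕ ν B (L ∸ i) i) ∎
    where
    C : ℕ → Carrier
    C i = pow r (i ℕ.* i) * gauss (L ℕ.+ M ∸ i) L
    part : (g e : ℕ → ℕ) → sumRange B (λ j → rhsTerm (e j) (suc ν) B L M (g j)) ≈
      sumRange (suc L) (λ i → C i * sumRange B (λ j → rhsTerm (e j) ν B (L ∸ i) i (g j)))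
    part g e = trans (sumRange-cong′ B (λ j → rhsTerm-suc (e j) ν B L M (g j) L<B))
      (trans (sumRange-comm B (suc L) _) (sumRange-cong′ (suc L) (λ i → sym (sumRange-*ˡ B (C i) _))))

  rhs≈rhsℕ : ∀ ν L M K → L ≤ K → rhs q ν L M K ≈ rhsℕ ν (suc K) L M
  rhs≈rhsℕ ν L M K L≤K = begin
    F (+ 0) + sumRange K (λ i → F (+ suc i) + F -[1+ i ])
      ≈⟨ +-congˡ (sumRange-+ K _ _) ⟩
    F (+ 0) + (sumRange K (λ i → F (+ suc i)) + sumRange K (λ i → F -[1+ i ]))
      ≈⟨ +-assoc _ _ _ ⟨
    F (+ 0) + sumRange K (λ i → F (+ suc i)) + sumRange K (λ i → F -[1+ i ])
      ≈⟨ +-cong (sym (sumRange-head K (λ j → F (+ j)))) refl ⟩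
    sumRange (suc K) (λ j → F (+ j)) + sumRange K (λ i → F -[1+ i ])
      ≈⟨ +-cong (sumRange-cong′ (suc K) nonneg) (sumRange-cong′ K neg) ⟩
    sumRange (suc K) (λ j → rhsTerm (e₊ j) ν (suc K) L M j) + sumRange K (λ i → rhsTerm (e₋ (suc i)) ν (suc K) L M (suc i))
      -- The bilateral sum stops at -K, while `rhsℕ` with bound `suc K` also includes -(K + 1); that
      -- term vanishes because K + 1 > L.
      ≈⟨ +-congˡ (sumRange-extend (ℕₚ.n≤1+n K) (λ i K≤i → trans (*-congˡ (trinomial-zero (suc K) L M (ν ℕ.* suc i) (suc i) (s≤s (ℕₚ.≤-trans L≤K K≤i)))) (zeroʳ _))) ⟩
    rhsℕ ν (suc K) L M ∎
    where
    exponent : ℤ → ℤ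
    exponent j = (+ (3 ℕ.* suc ν)) ℤ.* j ℤ.* j ℤ.+ (+ 2) ℤ.* j
    F : ℤ → Carrier
    F j = pow q ℤ.∣ exponent j ∣ * trinomialSq r L M ((+ suc ν) ℤ.* j) j

    nonneg : ∀ j → F (+ j) ≈ rhsTerm (e₊ j) ν (suc K) L M j
    nonneg j = *-cong (pow-≡ q (≡.cong ℤ.∣_∣ exponent≡))
      (trans (reflexive (≡.cong (λ a → trinomialSq r L M a (+ j)) (≡.trans (≡.sym (ℤₚ.pos-* (suc ν) j)) (≡.cong +_ (ℕₚ.+-comm j (ν ℕ.* j))))))
             (trinomialSq≈trinomial (suc K) L M (ν ℕ.* j) j (s≤s L≤K)))
      where
      lemma : ∀ ν j → 3 ℕ.* suc ν ℕ.* j ℕ.* j ℕ.+ 2 ℕ.* j ≡ 3 ℕ.* j ℕ.* j ℕ.+ 2 ℕ.* j ℕ.+ ν ℕ.* (3 ℕ.* (j ℕ.* j))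
      lemma = solve-∀
      exponent≡ : exponent (+ j) ≡ + (e₊ j ℕ.+ ν ℕ.* (3 ℕ.* (j ℕ.* j)))
      exponent≡ = ≡.trans (≡.sym (≡.trans (ℤₚ.pos-+ (3 ℕ.* suc ν ℕ.* j ℕ.* j) (2 ℕ.* j))
        (≡.cong₂ ℤ._+_ (≡.trans (ℤₚ.pos-* (3 ℕ.* suc ν ℕ.* j) j) (≡.cong (ℤ._* + j) (ℤₚ.pos-* (3 ℕ.* suc ν) j))) (ℤₚ.pos-* 2 j))))
        (≡.cong +_ (lemma ν j))

    neg : ∀ i → F -[1+ i ] ≈ rhsTerm (e₋ (suc i)) ν (suc K) L M (suc i)
    neg i = *-cong (pow-≡ q (≡.cong ℤ.∣_∣ exponent≡))
      (trans (reflexive (≡.cong (λ a → trinomialSq r L M a -[1+ i ]) (≡.trans (≡.sym (ℤₚ.neg-distribʳ-* (+ suc ν) (+ suc i)))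
               (≡.cong ℤ.-_ (≡.trans (≡.sym (ℤₚ.pos-* (suc ν) (suc i))) (≡.cong +_ (ℕₚ.+-comm (suc i) (ν ℕ.* suc i))))))))
      (trans (trinomialSq-neg L M (+ (ν ℕ.* suc i ℕ.+ suc i)) (+ suc i))
             (trinomialSq≈trinomial (suc K) L M (ν ℕ.* suc i) (suc i) (s≤s L≤K))))
      where
      lemma : ∀ ν i → 3 ℕ.* suc ν ℕ.* suc i ℕ.* suc i
        ≡ 3 ℕ.* i ℕ.* i ℕ.+ 4 ℕ.* i ℕ.+ 1 ℕ.+ ν ℕ.* (3 ℕ.* (suc i ℕ.* suc i)) ℕ.+ 2 ℕ.* suc i
      lemma = solve-∀
      negate : ∀ a s → a ℤ.* (ℤ.- s) ℤ.* (ℤ.- s) ℤ.+ + 2 ℤ.* (ℤ.- s) ≡ a ℤ.* s ℤ.* s ℤ.- + 2 ℤ.* s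
      negate = ℤ-RingSolver.solve-∀
      cancel : ∀ x y → x ℤ.+ y ℤ.- y ≡ x
      cancel = ℤ-RingSolver.solve-∀
      E = e₋ (suc i) ℕ.+ ν ℕ.* (3 ℕ.* (suc i ℕ.* suc i))
      exponent≡ : exponent -[1+ i ] ≡ + E
      exponent≡ = ≡.trans (negate (+ (3 ℕ.* suc ν)) (+ suc i)) (≡.trans (≡.cong₂ ℤ._-_
        (≡.trans (≡.sym (≡.trans (ℤₚ.pos-* (3 ℕ.* suc ν ℕ.* suc i) (suc i)) (≡.cong (ℤ._* + suc i) (ℤₚ.pos-* (3 ℕ.* suc ν) (suc i)))))
          (≡.trans (≡.cong +_ (lemma ν i)) (ℤₚ.pos-+ E (2 ℕ.* suc i))))
        (≡.sym (ℤₚ.pos-* 2 (suc i)))) (cancel (+ E) (+ (2 ℕ.* suc i))))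

-- Partial sums of the N_k, lists and boxes.

accumulate : (ℕ → ℕ) → ℕ → ℕ
accumulate g zero    = 0
accumulate g (suc j) = accumulate g j ℕ.+ g j

accumulate-unique : ∀ {f g : ℕ → ℕ} → f 0 ≡ 0 → (∀ j → f (suc j) ≡ f j ℕ.+ g j) → ∀ j → f j ≡ accumulate g j
accumulate-unique f0 f+ zero    = f0
accumulate-unique f0 f+ (suc j) = ≡.trans (f+ j) (≡.cong (ℕ._+ _) (accumulate-unique f0 f+ j))

accumulate-head : ∀ g j → accumulate g (suc j) ≡ g 0 ℕ.+ accumulate (g ∘ suc) j
accumulate-head g zero    = ≡.sym (ℕₚ.+-identityʳ (g 0))
accumulate-head g (suc j) = ≡.trans (≡.cong (ℕ._+ g (suc j)) (accumulate-head g j)) (ℕₚ.+-assoc (g 0) _ _)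

accumulate-mono : ∀ g {i j} → i ≤ j → accumulate g i ≤ accumulate g j
accumulate-mono g {j = zero}  z≤n = z≤n
accumulate-mono g {i} {suc j} i≤1+j with ℕₚ.m≤n⇒m<n∨m≡n i≤1+j
... | inj₁ (s≤s i≤j) = ℕₚ.≤-trans (accumulate-mono g i≤j) (ℕₚ.m≤m+n _ _)
... | inj₂ ≡.refl    = ℕₚ.≤-refl

suffixSum : List ℕ → ℕ → ℕ
suffixSum ns j = sum (drop j ns)

-- For ns = n₁ ∷ … ∷ n_ν: total ns = N₁ + ⋯ + N_ν and totalSq ns = N₁² + ⋯ + N_ν².
total totalSq : List ℕ → ℕ
total []       = 0
total (n ∷ ns) = n ℕ.+ sum ns ℕ.+ total ns
totalSq []       = 0
totalSq (n ∷ ns) = (n ℕ.+ sum ns) ℕ.* (n ℕ.+ sum ns) ℕ.+ totalSq ns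

accumulate-total : ∀ ns → accumulate (suffixSum ns) (length ns) ≡ total ns
accumulate-total []       = ≡.refl
accumulate-total (n ∷ ns) = ≡.trans (accumulate-head (suffixSum (n ∷ ns)) (length ns)) (≡.cong (n ℕ.+ sum ns ℕ.+_) (accumulate-total ns))

accumulate-totalSq : ∀ ns → accumulate (λ j → suffixSum ns j ℕ.* suffixSum ns j) (length ns) ≡ totalSq ns
accumulate-totalSq []       = ≡.refl
accumulate-totalSq (n ∷ ns) = ≡.trans (accumulate-head (λ j → suffixSum (n ∷ ns) j ℕ.* suffixSum (n ∷ ns) j) (length ns))
  (≡.cong ((n ℕ.+ sum ns) ℕ.* (n ℕ.+ sum ns) ℕ.+_) (accumulate-totalSq ns))

-- This is n_ν, or M when there are no n_i. The carried value is the latest N_k, and N_ν = n_ν.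
lastOr : ℕ → List ℕ → ℕ
lastOr M []       = M
lastOr M (n ∷ ns) = lastOr (n ℕ.+ sum ns) ns

lastOr-nth : ∀ M n ns → lastOr M (n ∷ ns) ≡ nth (n ∷ ns) (length ns)
lastOr-nth M n []        = ℕₚ.+-identityʳ n
lastOr-nth M n (n′ ∷ ns) = lastOr-nth (n ℕ.+ sum (n′ ∷ ns)) n′ ns

module FiniteProducts {c ℓ} (R : CommutativeRing c ℓ) where
  open CommutativeRing R hiding (zero)
  open QDefs R using (sumRange; prodRange; sumBox)
  open FiniteSums R

  prodRange-cong : ∀ n {f g : ℕ → Carrier} → (∀ i → i < n → f i ≈ g i) → prodRange n f ≈ prodRange n g
  prodRange-cong zero    f≈g = refl
  prodRange-cong (suc n) f≈g =
    *-cong (prodRange-cong n (λ i i<n → f≈g i (ℕₚ.m<n⇒m<1+n i<n))) (f≈g n ℕₚ.≤-refl)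

  prodRange-head : ∀ n (f : ℕ → Carrier) → prodRange (suc n) f ≈ f 0 * prodRange n (f ∘ suc)
  prodRange-head zero    f = *-comm _ _
  prodRange-head (suc n) f = trans (*-congʳ (prodRange-head n f)) (*-assoc _ _ _)

  sumBox-cong : ∀ k B {F G : Vector ℕ k → Carrier} → (∀ f → F f ≈ G f) → sumBox k B F ≈ sumBox k B G
  sumBox-cong zero    B F≈G = F≈G _
  sumBox-cong (suc k) B F≈G = sumRange-cong′ (suc B) (λ x → sumBox-cong k B (λ f → F≈G (x VF.∷ f)))

  sumBox-*ˡ : ∀ k B x (F : Vector ℕ k → Carrier) → x * sumBox k B F ≈ sumBox k B (λ f → x * F f)
  sumBox-*ˡ zero    B x F = refl
  sumBox-*ˡ (suc k) B x F = trans (sumRange-*ˡ (suc B) x _) (sumRange-cong′ (suc B) (λ y → sumBox-*ˡ k B x _))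

  sumRange-sumBox-comm : ∀ n k B (F : ℕ → Vector ℕ k → Carrier) →
    sumRange n (λ x → sumBox k B (F x)) ≈ sumBox k B (λ f → sumRange n (λ x → F x f))
  sumRange-sumBox-comm n zero    B F = refl
  sumRange-sumBox-comm n (suc k) B F = trans (sumRange-comm n (suc B) _)
    (sumRange-cong′ (suc B) (λ y → sumRange-sumBox-comm n k B (λ x f → F x (y VF.∷ f))))

-- Access to the local definitions of the left-hand summand.

module LhsTerms {c ℓ} (R : CommutativeRing c ℓ) (q : CommutativeRing.Carrier R) where
  open CommutativeRing R using (Carrier; 0#; _*_)
  open QDefs R using (pow; bracket; prodRange; lhsTerm)

  -- The body of `lhsTerm` with its local sums turned into parameters, so that they can be rewritten
  -- to closed forms.
  lhsBody : (ν L M m : ℕ) (ns : List ℕ) (S SQ : ℕ) (partial : ℕ → ℕ) → Carrier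
  lhsBody ν L M m ns S SQ partial =
    if isEven (+ L ℤ.+ + m ℤ.- + S)
    then pow q (m ℕ.* m ℕ.+ 3 ℕ.* SQ)
         * bracket (pow q 6) (+ L ℤ.+ + M ℤ.- + suffixSum ns 0) (+ L)
         * bracket (pow q 2) (+ (3 ℕ.* nth ns (ν ∸ 1))) (+ m)
         * bracket (pow q 6) (+ (2 ℕ.* nth ns (ν ∸ 1)) ℤ.+ half (+ L ℤ.- + m ℤ.- + S)) (+ (2 ℕ.* nth ns (ν ∸ 1)))
         * prodRange (ν ∸ 1) (λ i →
              bracket (pow q 6) (+ L ℤ.- + (partial i ℕ.+ suffixSum ns i) ℤ.+ + nth ns i) (+ nth ns i))
    else 0#

  -- The functions partial and partialSq local to lhsTerm have no name outside Defs, so they are left to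
  -- unification. Abstracting over suc ν and ℕ._+_ separates the bound of the recursion from the parameter ν
  -- and blocks the reduction of sums, which makes the unification problem a pattern.
  mutual
    partialOf partialSqOf : (ν L M m : ℕ) (ns : List ℕ) → ℕ → ℕ
    partialOf ν L M m ns j = _
    partialSqOf ν L M m ns j = _

    lhsTerm-body : ∀ ν L M m ns → lhsTerm q (suc ν) L M m ns ≡
      lhsBody (suc ν) L M m ns
        (partialOf (suc ν) L M m ns ν ℕ.+ suffixSum ns ν)
        (partialSqOf (suc ν) L M m ns ν ℕ.+ suffixSum ns ν ℕ.* suffixSum ns ν)
        (partialOf (suc ν) L M m ns)
    lhsTerm-body ν L M m ns with suc ν | ℕ._+_
    ... | _ | _ = ≡.refl

  partialOf-accumulate : ∀ ν L M m ns j → partialOf ν L M m ns j ≡ accumulate (suffixSum ns) j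
  partialOf-accumulate ν L M m ns = accumulate-unique ≡.refl (λ _ → ≡.refl)

  partialSqOf-accumulate : ∀ ν L M m ns j →
    partialSqOf ν L M m ns j ≡ accumulate (λ j → suffixSum ns j ℕ.* suffixSum ns j) j
  partialSqOf-accumulate ν L M m ns = accumulate-unique ≡.refl (λ _ → ≡.refl)

-- Peeling the multisum and the induction on ν.

module Multisums {c ℓ} (R : CommutativeRing c ℓ) (q : CommutativeRing.Carrier R) where
  open CommutativeRing R hiding (zero)
  open QDefs R using (pow; sumRange; prodRange; sumBox; bracket; lhsTerm; lhs)
  open FiniteSums R
  open FiniteProducts R
  open Powers R
  open EvenSums R
  open LhsTerms R q
  open Seed R q using (r; p≈q⁶; seedTerm)
  open Transformation R r using (p)
  open Gaussian R p
  open TrinomialSums R q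
  open SetoidReasoning setoid
  open import Algebra.Solver.Ring.NaturalCoefficients.Default commutativeSemiring
    using (solve; _:*_; _:=_)

  -- The product of coefficients collected by iterating the transformation, each step replacing (L,
  -- M) by (L - N, N).
  chain : (L M : ℕ) → List ℕ → Carrier
  chain L M []       = 1#
  chain L M (n ∷ ns) = pow r (N ℕ.* N) * gauss (L ℕ.+ M ∸ N) L * chain (L ∸ N) N ns
    where N = n ℕ.+ sum ns

  -- The summand of the case ν = 0 with k for M; in the multisum k is n_ν.
  core : (k m s : ℕ) → Carrier
  core k m s = pow q (m ℕ.* m) * (QDefs.gauss R (pow q 2) (3 ℕ.* k) m * gauss (2 ℕ.* k ℕ.+ s) s)

  -- lhsTerm, with (L - m - N₁ - ⋯ - N_ν) / 2 as a summation variable.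
  summand : (B L M m : ℕ) → List ℕ → Carrier
  summand B L M m ns = sumRange B (λ s → guard (m ℕ.+ total ns ℕ.+ 2 ℕ.* s) L (core (lastOr M ns) m s * chain L M ns))

  -- Since the new M is N = n + N′, the next coefficient has the Gaussian [(L - N) + N - N′; L - N]
  -- = [L - N + n; n]. Hence every coefficient after the first yields one factor of the product in
  -- the theorem.
  chain-product : ∀ n ns L M → chain L M (n ∷ ns) ≈
    pow q (3 ℕ.* totalSq (n ∷ ns)) * (gauss (L ℕ.+ M ∸ (n ℕ.+ sum ns)) L * prodRange (length ns) (λ i →
      gauss (L ∸ (accumulate (suffixSum (n ∷ ns)) i ℕ.+ suffixSum (n ∷ ns) i) ℕ.+ nth (n ∷ ns) i) (nth (n ∷ ns) i)))
  chain-product n [] L M = trans (*-identityʳ _)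
    (*-cong (trans (pow-pow q 3 (N ℕ.* N)) (pow-≡ q (≡.cong (3 ℕ.*_) (≡.sym (ℕₚ.+-identityʳ (N ℕ.* N)))))) (sym (*-identityʳ _)))
    where N = n ℕ.+ 0
  chain-product n (n′ ∷ ns) L M = begin
    pow r (N ℕ.* N) * gauss (L ℕ.+ M ∸ N) L * chain (L ∸ N) N (n′ ∷ ns)
      ≈⟨ *-cong (*-congʳ (pow-pow q 3 (N ℕ.* N))) (chain-product n′ ns (L ∸ N) N) ⟩
    pow q (3 ℕ.* (N ℕ.* N)) * gauss (L ℕ.+ M ∸ N) L *
      (pow q (3 ℕ.* totalSq (n′ ∷ ns)) * (gauss (L ∸ N ℕ.+ N ∸ N′) (L ∸ N) * prodRange (length ns) tail))
      ≈⟨ solve 5 (λ a g b h x → a :* g :* (b :* (h :* x)) := (a :* b) :* (g :* (h :* x))) refl _ _ _ _ _ ⟩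
    pow q (3 ℕ.* (N ℕ.* N)) * pow q (3 ℕ.* totalSq (n′ ∷ ns)) *
      (gauss (L ℕ.+ M ∸ N) L * (gauss (L ∸ N ℕ.+ N ∸ N′) (L ∸ N) * prodRange (length ns) tail))
      ≈⟨ *-cong (trans (sym (pow-+ q (3 ℕ.* (N ℕ.* N)) _)) (pow-≡ q (≡.sym (ℕₚ.*-distribˡ-+ 3 (N ℕ.* N) (totalSq (n′ ∷ ns))))))
                (*-congˡ (*-cong first (prodRange-cong (length ns) (λ i _ → gauss-top (nth (n′ ∷ ns) i) (≡.cong (ℕ._+ nth (n′ ∷ ns) i) (shift i)))))) ⟩
    pow q (3 ℕ.* totalSq (n ∷ n′ ∷ ns)) * (gauss (L ℕ.+ M ∸ N) L * (factor 0 * prodRange (length ns) (factor ∘ suc)))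
      ≈⟨ *-congˡ (*-congˡ (prodRange-head (length ns) factor)) ⟨
    pow q (3 ℕ.* totalSq (n ∷ n′ ∷ ns)) * (gauss (L ℕ.+ M ∸ N) L * prodRange (suc (length ns)) factor) ∎
    where
    N′ = n′ ℕ.+ sum ns
    N  = n ℕ.+ N′
    tail factor : ℕ → Carrier
    tail i   = gauss (L ∸ N ∸ (accumulate (suffixSum (n′ ∷ ns)) i ℕ.+ suffixSum (n′ ∷ ns) i) ℕ.+ nth (n′ ∷ ns) i) (nth (n′ ∷ ns) i)
    factor i = gauss (L ∸ (accumulate (suffixSum (n ∷ n′ ∷ ns)) i ℕ.+ suffixSum (n ∷ n′ ∷ ns) i) ℕ.+ nth (n ∷ n′ ∷ ns) i) (nth (n ∷ n′ ∷ ns) i)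
    first : gauss (L ∸ N ℕ.+ N ∸ N′) (L ∸ N) ≈ factor 0
    first = trans (gauss-top (L ∸ N) (≡.trans (≡.cong (_∸ N′) (≡.sym (ℕₚ.+-assoc (L ∸ N) n N′))) (ℕₚ.m+n∸n≡m (L ∸ N ℕ.+ n) N′))) (gauss-sym (L ∸ N) n)
    shift : ∀ i → L ∸ N ∸ (accumulate (suffixSum (n′ ∷ ns)) i ℕ.+ suffixSum (n′ ∷ ns) i)
                ≡ L ∸ (accumulate (suffixSum (n ∷ n′ ∷ ns)) (suc i) ℕ.+ suffixSum (n ∷ n′ ∷ ns) (suc i))
    shift i = ≡.trans (ℕₚ.∸-+-assoc L N _) (≡.cong (L ∸_) (≡.trans (≡.sym (ℕₚ.+-assoc N (accumulate (suffixSum (n′ ∷ ns)) i) _))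
      (≡.cong (ℕ._+ suffixSum (n′ ∷ ns) i) (≡.sym (accumulate-head (suffixSum (n ∷ n′ ∷ ns)) i)))))

  lhsTerm≈summand : ∀ B L M m n ns → L < B → lhsTerm q (suc (length ns)) L M m (n ∷ ns) ≈ summand B L M m (n ∷ ns)
  lhsTerm≈summand B L M m n ns L<B = begin
    lhsTerm q (suc ν) L M m (n ∷ ns)
      ≡⟨ lhsTerm-body ν L M m (n ∷ ns) ⟩
    lhsBody (suc ν) L M m (n ∷ ns) (partialOf (suc ν) L M m (n ∷ ns) ν ℕ.+ suffixSum (n ∷ ns) ν)
        (partialSqOf (suc ν) L M m (n ∷ ns) ν ℕ.+ suffixSum (n ∷ ns) ν ℕ.* suffixSum (n ∷ ns) ν) part
      ≡⟨ ≡.cong₂ (λ S SQ → lhsBody (suc ν) L M m (n ∷ ns) S SQ part) S≡ SQ≡ ⟩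
    (if isEven (+ L ℤ.+ + m ℤ.- + Tot) then t else 0#)
      -- The parity test is on L + m - S but the halved number is L - m - S; they differ by 2 m.
      ≡⟨ ≡.cong (λ b → if b then t else 0#) (≡.trans (≡.cong isEven (lemma (+ L) (+ m) (+ Tot))) (isEven-shift z (+ m))) ⟩
    (if isEven z then t else 0#)
      ≈⟨ even-sum B L (m ℕ.+ Tot) z t (λ s → core k m s * chain L M (n ∷ ns)) L<B z≡ pos neg ⟩
    summand B L M m (n ∷ ns) ∎
    where
    ν = length ns
    N = n ℕ.+ sum ns
    Tot = total (n ∷ ns)
    k = lastOr M (n ∷ ns)
    Q = pow q 6
    part : ℕ → ℕ
    part = partialOf (suc ν) L M m (n ∷ ns)
    part≡ : ∀ i → part i ≡ accumulate (suffixSum (n ∷ ns)) i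
    part≡ = partialOf-accumulate (suc ν) L M m (n ∷ ns)
    S≡ : part ν ℕ.+ suffixSum (n ∷ ns) ν ≡ Tot
    S≡ = ≡.trans (≡.cong (ℕ._+ suffixSum (n ∷ ns) ν) (part≡ ν)) (accumulate-total (n ∷ ns))
    SQ≡ : partialSqOf (suc ν) L M m (n ∷ ns) ν ℕ.+ suffixSum (n ∷ ns) ν ℕ.* suffixSum (n ∷ ns) ν ≡ totalSq (n ∷ ns)
    SQ≡ = ≡.trans (≡.cong (ℕ._+ suffixSum (n ∷ ns) ν ℕ.* suffixSum (n ∷ ns) ν) (partialSqOf-accumulate (suc ν) L M m (n ∷ ns) ν)) (accumulate-totalSq (n ∷ ns))
    z : ℤ
    z = + L ℤ.- + m ℤ.- + Tot
    z≡ : z ≡ + L ℤ.- + (m ℕ.+ Tot)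
    z≡ = ≡.trans (assoc (+ L) (+ m) (+ Tot)) (≡.cong (λ x → + L ℤ.- x) (≡.sym (ℤₚ.pos-+ m Tot)))
      where
      assoc : ∀ x y w → x ℤ.- y ℤ.- w ≡ x ℤ.- (y ℤ.+ w)
      assoc = ℤ-RingSolver.solve-∀
    lemma : ∀ L m t → L ℤ.+ m ℤ.- t ≡ L ℤ.- m ℤ.- t ℤ.+ (m ℤ.+ m)
    lemma = ℤ-RingSolver.solve-∀
    factor : ℕ → Carrier
    factor i = bracket Q (+ L ℤ.- + (part i ℕ.+ suffixSum (n ∷ ns) i) ℤ.+ + nth (n ∷ ns) i) (+ nth (n ∷ ns) i)
    t : Carrier
    t = pow q (m ℕ.* m ℕ.+ 3 ℕ.* totalSq (n ∷ ns)) * bracket Q (+ L ℤ.+ + M ℤ.- + N) (+ L)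
      * bracket (pow q 2) (+ (3 ℕ.* nth (n ∷ ns) ν)) (+ m)
      * bracket Q (+ (2 ℕ.* nth (n ∷ ns) ν) ℤ.+ half z) (+ (2 ℕ.* nth (n ∷ ns) ν))
      * prodRange ν factor

    pos-∸ : ∀ {x y} → y ≤ x → + x ℤ.- + y ≡ + (x ∸ y)
    pos-∸ {x} {y} y≤x = ≡.trans (ℤₚ.m-n≡m⊖n x y) (ℤₚ.⊖-≥ y≤x)

    toP : ∀ {x y} a b → x ≡ + a → y ≡ + b → bracket Q x y ≈ gauss a b
    toP a b x≡ y≡ = trans (bracket-≡ Q {n = a} {k = b} x≡ y≡) (gauss-cong (sym p≈q⁶) a b)

    k≡ : nth (n ∷ ns) ν ≡ k
    k≡ = ≡.sym (lastOr-nth M n ns)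

    pos : ∀ s → m ℕ.+ Tot ℕ.+ 2 ℕ.* s ≡ L → isEven z ≡ true → half z ≡ + s → t ≈ core k m s * chain L M (n ∷ ns)
    pos s eq _ half≡ = begin
      t
        ≈⟨ *-cong (*-cong (*-cong (*-cong (pow-+ q (m ℕ.* m) _) (toP (L ℕ.+ M ∸ N) L (pos-∸ (ℕₚ.≤-trans N≤L (ℕₚ.m≤m+n L M))) ≡.refl))
             (trans (bracket-gauss (pow q 2) (3 ℕ.* nth (n ∷ ns) ν) m) (reflexive (≡.cong (λ k → QDefs.gauss R (pow q 2) (3 ℕ.* k) m) k≡))))
             (trans (toP (2 ℕ.* nth (n ∷ ns) ν ℕ.+ s) (2 ℕ.* nth (n ∷ ns) ν) (≡.cong (ℤ._+_ (+ (2 ℕ.* nth (n ∷ ns) ν))) half≡) ≡.refl)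
               (trans (gauss-sym (2 ℕ.* nth (n ∷ ns) ν) s) (gauss-top s (≡.cong (λ k → 2 ℕ.* k ℕ.+ s) k≡)))))
             (prodRange-cong ν factor≈) ⟩
      pow q (m ℕ.* m) * pow q (3 ℕ.* totalSq (n ∷ ns)) * gauss (L ℕ.+ M ∸ N) L * QDefs.gauss R (pow q 2) (3 ℕ.* k) m * gauss (2 ℕ.* k ℕ.+ s) s * prodRange ν factor′
        ≈⟨ solve 6 (λ a b g h u x → a :* b :* g :* h :* u :* x := (a :* (h :* u)) :* (b :* (g :* x))) refl _ _ _ _ _ _ ⟩
      core k m s * (pow q (3 ℕ.* totalSq (n ∷ ns)) * (gauss (L ℕ.+ M ∸ N) L * prodRange ν factor′))
        ≈⟨ *-congˡ (chain-product n ns L M) ⟨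
      core k m s * chain L M (n ∷ ns) ∎
      where
      -- The weight equation bounds all partial sums by L, so the integer differences in the
      -- brackets agree with truncated ones.
      Tot≤L : Tot ≤ L
      Tot≤L = ℕₚ.≤-trans (ℕₚ.≤-trans (ℕₚ.m≤n+m Tot m) (ℕₚ.m≤m+n (m ℕ.+ Tot) (2 ℕ.* s))) (ℕₚ.≤-reflexive eq)
      N≤L : N ≤ L
      N≤L = ℕₚ.≤-trans (ℕₚ.m≤m+n N (total ns)) Tot≤L
      factor′ : ℕ → Carrier
      factor′ i = gauss (L ∸ (accumulate (suffixSum (n ∷ ns)) i ℕ.+ suffixSum (n ∷ ns) i) ℕ.+ nth (n ∷ ns) i) (nth (n ∷ ns) i)
      factor≈ : ∀ i → i < ν → factor i ≈ factor′ i
      factor≈ i i<ν = toP _ _ (≡.cong (ℤ._+ + nth (n ∷ ns) i) (≡.trans (≡.cong (λ x → + L ℤ.- + (x ℕ.+ suffixSum (n ∷ ns) i)) (part≡ i)) (pos-∸ below))) ≡.refl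
        where
        below : accumulate (suffixSum (n ∷ ns)) (suc i) ≤ L
        below = ℕₚ.≤-trans (accumulate-mono (suffixSum (n ∷ ns)) (ℕₚ.m≤n⇒m≤1+n i<ν)) (ℕₚ.≤-trans (ℕₚ.≤-reflexive (accumulate-total (n ∷ ns))) Tot≤L)

    neg : ∀ s → isEven z ≡ true → half z ≡ -[1+ s ] → t ≈ 0#
    neg s _ half≡ = trans (*-congʳ (trans (*-congˡ (trans
      (reflexive (≡.cong (λ x → bracket Q (+ (2 ℕ.* nth (n ∷ ns) ν) ℤ.+ x) (+ (2 ℕ.* nth (n ∷ ns) ν))) half≡))
      (bracket-deficit Q (2 ℕ.* nth (n ∷ ns) ν) s))) (zeroʳ _))) (zeroˡ _)

  -- The cut at N ≤ L is essential: for N > L truncation turns L - N into 0, and both the Gaussian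
  -- and the remaining sum may then be nonzero.
  coefficient : (L M N : ℕ) → Carrier
  coefficient L M N with N ℕₚ.≤? L
  ... | yes _ = pow r (N ℕ.* N) * gauss (L ℕ.+ M ∸ N) L
  ... | no _  = 0#

  coefficient-≤ : ∀ {L M N} → N ≤ L → coefficient L M N ≈ pow r (N ℕ.* N) * gauss (L ℕ.+ M ∸ N) L
  coefficient-≤ {L} {M} {N} N≤L with N ℕₚ.≤? L
  ... | yes _  = refl
  ... | no N≰L = contradiction N≤L N≰L

  coefficient-> : ∀ {L M N} → L < N → coefficient L M N ≈ 0#
  coefficient-> {L} {M} {N} L<N with N ℕₚ.≤? L
  ... | yes N≤L = contradiction N≤L (ℕₚ.<⇒≱ L<N)
  ... | no _    = refl

  coefficient-M : ∀ {L M N} → M < N → coefficient L M N ≈ 0#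
  coefficient-M {L} {M} {N} M<N with N ℕₚ.≤? L
  ... | yes N≤L = trans (*-congˡ (gauss-> (ℕₚ.m<n+o⇒m∸n<o (L ℕ.+ M) N {{ℕ.>-nonZero (ℕₚ.≤-trans (s≤s z≤n) (ℕₚ.≤-trans M<N N≤L))}}
                    (≡.subst (L ℕ.+ M <_) (ℕₚ.+-comm L N) (ℕₚ.+-monoʳ-< L M<N))))) (zeroʳ _)
  ... | no _    = refl

  summand-∷ : ∀ B L M m n ns → summand B L M m (n ∷ ns) ≈ coefficient L M (n ℕ.+ sum ns) * summand B (L ∸ (n ℕ.+ sum ns)) (n ℕ.+ sum ns) m ns
  summand-∷ B L M m n ns with ℕₚ.≤-<-connex (n ℕ.+ sum ns) L
  ... | inj₂ L<N = trans (sumRange-zero B (λ s _ → guard-no (ℕₚ.>⇒≢ (ℕₚ.<-≤-trans L<N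
          (ℕₚ.≤-trans (ℕₚ.m≤m+n N (m ℕ.+ total ns ℕ.+ 2 ℕ.* s)) (ℕₚ.≤-reflexive (lemma N m (total ns) s)))))))
          (sym (trans (*-congʳ (coefficient-> {L} {M} L<N)) (zeroˡ _)))
    where
    N = n ℕ.+ sum ns
    lemma : ∀ N m T s → N ℕ.+ (m ℕ.+ T ℕ.+ 2 ℕ.* s) ≡ m ℕ.+ (N ℕ.+ T) ℕ.+ 2 ℕ.* s
    lemma = solve-∀
  ... | inj₁ N≤L = sym (begin
    coefficient L M N * summand B (L ∸ N) N m ns
      ≈⟨ *-congʳ (coefficient-≤ {L} {M} N≤L) ⟩
    pow r (N ℕ.* N) * gauss (L ℕ.+ M ∸ N) L * summand B (L ∸ N) N m ns
      ≈⟨ sumRange-*ˡ B _ _ ⟩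
    sumRange B (λ s → pow r (N ℕ.* N) * gauss (L ℕ.+ M ∸ N) L * guard (w s) (L ∸ N) (core k m s * chain (L ∸ N) N ns))
      ≈⟨ sumRange-cong′ B (λ s → trans (guard-*ˡ (w s) (L ∸ N) _ _) (trans (guard-iff (to s) (from s))
           (guard-cong (λ _ → solve 3 (λ x y z → x :* (y :* z) := y :* (x :* z)) refl _ _ _)))) ⟩
    summand B L M m (n ∷ ns) ∎)
    where
    N = n ℕ.+ sum ns
    k = lastOr N ns
    w : ℕ → ℕ
    w s = m ℕ.+ total ns ℕ.+ 2 ℕ.* s
    lemma : ∀ N m T s → N ℕ.+ (m ℕ.+ T ℕ.+ 2 ℕ.* s) ≡ m ℕ.+ (N ℕ.+ T) ℕ.+ 2 ℕ.* s
    lemma = solve-∀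
    to : ∀ s → w s ≡ L ∸ N → m ℕ.+ (N ℕ.+ total ns) ℕ.+ 2 ℕ.* s ≡ L
    to s eq = ≡.trans (≡.sym (lemma N m (total ns) s)) (≡.trans (≡.cong (N ℕ.+_) eq) (ℕₚ.m+[n∸m]≡n N≤L))
    from : ∀ s → m ℕ.+ (N ℕ.+ total ns) ℕ.+ 2 ℕ.* s ≡ L → w s ≡ L ∸ N
    from s eq = ≡.trans (≡.sym (ℕₚ.m+n∸m≡n N (w s))) (≡.cong (_∸ N) (≡.trans (lemma N m (total ns) s) eq))

  -- If N₂ = sum ns exceeds N, the leading Gaussian of `chain` has too small an upper index. This
  -- allows the free index n₁ to be replaced by N₁ without the constraint N₁ ≥ N₂.
  summand-zero : ∀ B L N m ns → N < sum ns → summand B L N m ns ≈ 0#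
  summand-zero B L N m (n ∷ ns) N<N′ = sumRange-zero B (λ s _ → guard-zero (λ eq → trans (*-congˡ (trans (*-congʳ (trans (*-congˡ (gauss-> (below s eq)))
      (zeroʳ _))) (zeroˡ _))) (zeroʳ _)))
    where
    N′ = n ℕ.+ sum ns
    below : ∀ s → m ℕ.+ (N′ ℕ.+ total ns) ℕ.+ 2 ℕ.* s ≡ L → L ℕ.+ N ∸ N′ < L
    below s eq = ℕₚ.m<n+o⇒m∸n<o (L ℕ.+ N) N′ {{ℕ.>-nonZero (ℕₚ.≤-trans (s≤s z≤n) (ℕₚ.≤-trans N<N′ N′≤L))}}
      (≡.subst (L ℕ.+ N <_) (ℕₚ.+-comm L N′) (ℕₚ.+-monoʳ-< L N<N′))
      where
      N′≤L : N′ ≤ L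
      N′≤L = ℕₚ.≤-trans (ℕₚ.≤-trans (ℕₚ.m≤m+n N′ (total ns)) (ℕₚ.≤-trans (ℕₚ.m≤n+m (N′ ℕ.+ total ns) m) (ℕₚ.m≤m+n _ (2 ℕ.* s)))) (ℕₚ.≤-reflexive eq)

  -- The value at ν = 0, with M in place of n_ν, is the base of the induction. `A` bounds m and the
  -- n_i, and `B` bounds s.
  multisum : (B A ν L M : ℕ) → Carrier
  multisum B A ν L M = sumRange (suc A) (λ m → sumBox ν A (λ f → summand B L M m (VF.toList f)))

  -- For fixed n₂, ..., n_ν the variable n₁ becomes N₁. The ranges N₁ ≤ A and N₁ ≤ L are
  -- interchangeable, as `coefficient` vanishes for N₁ > M and for N₁ > L.
  multisum-suc : ∀ B A ν L M → M ≤ A → multisum B A (suc ν) L M ≈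
    sumRange (suc L) (λ N → pow r (N ℕ.* N) * gauss (L ℕ.+ M ∸ N) L * multisum B A ν (L ∸ N) N)
  multisum-suc B A ν L M M≤A = begin
    sumRange (suc A) (λ m → sumRange (suc A) (λ n → sumBox ν A (λ f → summand B L M m (n ∷ VF.toList f))))
      ≈⟨ sumRange-cong′ (suc A) (λ m → trans (sumRange-sumBox-comm (suc A) ν A _) (sumBox-cong ν A (λ f → shift m (VF.toList f)))) ⟩
    sumRange (suc A) (λ m → sumBox ν A (λ f → sumRange (suc A) (λ N → coefficient L M N * summand B (L ∸ N) N m (VF.toList f))))
      ≈⟨ sumRange-cong′ (suc A) (λ m → sym (sumRange-sumBox-comm (suc A) ν A _)) ⟩
    sumRange (suc A) (λ m → sumRange (suc A) (λ N → sumBox ν A (λ f → coefficient L M N * summand B (L ∸ N) N m (VF.toList f))))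
      ≈⟨ sumRange-comm (suc A) (suc A) _ ⟩
    sumRange (suc A) (λ N → sumRange (suc A) (λ m → sumBox ν A (λ f → coefficient L M N * summand B (L ∸ N) N m (VF.toList f))))
      ≈⟨ sumRange-cong′ (suc A) (λ N → trans (sumRange-cong′ (suc A) (λ m → sym (sumBox-*ˡ ν A _ _))) (sym (sumRange-*ˡ (suc A) _ _))) ⟩
    sumRange (suc A) (λ N → coefficient L M N * multisum B A ν (L ∸ N) N)
      ≈⟨ sumRange-resize (suc A) (suc L) (λ N A<N → trans (*-congʳ (coefficient-M {L} (ℕₚ.≤-<-trans M≤A A<N))) (zeroˡ _))
           (λ N L<N → trans (*-congʳ (coefficient-> {L} {M} L<N)) (zeroˡ _)) ⟩
    sumRange (suc L) (λ N → coefficient L M N * multisum B A ν (L ∸ N) N)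
      ≈⟨ sumRange-cong (suc L) (λ { N (s≤s N≤L) → *-congʳ (coefficient-≤ {L} {M} N≤L) }) ⟩
    sumRange (suc L) (λ N → pow r (N ℕ.* N) * gauss (L ℕ.+ M ∸ N) L * multisum B A ν (L ∸ N) N) ∎
    where
    shift : ∀ m ns → sumRange (suc A) (λ n → summand B L M m (n ∷ ns)) ≈ sumRange (suc A) (λ N → coefficient L M N * summand B (L ∸ N) N m ns)
    shift m ns = sym (trans
      (sumRange-shift (suc A) (sum ns) (λ N N<sum → trans (*-congˡ (summand-zero B (L ∸ N) N m ns N<sum)) (zeroʳ _))
        (λ N A<N → trans (*-congʳ (coefficient-M {L} (ℕₚ.≤-<-trans M≤A A<N))) (zeroˡ _)))
      (sumRange-cong′ (suc A) (λ n → trans (reflexive (≡.cong (λ N → coefficient L M N * summand B (L ∸ N) N m ns) (ℕₚ.+-comm (sum ns) n)))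
        (sym (summand-∷ B L M m n ns)))))

  multisum-zero : ∀ B A L M → 3 ℕ.* M ≤ A → L < B → multisum B A 0 L M ≈ sumRange B (λ m → sumRange B (λ s → seedTerm L M m s))
  multisum-zero B A L M 3M≤A L<B = trans
    (sumRange-cong′ (suc A) (λ m → sumRange-cong′ B (λ s → trans (guard-iff (≡.trans (lemma m s)) (≡.trans (≡.sym (lemma m s)))) (guard-cong (λ _ → *-identityʳ _)))))
    (sumRange-resize (suc A) B
      -- Here 3 M ≤ A is used: the Gaussian [3M; m] in base q² is zero beyond the cut-off.
      (λ m A<m → sumRange-zero B (λ s _ → guard-zero (λ _ → trans (*-congˡ (trans (*-congʳ (Gaussian.gauss-> R (pow q 2) (ℕₚ.≤-<-trans 3M≤A A<m))) (zeroˡ _))) (zeroʳ _))))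
      (λ m B≤m → sumRange-zero B (λ s _ → guard-no (ℕₚ.>⇒≢ (ℕₚ.<-≤-trans L<B (ℕₚ.≤-trans B≤m (ℕₚ.m≤m+n m (2 ℕ.* s))))))))
    where
    lemma : ∀ m s → m ℕ.+ 2 ℕ.* s ≡ m ℕ.+ 0 ℕ.+ 2 ℕ.* s
    lemma = solve-∀

  multisum≈rhsℕ : ∀ B A ν L M → 3 ℕ.* M ≤ A → L < B → multisum B A ν L M ≈ rhsℕ ν B L M
  multisum≈rhsℕ B A zero    L M 3M≤A L<B = trans (multisum-zero B A L M 3M≤A L<B) (sym (rhsℕ-zero B L M L<B))
  multisum≈rhsℕ B A (suc ν) L M 3M≤A L<B = trans (multisum-suc B A ν L M (ℕₚ.≤-trans (ℕₚ.m≤n*m M 3) 3M≤A))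
    (trans (sumRange-cong (suc L) step) (sym (rhsℕ-suc ν B L M L<B)))
    where
    step : ∀ N → N < suc L → pow r (N ℕ.* N) * gauss (L ℕ.+ M ∸ N) L * multisum B A ν (L ∸ N) N
                           ≈ pow r (N ℕ.* N) * gauss (L ℕ.+ M ∸ N) L * rhsℕ ν B (L ∸ N) N
    -- The hypothesis at (L - N, N) requires 3 N ≤ A, which follows from N ≤ M; for larger N the
    -- coefficient vanishes on both sides.
    step N (s≤s N≤L) with ℕₚ.≤-<-connex N M
    ... | inj₁ N≤M = *-congˡ (multisum≈rhsℕ B A ν (L ∸ N) N (ℕₚ.≤-trans (ℕₚ.*-monoʳ-≤ 3 N≤M) 3M≤A) (ℕₚ.≤-<-trans (ℕₚ.m∸n≤m L N) L<B))
    ... | inj₂ M<N = trans (*-congʳ vanish) (trans (zeroˡ _) (sym (trans (*-congʳ vanish) (zeroˡ _))))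
      where
      vanish : pow r (N ℕ.* N) * gauss (L ℕ.+ M ∸ N) L ≈ 0#
      vanish = trans (sym (coefficient-≤ {L} {M} N≤L)) (coefficient-M {L} M<N)

  lhs≈multisum : ∀ B A ν L M → L < B → lhs q (suc ν) L M A ≈ multisum B A (suc ν) L M
  lhs≈multisum B A ν L M L<B = sumRange-cong′ (suc A) (λ m → sumBox-cong (suc ν) A (λ f →
    trans (reflexive (≡.cong (λ k → lhsTerm q (suc k) L M m (VF.toList f)) (≡.sym (Listₚ.length-tabulate (f ∘ Fin.suc)))))
          (lhsTerm≈summand B L M m (f Fin.zero) (VF.toList (f ∘ Fin.suc)) L<B)))

open import Data.Nat using (_*_)

theorem5p1 : ∀ {c ℓ} (R : CommutativeRing c ℓ) (q : CommutativeRing.Carrier R)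
    (ν L M B K : ℕ) → 1 ≤ ν → 3 * M ≤ B → L ≤ K →
    CommutativeRing._≈_ R (QDefs.lhs R q ν L M B) (QDefs.rhs R q ν L M K)
theorem5p1 R q (suc ν) L M B K _ 3M≤B L≤K = begin
  -- The single bound `suc K` > L serves for s on the left and for j on the right.
  QDefs.lhs R q (suc ν) L M B   ≈⟨ lhs≈multisum (suc K) B ν L M (s≤s L≤K) ⟩
  multisum (suc K) B (suc ν) L M ≈⟨ multisum≈rhsℕ (suc K) B (suc ν) L M 3M≤B (s≤s L≤K) ⟩
  rhsℕ (suc ν) (suc K) L M      ≈⟨ rhs≈rhsℕ (suc ν) L M K L≤K ⟨
  QDefs.rhs R q (suc ν) L M K   ∎
  where
  open Multisums R q
  open TrinomialSums R q
  open SetoidReasoning (CommutativeRing.setoid R)
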